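{- Let $\varepsilon>0$ be fixed. There is $p_0(\varepsilon)$ such that the following holds for every prime $p>p_0(\varepsilon)$. Let $\mathcal{I}$ and $\mathcal{J}$ be nonzero intervals of $\mathbb{F}_p$ such that $$|\mathcal{I}|^2\cdot|\mathcal{J}|>p^{1+\varepsilon},\qquad |\mathcal{I}|\cdot|\mathcal{J}|^2>p^{1+\varepsilon}.$$ Then for every $\lambda\in\mathbb{F}_p$ the equation $$\sum_{i=1}^{8}\frac{x_i}{y_i}=\lambda$$ has a solution with $(x_1,\dots,x_8)\in\mathcal{I}^8$ and $(y_1,\dots,y_8)\in\mathcal{J}^8$ (with all $y_i\neq 0$).
   Context: $\mathbb{F}_p$ is the field of residues modulo the prime $p$. An interval of $\mathbb{F}_p$ is a set of the form $\{a,a+1,\dots,a+N-1\}$ (residues mod $p$) for some $a\in\mathbb{F}_p$ and integer $1\le N\le p$; it is called nonzero if it is not equal to $\{0\}$. $|\mathcal{X}|$ denotes cardinality. The fraction $x/y$ means $x\cdot y^{ -1}$ in $\mathbb{F}_p$, so only $y\neq 0$ is allowed. Here $\varepsilon$ is a small fixed positive constant and $p$ is sufficiently large in terms of $\varepsilon$. -}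

module Defs where

open import Data.Nat using (ℕ; _+_; _*_; _<_; NonZero)
open import Data.Nat.DivMod using (_%_)
open import Data.Fin using (Fin)
open import Data.List using (map; allFin)
open import Data.Nat.ListAction using (sum)
open import Data.Product using (_×_; ∃-syntax)
open import Relation.Binary.PropositionalEquality using (_≡_; _≢_)
open import Relation.Nullary using (¬_)

-- Elements of F_p are represented by natural numbers, with equality in F_p
-- being equality of residues mod p.
ModEq : (p : ℕ) .{{_ : NonZero p}} → ℕ → ℕ → Set
ModEq p x y = x % p ≡ y % p

-- The interval {a, a+1, ..., a+N-1} of F_p  (1 ≤ N ≤ p; its cardinality is N).
InInterval : (p : ℕ) .{{_ : NonZero p}} → (a N : ℕ) → ℕ → Set
InInterval p a N x = ∃[ k ] (k < N × ModEq p x (a + k))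

IsZeroInterval : (p : ℕ) .{{_ : NonZero p}} → (a N : ℕ) → Set
IsZeroInterval p a N = (N ≡ 1) × ModEq p a 0

IsFraction : (p : ℕ) .{{_ : NonZero p}} → (z x y : ℕ) → Set
IsFraction p z x y = ¬ ModEq p y 0 × ModEq p (z * y) x

Σ[_] : (n : ℕ) → (Fin n → ℕ) → ℕ
Σ[ n ] f = sum (map f (allFin n))

{-# OPTIONS --safe #-}
-- If the numerators are long, M ≥ L√p, five fractions with fixed neighbouring denominators y, y+1, ..., y+4
-- suffice. Up to a bounded factor their sums are the values of quartic polynomials with coefficients O(M) at y,
-- and if y ≡ v/u in lowest terms with √N ≪ max(|u|,|v|) ≪ √p, then an expansion to the base v/u shows that
-- these values exhaust F_p, because MN² ≫ p. Such a y exists in J as there are few fractions of small height.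
--
-- If M < L√p, take sums of four products x w with x ∈ I and w = 1/y + 1/y′. Group the pairs (x₁,x₂) by the
-- ratio μ = x₂/x₁: the distribution of x₁w₁ + x₂w₂ depends, up to a dilation, on μ only, and its variance summed
-- over all μ ∈ F_p is at most p E², where E is the additive energy of the w's. By Cauchy–Schwarz the variance of
-- x₁w₁ + x₂w₂ taken over all pairs is at most p E² times the multiplicative energy of I. This is below the main
-- term, so every residue is represented: by the divisor bound the two energies are at most
-- |J|² (1 + √(|J|³/p)) p^o(1) and |I|² p^o(1).
module Submission where

-- Write M and N for the lengths of I and J. The two hypotheses are what the variance asks for: with
-- the N² values w of energy about N²(1 + √(N³/p)), the error is below the main term once p² + p N³
-- ≪ M² N⁴, and the two terms on the left require M N² ≫ p and M² N ≫ p. The bound M² p^o(1) for the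
-- multiplicative energy is available only up to M ≈ √p; beyond that the M⁴/p quadruples expected at
-- random dominate. Shrinking I to length √p is no way out: N may be far below p^(1/4), and then the
-- condition on M N² is lost. Hence the separate argument for long numerators, which loses only
-- constants. Every p^o(1) is a power of a uniform divisor bound τ, and six factors occur: two from
-- the multiplicative energy and four from the square of the additive one. All estimates are made in
-- ℤ. Counts multiplied by p, with their means subtracted, replace additive characters, and
-- inequalities are squared where a root would appear.

open import Data.Nat using (ℕ)
open import Data.Nat.Primality using (Prime)

-- Finite sums of integers over lists.

module Sums where
  open import Data.Integer
  open import Data.Integer.Properties
  import Data.Nat as ℕ
  open import Data.Integer.Tactic.RingSolver using (solve-∀)
  open import Data.List using (List; []; _∷_; length; map; _++_; cartesianProduct)
  open import Data.Product using (_×_; _,_; ∃-syntax)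
  open import Relation.Nullary using (yes; no)
  open import Relation.Binary.PropositionalEquality

  private variable
    A B : Set

  ∑ : List A → (A → ℤ) → ℤ
  ∑ []       f = 0ℤ
  ∑ (a ∷ as) f = f a + ∑ as f

  ∑-cong : (as : List A) {f g : A → ℤ} → (∀ a → f a ≡ g a) → ∑ as f ≡ ∑ as g
  ∑-cong []       f≗g = refl
  ∑-cong (a ∷ as) f≗g = cong₂ _+_ (f≗g a) (∑-cong as f≗g)

  ∑-mono : (as : List A) {f g : A → ℤ} → (∀ a → f a ≤ g a) → ∑ as f ≤ ∑ as g
  ∑-mono []       f≤g = ≤-refl
  ∑-mono (a ∷ as) f≤g = +-mono-≤ (f≤g a) (∑-mono as f≤g)

  ∑-nonneg : (as : List A) {f : A → ℤ} → (∀ a → 0ℤ ≤ f a) → 0ℤ ≤ ∑ as f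
  ∑-nonneg []       0≤f = ≤-refl
  ∑-nonneg (a ∷ as) 0≤f = +-mono-≤ (0≤f a) (∑-nonneg as 0≤f)

  ∑-zero : (as : List A) → ∑ as (λ _ → 0ℤ) ≡ 0ℤ
  ∑-zero []       = refl
  ∑-zero (a ∷ as) = trans (+-identityˡ _) (∑-zero as)

  ∑-+ : (as : List A) (f g : A → ℤ) → ∑ as (λ a → f a + g a) ≡ ∑ as f + ∑ as g
  ∑-+ []       f g = refl
  ∑-+ (a ∷ as) f g rewrite ∑-+ as f g = lemma (f a) (g a) (∑ as f) (∑ as g)
    where
    lemma : ∀ w x y z → w + x + (y + z) ≡ w + y + (x + z)
    lemma = solve-∀

  ∑-*ˡ : (as : List A) (c : ℤ) (f : A → ℤ) → ∑ as (λ a → c * f a) ≡ c * ∑ as f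
  ∑-*ˡ []       c f = sym (*-zeroʳ c)
  ∑-*ˡ (a ∷ as) c f rewrite ∑-*ˡ as c f = sym (*-distribˡ-+ c (f a) (∑ as f))

  ∑-*ʳ : (as : List A) (c : ℤ) (f : A → ℤ) → ∑ as (λ a → f a * c) ≡ ∑ as f * c
  ∑-*ʳ []       c f = refl
  ∑-*ʳ (a ∷ as) c f rewrite ∑-*ʳ as c f = sym (*-distribʳ-+ c (f a) (∑ as f))

  ∑-neg : (as : List A) (f : A → ℤ) → ∑ as (λ a → - f a) ≡ - ∑ as f
  ∑-neg []       f = refl
  ∑-neg (a ∷ as) f rewrite ∑-neg as f = sym (neg-distrib-+ (f a) (∑ as f))

  ∑-minus : (as : List A) (f g : A → ℤ) → ∑ as (λ a → f a - g a) ≡ ∑ as f - ∑ as g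
  ∑-minus as f g = trans (∑-+ as f (λ a → - g a)) (cong (_+_ (∑ as f)) (∑-neg as g))

  ∑-const : (as : List A) (c : ℤ) → ∑ as (λ _ → c) ≡ + length as * c
  ∑-const []       c = refl
  ∑-const (a ∷ as) c rewrite ∑-const as c = sym (suc-* (+ length as) c)

  ∑-swap : (as : List A) (bs : List B) (f : A → B → ℤ) →
    ∑ as (λ a → ∑ bs (f a)) ≡ ∑ bs (λ b → ∑ as (λ a → f a b))
  ∑-swap []       bs f = sym (∑-zero bs)
  ∑-swap (a ∷ as) bs f rewrite ∑-swap as bs f = sym (∑-+ bs (f a) _)

  ∑-++ : (as bs : List A) (f : A → ℤ) → ∑ (as ++ bs) f ≡ ∑ as f + ∑ bs f
  ∑-++ []       bs f = sym (+-identityˡ _)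
  ∑-++ (a ∷ as) bs f rewrite ∑-++ as bs f = sym (+-assoc (f a) _ _)

  ∑-map : (g : A → B) (as : List A) (f : B → ℤ) → ∑ (map g as) f ≡ ∑ as (λ a → f (g a))
  ∑-map g []       f = refl
  ∑-map g (a ∷ as) f = cong (_+_ (f (g a))) (∑-map g as f)

  ∑-cartesianProduct : (as : List A) (bs : List B) (f : A × B → ℤ) →
    ∑ (cartesianProduct as bs) f ≡ ∑ as (λ a → ∑ bs (λ b → f (a , b)))
  ∑-cartesianProduct []       bs f = refl
  ∑-cartesianProduct (a ∷ as) bs f = trans
    (∑-++ (map (a ,_) bs) (cartesianProduct as bs) f)
    (cong₂ _+_ (∑-map (a ,_) bs f) (∑-cartesianProduct as bs f))

  ∑-*-∑ : (as : List A) (bs : List B) (f : A → ℤ) (g : B → ℤ) →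
    ∑ as (λ a → ∑ bs (λ b → f a * g b)) ≡ ∑ as f * ∑ bs g
  ∑-*-∑ as bs f g = trans (∑-cong as λ a → ∑-*ˡ bs (f a) g) (∑-*ʳ as (∑ bs g) f)

  size : List A → ℤ
  size as = + length as

  ∑-1 : (as : List A) → ∑ as (λ _ → 1ℤ) ≡ size as
  ∑-1 as = trans (∑-const as 1ℤ) (*-identityʳ _)

  size-cartesianProduct : (as : List A) (bs : List B) → size (cartesianProduct as bs) ≡ size as * size bs
  size-cartesianProduct as bs = trans (sym (∑-1 (cartesianProduct as bs)))
    (trans (∑-cartesianProduct as bs _) (trans (∑-cong as λ a → trans (∑-1 bs) (sym (*-identityˡ _)))
      (trans (∑-*ʳ as (size bs) (λ _ → 1ℤ)) (cong (_* size bs) (∑-1 as)))))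

  length-cartesianProduct : (as : List A) (bs : List B) → length (cartesianProduct as bs) ≡ length as ℕ.* length bs
  length-cartesianProduct as bs = +-injective (trans (size-cartesianProduct as bs) (sym (pos-* (length as) (length bs))))

  ∑-positive⇒∃ : (as : List A) (f : A → ℤ) → 0ℤ < ∑ as f → ∃[ a ] 0ℤ < f a
  ∑-positive⇒∃ []       f (+<+ ())
  ∑-positive⇒∃ (a ∷ as) f 0<∑ with 0ℤ <? f a
  ... | yes 0<fa = a , 0<fa
  ... | no  0≮fa = ∑-positive⇒∃ as f
    (<-≤-trans 0<∑ (≤-trans (+-monoˡ-≤ (∑ as f) (≮⇒≥ 0≮fa)) (≤-reflexive (+-identityˡ _))))

  0≤i*i : ∀ i → 0ℤ ≤ i * i
  0≤i*i (+ n)    = ≤-trans (+≤+ ℕ.z≤n) (≤-reflexive (pos-* n n))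
  0≤i*i -[1+ n ] = +≤+ ℕ.z≤n

  2ij≤i²+j² : ∀ i j → + 2 * (i * j) ≤ i * i + j * j
  2ij≤i²+j² i j = 0≤i-j⇒j≤i (subst (0ℤ ≤_) (lemma i j) (0≤i*i (i - j)))
    where
    lemma : ∀ i j → (i - j) * (i - j) ≡ i * i + j * j - + 2 * (i * j)
    lemma = solve-∀

  *-nonneg : ∀ {i j} → 0ℤ ≤ i → 0ℤ ≤ j → 0ℤ ≤ i * j
  *-nonneg {i} {j} 0≤i 0≤j =
    subst (_≤ i * j) (*-zeroʳ i) (*-monoˡ-≤-nonNeg i {{nonNegative 0≤i}} 0≤j)

  2∑fg≤∑f²+∑g² : (as : List A) (f g : A → ℤ) →
    + 2 * ∑ as (λ a → f a * g a) ≤ ∑ as (λ a → f a * f a) + ∑ as (λ a → g a * g a)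
  2∑fg≤∑f²+∑g² as f g = begin
    + 2 * ∑ as (λ a → f a * g a)                    ≡⟨ ∑-*ˡ as (+ 2) _ ⟨
    ∑ as (λ a → + 2 * (f a * g a))                  ≤⟨ ∑-mono as (λ a → 2ij≤i²+j² (f a) (g a)) ⟩
    ∑ as (λ a → f a * f a + g a * g a)              ≡⟨ ∑-+ as _ _ ⟩
    ∑ as (λ a → f a * f a) + ∑ as (λ a → g a * g a) ∎
    where open ≤-Reasoning

-- Cauchy-Schwarz, also over classes of vectors, and indicators.

module CauchySchwarz where
  open Sums
  open import Data.Integer
  open import Data.Integer.Properties
  open import Data.Integer.Tactic.RingSolver using (solve-∀)
  open import Data.List using (List; allFin)
  open import Data.List.Properties using (map-tabulate)
  open import Data.Fin as Fin using (Fin)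
  import Data.Fin.Properties as Fin
  open import Data.Nat using (z≤n)
  open import Data.Empty using (⊥-elim)
  open import Function using (id)
  open import Relation.Nullary using (Dec; yes; no; ¬_; contradiction)
  open import Relation.Binary.PropositionalEquality

  private variable
    A T P : Set

  -- Lagrange's identity: the double sum of the squares (f a g b - f b g a)² is twice the difference
  -- of the two sides.
  cauchy-schwarz : (as : List A) (f g : A → ℤ) →
    ∑ as (λ a → f a * g a) * ∑ as (λ a → f a * g a) ≤
    ∑ as (λ a → f a * f a) * ∑ as (λ a → g a * g a)
  cauchy-schwarz as f g = *-cancelˡ-≤-pos _ _ (+ 2) (0≤i-j⇒j≤i (subst (0ℤ ≤_) lagrange
    (∑-nonneg as λ a → ∑-nonneg as λ b → 0≤i*i (f a * g b - f b * g a))))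
    where
    open ≡-Reasoning
    F = ∑ as (λ a → f a * f a)
    G = ∑ as (λ a → g a * g a)
    H = ∑ as (λ a → f a * g a)
    expand : ∀ x y z w → (x * w - z * y) * (x * w - z * y) ≡
      x * x * (w * w) + y * y * (z * z) - + 2 * (x * y * (z * w))
    expand = solve-∀
    collect : ∀ x y z → x * y + y * x - + 2 * (z * z) ≡ + 2 * (x * y) - + 2 * (z * z)
    collect = solve-∀
    lagrange : ∑ as (λ a → ∑ as (λ b → (f a * g b - f b * g a) * (f a * g b - f b * g a))) ≡
      + 2 * (F * G) - + 2 * (H * H)
    lagrange = begin
      ∑ as (λ a → ∑ as (λ b → (f a * g b - f b * g a) * (f a * g b - f b * g a)))
        ≡⟨ (∑-cong as λ a → trans (∑-cong as λ b → expand (f a) (g a) (f b) (g b))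
             (trans (∑-minus as _ _) (cong₂ _-_ (∑-+ as _ _) (∑-*ˡ as (+ 2) _)))) ⟩
      ∑ as (λ a → ∑ as (λ b → f a * f a * (g b * g b)) + ∑ as (λ b → g a * g a * (f b * f b))
                  - + 2 * ∑ as (λ b → f a * g a * (f b * g b)))
        ≡⟨ trans (∑-minus as _ _) (cong₂ _-_ (∑-+ as _ _) (∑-*ˡ as (+ 2) _)) ⟩
      ∑ as (λ a → ∑ as (λ b → f a * f a * (g b * g b))) + ∑ as (λ a → ∑ as (λ b → g a * g a * (f b * f b)))
                  - + 2 * ∑ as (λ a → ∑ as (λ b → f a * g a * (f b * g b)))
        ≡⟨ cong₂ _-_ (cong₂ _+_ (∑-*-∑ as as _ _) (∑-*-∑ as as _ _)) (cong (_*_ (+ 2)) (∑-*-∑ as as _ _)) ⟩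
      F * G + G * F - + 2 * (H * H)
        ≡⟨ collect F G H ⟩
      + 2 * (F * G) - + 2 * (H * H) ∎

  -- Arithmetic and geometric means without roots: 4jk ≤ (j + k)², so j + k < 2i would force jk <
  -- i².
  i*i≤jk⇒2i≤j+k : ∀ {i j k} → 0ℤ ≤ j → 0ℤ ≤ k → i * i ≤ j * k → + 2 * i ≤ j + k
  i*i≤jk⇒2i≤j+k {i} {j} {k} 0≤j 0≤k i²≤jk with + 2 * i ≤? j + k
  ... | yes 2i≤j+k = 2i≤j+k
  ... | no  2i≰j+k = contradiction (≤-<-trans amgm (<-≤-trans square< (≤-reflexive (four i)))) (≤⇒≯ (*-monoˡ-≤-nonNeg (+ 4) i²≤jk))
    where
    four : ∀ i → + 2 * i * (+ 2 * i) ≡ + 4 * (i * i)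
    four = solve-∀
    expand : ∀ j k → (j - k) * (j - k) ≡ (j + k) * (j + k) - + 4 * (j * k)
    expand = solve-∀
    amgm : + 4 * (j * k) ≤ (j + k) * (j + k)
    amgm = 0≤i-j⇒j≤i (subst (0ℤ ≤_) (expand j k) (0≤i*i (j - k)))
    j+k<2i : j + k < + 2 * i
    j+k<2i = ≰⇒> 2i≰j+k
    0≤j+k : 0ℤ ≤ j + k
    0≤j+k = +-mono-≤ 0≤j 0≤k
    square< : (j + k) * (j + k) < + 2 * i * (+ 2 * i)
    square< = ≤-<-trans (*-monoˡ-≤-nonNeg (j + k) {{nonNegative 0≤j+k}} (<⇒≤ j+k<2i))
      (*-monoʳ-<-pos (+ 2 * i) {{positive (≤-<-trans 0≤j+k j+k<2i)}} j+k<2i)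

  ⟦_⟧ : Dec P → ℤ
  ⟦ yes _ ⟧ = 1ℤ
  ⟦ no  _ ⟧ = 0ℤ

  ⟦⟧-nonneg : (d : Dec P) → 0ℤ ≤ ⟦ d ⟧
  ⟦⟧-nonneg (yes _) = +≤+ z≤n
  ⟦⟧-nonneg (no  _) = ≤-refl

  ⟦⟧-yes : (d : Dec P) → P → ⟦ d ⟧ ≡ 1ℤ
  ⟦⟧-yes (yes _) p = refl
  ⟦⟧-yes (no ¬p) p = ⊥-elim (¬p p)

  ⟦⟧-no : (d : Dec P) → ¬ P → ⟦ d ⟧ ≡ 0ℤ
  ⟦⟧-no (yes p) ¬p = ⊥-elim (¬p p)
  ⟦⟧-no (no _)  ¬p = refl

  ⟦⟧-mono : {Q : Set} (d : Dec P) (d′ : Dec Q) → (P → Q) → ⟦ d ⟧ ≤ ⟦ d′ ⟧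
  ⟦⟧-mono (yes p) d′ p⇒q = ≤-reflexive (sym (⟦⟧-yes d′ (p⇒q p)))
  ⟦⟧-mono (no _)  d′ p⇒q = ⟦⟧-nonneg d′

  ⟦⟧-cong : {Q : Set} (d : Dec P) (d′ : Dec Q) → (P → Q) → (Q → P) → ⟦ d ⟧ ≡ ⟦ d′ ⟧
  ⟦⟧-cong d d′ p⇒q q⇒p = ≤-antisym (⟦⟧-mono d d′ p⇒q) (⟦⟧-mono d′ d q⇒p)

  ⟦⟧-positive : (d : Dec P) → 0ℤ < ⟦ d ⟧ → P
  ⟦⟧-positive (yes p) _ = p
  ⟦⟧-positive (no _)  (+<+ ())

  ∑-allFin-suc : ∀ {n} (f : Fin (Data.Nat.suc n) → ℤ) →
    ∑ (allFin (Data.Nat.suc n)) f ≡ f Fin.zero + ∑ (allFin n) (λ i → f (Fin.suc i))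
  ∑-allFin-suc {n} f = cong (_+_ (f Fin.zero))
    (trans (cong (λ is → ∑ is f) (sym (map-tabulate id Fin.suc))) (∑-map Fin.suc (allFin n) f))

  ∑-δ : ∀ {n} (i : Fin n) (f : Fin n → ℤ) → ∑ (allFin n) (λ j → ⟦ i Fin.≟ j ⟧ * f j) ≡ f i
  ∑-δ {Data.Nat.suc n} Fin.zero f = trans (∑-allFin-suc (λ j → ⟦ Fin.zero Fin.≟ j ⟧ * f j))
    (trans (cong₂ _+_ (*-identityˡ (f Fin.zero)) (∑-zero (allFin n))) (+-identityʳ _))
  ∑-δ {Data.Nat.suc n} (Fin.suc i) f = trans (∑-allFin-suc (λ j → ⟦ Fin.suc i Fin.≟ j ⟧ * f j))
    (trans (+-identityˡ _) (trans (∑-cong (allFin n) (λ j → cong (_* f (Fin.suc j))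
      (⟦⟧-cong (Fin.suc i Fin.≟ Fin.suc j) (i Fin.≟ j) Fin.suc-injective (cong Fin.suc))))
      (∑-δ i (λ j → f (Fin.suc j)))))

  -- A class μ of size m(μ) contributes a vector of norm at most m(μ)√g(μ), and
  -- (∑ m √g)² ≤ (∑ m²)(∑ g).
  classwise-cauchy-schwarz : ∀ {n} (as : List A) (κ : A → Fin n) (ts : List T)
    (v : A → T → ℤ) (g : Fin n → ℤ) → (∀ μ → 0ℤ ≤ g μ) →
    (∀ a → ∑ ts (λ t → v a t * v a t) ≡ g (κ a)) →
    ∑ ts (λ t → ∑ as (λ a → v a t) * ∑ as (λ a → v a t)) ≤
    ∑ as (λ a → ∑ as (λ b → ⟦ κ a Fin.≟ κ b ⟧)) * ∑ (allFin n) g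
  classwise-cauchy-schwarz {n = n} as κ ts v g 0≤g ‖v‖² = *-cancelˡ-≤-pos _ _ (+ 2) (begin
    + 2 * ∑ ts (λ t → ∑ as (λ a → v a t) * ∑ as (λ a → v a t))
      ≡⟨ cong (_*_ (+ 2)) (trans (∑-cong ts λ t → trans (cong₂ _*_ (u≡∑V t) (u≡∑V t)) (sym (∑-*-∑ μs μs _ _)))
           (trans (∑-swap ts μs _) (∑-cong μs λ μ → ∑-swap ts μs _))) ⟩
    + 2 * ∑ μs (λ μ → ∑ μs (λ ν → ⟨ μ , ν ⟩))
      ≡⟨ trans (sym (∑-*ˡ μs (+ 2) _)) (∑-cong μs λ μ → sym (∑-*ˡ μs (+ 2) _)) ⟩
    ∑ μs (λ μ → ∑ μs (λ ν → + 2 * ⟨ μ , ν ⟩))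
      ≤⟨ (∑-mono μs λ μ → ∑-mono μs λ ν → pair μ ν) ⟩
    ∑ μs (λ μ → ∑ μs (λ ν → m μ * m μ * g ν + m ν * m ν * g μ))
      ≡⟨ trans (∑-cong μs λ μ → ∑-+ μs _ _) (trans (∑-+ μs _ _)
           (cong₂ _+_ (∑-*-∑ μs μs _ _) (trans (∑-swap μs μs _) (∑-*-∑ μs μs _ _)))) ⟩
    ∑ μs (λ μ → m μ * m μ) * ∑ μs g + ∑ μs (λ μ → m μ * m μ) * ∑ μs g
      ≡⟨ double (∑ μs (λ μ → m μ * m μ) * ∑ μs g) ⟩
    + 2 * (∑ μs (λ μ → m μ * m μ) * ∑ μs g)
      ≡⟨ cong (λ z → + 2 * (z * ∑ μs g)) ∑m² ⟩
    + 2 * (∑ as (λ a → ∑ as (λ b → ⟦ κ a Fin.≟ κ b ⟧)) * ∑ μs g) ∎)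
    where
    open ≤-Reasoning
    μs = allFin n
    -- `V μ` is the total of the vectors in the class μ, and `m μ` is the size of that class.
    V : Fin n → _ → ℤ
    V μ t = ∑ as (λ a → ⟦ κ a Fin.≟ μ ⟧ * v a t)
    m : Fin n → ℤ
    m μ = ∑ as (λ a → ⟦ κ a Fin.≟ μ ⟧)
    ⟨_,_⟩ : Fin n → Fin n → ℤ
    ⟨ μ , ν ⟩ = ∑ ts (λ t → V μ t * V ν t)
    double : ∀ x → x + x ≡ + 2 * x
    double = solve-∀
    u≡∑V : ∀ t → ∑ as (λ a → v a t) ≡ ∑ μs (λ μ → V μ t)
    u≡∑V t = trans (∑-cong as λ a → sym (∑-δ (κ a) (λ _ → v a t))) (∑-swap as μs _)
    ∑m² : ∑ μs (λ μ → m μ * m μ) ≡ ∑ as (λ a → ∑ as (λ b → ⟦ κ a Fin.≟ κ b ⟧))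
    ∑m² = trans (∑-cong μs λ μ → sym (∑-*-∑ as as _ _)) (trans (∑-swap μs as _) (∑-cong as λ a →
      trans (∑-swap μs as _) (∑-cong as λ b → trans (∑-δ (κ a) (λ μ → ⟦ κ b Fin.≟ μ ⟧))
        (⟦⟧-cong (κ b Fin.≟ κ a) (κ a Fin.≟ κ b) sym sym))))
    rearrange : ∀ i j x y → i * x * (j * y) ≡ i * j * (x * y)
    rearrange = solve-∀
    term : ∀ μ a b → + 2 * (⟦ κ a Fin.≟ μ ⟧ * ⟦ κ b Fin.≟ μ ⟧ * ∑ ts (λ t → v a t * v b t)) ≤
      + 2 * (⟦ κ a Fin.≟ μ ⟧ * ⟦ κ b Fin.≟ μ ⟧ * g μ)
    term μ a b with κ a Fin.≟ μ | κ b Fin.≟ μ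
    ... | no _    | no _    = ≤-refl
    ... | no _    | yes _   = ≤-refl
    ... | yes _   | no _    = ≤-refl
    ... | yes κa≡μ | yes κb≡μ = begin
      + 2 * (1ℤ * 1ℤ * ∑ ts (λ t → v a t * v b t))
        ≡⟨ cong (_*_ (+ 2)) (*-identityˡ _) ⟩
      + 2 * ∑ ts (λ t → v a t * v b t)
        ≤⟨ 2∑fg≤∑f²+∑g² ts (v a) (v b) ⟩
      ∑ ts (λ t → v a t * v a t) + ∑ ts (λ t → v b t * v b t)
        ≡⟨ cong₂ _+_ (trans (‖v‖² a) (cong g κa≡μ)) (trans (‖v‖² b) (cong g κb≡μ)) ⟩
      g μ + g μ
        ≡⟨ double (g μ) ⟩
      + 2 * g μ
        ≡⟨ cong (_*_ (+ 2)) (*-identityˡ (g μ)) ⟨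
      + 2 * (1ℤ * 1ℤ * g μ) ∎
    -- The triangle inequality for `m μ` vectors of squared norm `g μ`, with each inner product
    -- bounded through 2⟨v, v′⟩ ≤ ‖v‖² + ‖v′‖².
    ‖V‖² : ∀ μ → ⟨ μ , μ ⟩ ≤ m μ * m μ * g μ
    ‖V‖² μ = *-cancelˡ-≤-pos _ _ (+ 2) (begin
      + 2 * ⟨ μ , μ ⟩
        ≡⟨ cong (_*_ (+ 2)) (trans (∑-cong ts λ t → trans (sym (∑-*-∑ as as _ _)) (∑-cong as λ a →
             ∑-cong as λ b → rearrange ⟦ κ a Fin.≟ μ ⟧ ⟦ κ b Fin.≟ μ ⟧ (v a t) (v b t)))
             (trans (∑-swap ts as _) (∑-cong as λ a → trans (∑-swap ts as _) (∑-cong as λ b →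
               ∑-*ˡ ts (⟦ κ a Fin.≟ μ ⟧ * ⟦ κ b Fin.≟ μ ⟧) (λ t → v a t * v b t))))) ⟩
      + 2 * ∑ as (λ a → ∑ as (λ b → ⟦ κ a Fin.≟ μ ⟧ * ⟦ κ b Fin.≟ μ ⟧ * ∑ ts (λ t → v a t * v b t)))
        ≡⟨ trans (sym (∑-*ˡ as (+ 2) _)) (∑-cong as λ a → sym (∑-*ˡ as (+ 2) _)) ⟩
      ∑ as (λ a → ∑ as (λ b → + 2 * (⟦ κ a Fin.≟ μ ⟧ * ⟦ κ b Fin.≟ μ ⟧ * ∑ ts (λ t → v a t * v b t))))
        ≤⟨ (∑-mono as λ a → ∑-mono as λ b → term μ a b) ⟩
      ∑ as (λ a → ∑ as (λ b → + 2 * (⟦ κ a Fin.≟ μ ⟧ * ⟦ κ b Fin.≟ μ ⟧ * g μ)))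
        ≡⟨ trans (∑-cong as λ a → ∑-*ˡ as (+ 2) _) (∑-*ˡ as (+ 2) _) ⟩
      + 2 * ∑ as (λ a → ∑ as (λ b → ⟦ κ a Fin.≟ μ ⟧ * ⟦ κ b Fin.≟ μ ⟧ * g μ))
        ≡⟨ cong (_*_ (+ 2)) (trans (∑-cong as λ a → ∑-*ʳ as (g μ) _)
             (trans (∑-*ʳ as (g μ) _) (cong (_* g μ) (∑-*-∑ as as _ _)))) ⟩
      + 2 * (m μ * m μ * g μ) ∎)
    -- The norms are paired crosswise so that the double sum over μ and ν splits into (∑ m²)(∑ g).
    -- The parallel pairing would leave n ∑ m² g instead.
    pair : ∀ μ ν → + 2 * ⟨ μ , ν ⟩ ≤ m μ * m μ * g ν + m ν * m ν * g μ
    pair μ ν = i*i≤jk⇒2i≤j+k (*-nonneg (0≤i*i (m μ)) (0≤g ν)) (*-nonneg (0≤i*i (m ν)) (0≤g μ)) (begin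
      ⟨ μ , ν ⟩ * ⟨ μ , ν ⟩
        ≤⟨ cauchy-schwarz ts (V μ) (V ν) ⟩
      ⟨ μ , μ ⟩ * ⟨ ν , ν ⟩
        ≤⟨ *-monoʳ-≤-nonNeg ⟨ ν , ν ⟩ {{nonNegative (∑-nonneg ts λ t → 0≤i*i (V ν t))}} (‖V‖² μ) ⟩
      m μ * m μ * g μ * ⟨ ν , ν ⟩
        ≤⟨ *-monoˡ-≤-nonNeg (m μ * m μ * g μ) {{nonNegative (*-nonneg (0≤i*i (m μ)) (0≤g μ))}} (‖V‖² ν) ⟩
      m μ * m μ * g μ * (m ν * m ν * g ν)
        ≡⟨ exchange (m μ * m μ) (g μ) (m ν * m ν) (g ν) ⟩
      m μ * m μ * g ν * (m ν * m ν * g μ) ∎)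
      where
      exchange : ∀ x y z w → x * y * (z * w) ≡ x * w * (z * y)
      exchange = solve-∀

-- Bézout coefficients and arithmetic modulo p.

module Bezout where
  open import Data.Integer
  open import Data.Integer.Properties
  open import Data.Integer.Tactic.RingSolver using (solve-∀)
  open import Data.Nat.Coprimality using (Coprime; coprime-Bézout)
  open import Data.Nat.GCD using (module Bézout)
  open import Data.Product using (_,_; ∃₂)
  open import Relation.Binary.PropositionalEquality

  bézout : ∀ {m n} → Coprime m n → ∃₂ λ x y → x * + m + y * + n ≡ 1ℤ
  bézout {m} {n} coprime with coprime-Bézout coprime
  ... | Bézout.+- x y eq = + x , - + y , trans
    (cong (_+ - + y * + n) (trans (sym (pos-* x m)) (trans (cong +_ (sym eq)) (cong (_+_ 1ℤ) (pos-* y n)))))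
    (cancel (+ y) (+ n))
    where
    cancel : ∀ y n → 1ℤ + y * n + - y * n ≡ 1ℤ
    cancel = solve-∀
  ... | Bézout.-+ x y eq = - + x , + y , trans
    (cong (_+_ (- + x * + m)) (trans (sym (pos-* y n)) (trans (cong +_ (sym eq)) (cong (_+_ 1ℤ) (pos-* x m)))))
    (cancel (+ x) (+ m))
    where
    cancel : ∀ x m → - x * m + (1ℤ + x * m) ≡ 1ℤ
    cancel = solve-∀

module Modular (p : ℕ) (p-prime : Prime p) where
  open Sums
  open CauchySchwarz
  open Bezout
  open import Data.Integer
  open import Data.Integer.Properties
  open import Data.Integer.Divisibility.Signed
  open import Data.Integer.DivMod using (n%ℕd<d; a≡a%ℕn+[a/ℕn]*n)
  open import Data.Integer.Tactic.RingSolver using (solve-∀)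
  import Data.Nat as ℕ
  import Data.Nat.Properties as ℕ
  import Data.Nat.Divisibility as ℕ
  open import Data.Nat.Coprimality using (Coprime)
  open import Data.Nat.Primality using (euclidsLemma; prime⇒irreducible; prime⇒nonZero; ¬prime[1])
  open import Data.List using (allFin)
  open import Data.Fin as Fin using (Fin; toℕ; fromℕ<)
  import Data.Fin.Properties as Fin
  open import Data.Sum using (_⊎_; inj₁; inj₂)
  open import Data.Product using (_,_; proj₁; proj₂; ∃-syntax)
  open import Relation.Nullary using (¬_; yes; no; contradiction)
  open import Relation.Binary.PropositionalEquality

  instance
    p≢0 : ℕ.NonZero p
    p≢0 = prime⇒nonZero p-prime

  P : ℤ
  P = + p

  infix 4 _≋_
  -- A record rather than a synonym of `P ∣ i - j`: unification recovers `i` and `j` from the type,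
  -- but not from their difference.
  record _≋_ (i j : ℤ) : Set where
    constructor mk
    field p∣- : P ∣ i - j
  open _≋_ public

  Unit : ℤ → Set
  Unit i = ¬ P ∣ i

  ∣-resp : ∀ {i j} → i ≡ j → P ∣ i → P ∣ j
  ∣-resp = subst (P ∣_)

  ≋-reflexive : ∀ {i j} → i ≡ j → i ≋ j
  ≋-reflexive {i} refl = mk (divides 0ℤ (+-inverseʳ i))

  ≋-refl : ∀ {i} → i ≋ i
  ≋-refl = ≋-reflexive refl

  ≋-sym : ∀ {i j} → i ≋ j → j ≋ i
  ≋-sym {i} {j} (mk i≋j) = mk (∣-resp (lemma i j) (∣m⇒∣-m i≋j))
    where
    lemma : ∀ i j → - (i - j) ≡ j - i
    lemma = solve-∀

  ≋-trans : ∀ {i j k} → i ≋ j → j ≋ k → i ≋ k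
  ≋-trans {i} {j} {k} (mk i≋j) (mk j≋k) = mk (∣-resp (lemma i j k) (∣m∣n⇒∣m+n i≋j j≋k))
    where
    lemma : ∀ i j k → i - j + (j - k) ≡ i - k
    lemma = solve-∀

  +-cong : ∀ {i j k l} → i ≋ j → k ≋ l → i + k ≋ j + l
  +-cong {i} {j} {k} {l} (mk i≋j) (mk k≋l) = mk (∣-resp (lemma i j k l) (∣m∣n⇒∣m+n i≋j k≋l))
    where
    lemma : ∀ i j k l → i - j + (k - l) ≡ i + k - (j + l)
    lemma = solve-∀

  neg-cong : ∀ {i j} → i ≋ j → - i ≋ - j
  neg-cong {i} {j} (mk i≋j) = mk (∣-resp (lemma i j) (∣m⇒∣-m i≋j))
    where
    lemma : ∀ i j → - (i - j) ≡ - i - - j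
    lemma = solve-∀

  minus-cong : ∀ {i j k l} → i ≋ j → k ≋ l → i - k ≋ j - l
  minus-cong i≋j k≋l = +-cong i≋j (neg-cong k≋l)

  *-cong : ∀ {i j k l} → i ≋ j → k ≋ l → i * k ≋ j * l
  *-cong {i} {j} {k} {l} (mk i≋j) (mk k≋l) = mk (∣-resp (lemma i j k l) (∣m∣n⇒∣m+n (∣n⇒∣m*n k i≋j) (∣n⇒∣m*n j k≋l)))
    where
    lemma : ∀ i j k l → k * (i - j) + j * (k - l) ≡ i * k - j * l
    lemma = solve-∀

  ∣-respˡ-≋ : ∀ {i j} → i ≋ j → P ∣ j → P ∣ i
  ∣-respˡ-≋ {i} {j} (mk i≋j) p∣j = ∣-resp (lemma i j) (∣m∣n⇒∣m+n i≋j p∣j)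
    where
    lemma : ∀ i j → i - j + j ≡ i
    lemma = solve-∀

  ≋0⇒∣ : ∀ {i} → i ≋ 0ℤ → P ∣ i
  ≋0⇒∣ {i} (mk i≋0) = ∣-resp (+-identityʳ i) i≋0

  euclid : ∀ i j → P ∣ i * j → (P ∣ i) ⊎ (P ∣ j)
  euclid i j p∣ij with euclidsLemma ∣ i ∣ ∣ j ∣ p-prime (subst (p ℕ.∣_) (abs-* i j) (∣⇒∣ᵤ p∣ij))
  ... | inj₁ p∣i = inj₁ (∣ᵤ⇒∣ p∣i)
  ... | inj₂ p∣j = inj₂ (∣ᵤ⇒∣ p∣j)

  unit-* : ∀ {i j} → Unit i → Unit j → Unit (i * j)
  unit-* {i} {j} ui uj p∣ij with euclid i j p∣ij
  ... | inj₁ p∣i = ui p∣i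
  ... | inj₂ p∣j = uj p∣j

  unit-cancel : ∀ {i j} → Unit i → P ∣ i * j → P ∣ j
  unit-cancel {i} {j} ui p∣ij with euclid i j p∣ij
  ... | inj₁ p∣i = contradiction p∣i ui
  ... | inj₂ p∣j = p∣j

  *-cancelˡ : ∀ {i j k} → Unit i → i * j ≋ i * k → j ≋ k
  *-cancelˡ {i} {j} {k} ui (mk ij≋ik) = mk (unit-cancel ui (∣-resp (lemma i j k) ij≋ik))
    where
    lemma : ∀ i j k → i * j - i * k ≡ i * (j - k)
    lemma = solve-∀

  unit⇒coprime : ∀ {i} → Unit i → Coprime p ∣ i ∣
  unit⇒coprime ui {d} (d∣p , d∣i) with prime⇒irreducible p-prime d∣p
  ... | inj₁ d≡1 = d≡1
  ... | inj₂ refl = contradiction (∣ᵤ⇒∣ d∣i) ui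

  unit⇒invertible : ∀ {i} → Unit i → ∃[ j ] i * j ≋ 1ℤ
  unit⇒invertible {i} ui with bézout (unit⇒coprime ui) | +∣i∣≡i⊎+∣i∣≡-i i
  ... | x , y , eq | inj₁ ∣i∣≡i = y , mk (divides (- x) (trans (cong (λ e → i * y - e) (sym eq))
          (trans (cong (λ e → i * y - (x * P + y * e)) ∣i∣≡i) (lemma i x y P))))
    where
    lemma : ∀ i x y P → i * y - (x * P + y * i) ≡ - x * P
    lemma = solve-∀
  ... | x , y , eq | inj₂ ∣i∣≡-i = - y , mk (divides (- x) (trans (cong (λ e → i * - y - e) (sym eq))
          (trans (cong (λ e → i * - y - (x * P + y * e)) ∣i∣≡-i) (lemma i x y P))))
    where
    lemma : ∀ i x y P → i * - y - (x * P + y * - i) ≡ - x * P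
    lemma = solve-∀

  -- Modular inverse, with the junk value 0 at multiples of p.
  inv : ℤ → ℤ
  inv i with P ∣? i
  ... | yes _  = 0ℤ
  ... | no  ui = proj₁ (unit⇒invertible ui)

  inv-inverse : ∀ {i} → Unit i → i * inv i ≋ 1ℤ
  inv-inverse {i} ui with P ∣? i
  ... | yes p∣i = contradiction p∣i ui
  ... | no  ui′ = proj₂ (unit⇒invertible ui′)

  p∤1 : Unit 1ℤ
  p∤1 p∣1 = ¬prime[1] (subst Prime (ℕ.∣1⇒≡1 (∣⇒∣ᵤ p∣1)) p-prime)

  ∣∧∣∣<⇒≡0 : ∀ {i} → P ∣ i → ∣ i ∣ ℕ.< p → i ≡ 0ℤ
  ∣∧∣∣<⇒≡0 {i} p∣i ∣i∣<p with ∣ i ∣ in eq | ∣⇒∣ᵤ p∣i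
  ... | ℕ.zero  | _     = ∣i∣≡0⇒i≡0 eq
  ... | ℕ.suc n | p∣1+n = contradiction ∣i∣<p (ℕ.≤⇒≯ (ℕ.∣⇒≤ p∣1+n))

  residue : ℤ → Fin p
  residue i = fromℕ< (n%ℕd<d i p)

  ≋-residue : ∀ i → i ≋ + toℕ (residue i)
  ≋-residue i = mk (divides (i /ℕ p) (trans (cong₂ _-_ (a≡a%ℕn+[a/ℕn]*n i p) (cong +_ (Fin.toℕ-fromℕ< (n%ℕd<d i p))))
    (lemma (+ (i %ℕ p)) ((i /ℕ p) * P))))
    where
    lemma : ∀ r q → r + q - r ≡ q
    lemma = solve-∀

  ≋⇒toℕ≡ : ∀ {m n} → m ℕ.< p → n ℕ.< p → + m ≋ + n → m ≡ n
  ≋⇒toℕ≡ {m} {n} m<p n<p m≋n = +-injective (i-j≡0⇒i≡j (+ m) (+ n)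
    (∣∧∣∣<⇒≡0 (p∣- m≋n) (subst (ℕ._< p) (cong ∣_∣ (sym (m-n≡m⊖n m n))) (ℕ.≤-<-trans (∣m⊝n∣≤m⊔n m n) (ℕ.⊔-pres-<m m<p n<p)))))

  residue-unique : ∀ {i} (t : Fin p) → i ≋ + toℕ t → residue i ≡ t
  residue-unique {i} t i≋t = Fin.toℕ-injective (≋⇒toℕ≡ (Fin.toℕ<n (residue i)) (Fin.toℕ<n t) (≋-trans (≋-sym (≋-residue i)) i≋t))

  δ : ℤ → ℤ
  δ i = ⟦ P ∣? i ⟧

  δ-cong : ∀ {i j} → (P ∣ i → P ∣ j) → (P ∣ j → P ∣ i) → δ i ≡ δ j
  δ-cong {i} {j} = ⟦⟧-cong (P ∣? i) (P ∣? j)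

  δ-residue : ∀ i t → δ (i - + toℕ t) ≡ ⟦ residue i Fin.≟ t ⟧
  δ-residue i t = ⟦⟧-cong (P ∣? (i - + toℕ t)) (residue i Fin.≟ t) (λ p∣ → residue-unique {i} t (mk p∣))
    (λ { refl → p∣- (≋-residue i) })

  ∑-residues : ∀ i (f : Fin p → ℤ) → ∑ (allFin p) (λ t → δ (i - + toℕ t) * f t) ≡ f (residue i)
  ∑-residues i f = trans (∑-cong (allFin p) λ t → cong (_* f t) (δ-residue i t)) (∑-δ (residue i) f)

-- Variance of bilinear sums and a covering criterion.

module BilinearCovering (p : ℕ) (p-prime : Prime p) where
  open Sums
  open CauchySchwarz
  open Modular p p-prime
  open import Data.Integer
  open import Data.Integer.Properties
  open import Data.Integer.Divisibility.Signed
  open import Data.Integer.Tactic.RingSolver using (solve-∀)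
  open import Data.List using (List; allFin; cartesianProduct)
  open import Data.List.Properties using (length-tabulate)
  open import Data.Fin as Fin using (Fin; toℕ)
  open import Data.Product using (Σ; _×_; _,_; proj₁)
  open import Relation.Nullary using (yes; no; contradiction)
  open import Relation.Binary.PropositionalEquality

  private variable
    A B : Set

  ∑-residues-const : ∀ c → ∑ (allFin p) (λ _ → c) ≡ P * c
  ∑-residues-const c = trans (∑-const (allFin p) c) (cong (λ n → + n * c) (length-tabulate {n = p} (λ i → i)))

  count : List A → (A → ℤ) → Fin p → ℤ
  count as α t = ∑ as (λ a → δ (α a - + toℕ t))

  collisions : List A → (A → ℤ) → List B → (B → ℤ) → ℤ
  collisions as α bs β = ∑ as (λ a → ∑ bs (λ b → δ (α a - β b)))

  -- p times the deviation of a count from its mean |A|/p.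
  excess : List A → (A → ℤ) → Fin p → ℤ
  excess as α t = P * count as α t - size as

  ∑-count : (as : List A) (α : A → ℤ) → ∑ (allFin p) (count as α) ≡ size as
  ∑-count as α = trans (∑-swap (allFin p) as _) (trans (∑-cong as λ a →
    trans (∑-cong (allFin p) λ t → sym (*-identityʳ _)) (∑-residues (α a) (λ _ → 1ℤ))) (∑-1 as))

  ∑-count-count : (as : List A) (α : A → ℤ) (bs : List B) (β : B → ℤ) →
    ∑ (allFin p) (λ t → count as α t * count bs β t) ≡ collisions as α bs β
  ∑-count-count as α bs β =
    trans (∑-cong (allFin p) λ t → sym (∑-*-∑ as bs (λ a → δ (α a - + toℕ t)) (λ b → δ (β b - + toℕ t))))
    (trans (∑-swap (allFin p) as _) (∑-cong as λ a → trans (∑-swap (allFin p) bs _) (∑-cong bs λ b →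
      trans (∑-residues (α a) (λ t → δ (β b - + toℕ t))) (δ-cong
        (λ p∣ → p∣- (≋-trans (≋-residue (α a)) (≋-sym (mk p∣))))
        (λ p∣ → p∣- (≋-trans (≋-sym (mk p∣)) (≋-residue (α a))))))))

  -- Two counts correlate through their collisions, and subtracting the means removes the uniform
  -- part. This is Parseval's identity without the zero frequency, kept in integers.
  ∑-excess-excess : (as : List A) (α : A → ℤ) (bs : List B) (β : B → ℤ) →
    ∑ (allFin p) (λ t → excess as α t * excess bs β t) ≡ P * P * collisions as α bs β - P * (size as * size bs)
  ∑-excess-excess as α bs β = begin
    ∑ ts (λ t → excess as α t * excess bs β t)
      ≡⟨ ∑-cong ts (λ t → expand P (count as α t) (count bs β t) (size as) (size bs)) ⟩
    ∑ ts (λ t → P * P * (count as α t * count bs β t) - P * size bs * count as α t - P * size as * count bs β t + size as * size bs)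
      ≡⟨ trans (∑-+ ts _ _) (cong₂ _+_ (trans (∑-minus ts _ _) (cong₂ _-_ (trans (∑-minus ts _ _)
           (cong₂ _-_ (trans (∑-*ˡ ts (P * P) (λ t → count as α t * count bs β t)) (cong (_*_ (P * P)) (∑-count-count as α bs β)))
                      (trans (∑-*ˡ ts (P * size bs) (count as α)) (cong (_*_ (P * size bs)) (∑-count as α)))))
           (trans (∑-*ˡ ts (P * size as) (count bs β)) (cong (_*_ (P * size as)) (∑-count bs β)))))
           (∑-residues-const (size as * size bs))) ⟩
    P * P * collisions as α bs β - P * size bs * size as - P * size as * size bs + P * (size as * size bs)
      ≡⟨ collect P (collisions as α bs β) (size as) (size bs) ⟩
    P * P * collisions as α bs β - P * (size as * size bs) ∎
    where
    open ≡-Reasoning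
    ts = allFin p
    expand : ∀ P x y a b → (P * x - a) * (P * y - b) ≡ P * P * (x * y) - P * b * x - P * a * y + a * b
    expand = solve-∀
    collect : ∀ P s a b → P * P * s - P * b * a - P * a * b + P * (a * b) ≡ P * P * s - P * (a * b)
    collect = solve-∀

  multiplicativeEnergy : List A → (A → ℤ) → ℤ
  multiplicativeEnergy X x = ∑ X λ a → ∑ X λ a′ → ∑ X λ c → ∑ X λ c′ → δ (x a * x c′ - x a′ * x c)

  FourProducts : (A → ℤ) → (B → ℤ) → ℤ → Set
  FourProducts {A} {B} x w λ₀ = Σ (A × A × A × A) λ (a₁ , a₂ , a₃ , a₄) → Σ (B × B × B × B) λ (b₁ , b₂ , b₃ , b₄) →
    x a₁ * w b₁ + x a₂ * w b₂ + (x a₃ * w b₃ + x a₄ * w b₄) ≋ λ₀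

  module _ (X : List A) (x : A → ℤ) (x-unit : ∀ a → Unit (x a)) (W : List B) (w : B → ℤ) where

    private
      Π = cartesianProduct X X
      Ω = cartesianProduct W W
      R = cartesianProduct Π Ω

      s : A × A → B × B → ℤ
      s (a , a′) (b , b′) = x a * w b + x a′ * w b′

      κ : A × A → Fin p
      κ (a , a′) = residue (inv (x a) * x a′)

      twisted : Fin p → B × B → ℤ
      twisted μ (b , b′) = w b + + toℕ μ * w b′

      g : Fin p → ℤ
      g μ = P * P * collisions Ω (twisted μ) Ω (twisted μ) - P * (size Ω * size Ω)

      g≡∑excess² : ∀ μ → ∑ (allFin p) (λ t → excess Ω (twisted μ) t * excess Ω (twisted μ) t) ≡ g μ
      g≡∑excess² μ = ∑-excess-excess Ω (twisted μ) Ω (twisted μ)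

      0≤g : ∀ μ → 0ℤ ≤ g μ
      0≤g μ = subst (0ℤ ≤_) (g≡∑excess² μ) (∑-nonneg (allFin p) λ t → 0≤i*i (excess Ω (twisted μ) t))

      s≋twisted : ∀ π ω → s π ω ≋ x (proj₁ π) * twisted (κ π) ω
      s≋twisted (a , a′) (b , b′) = ≋-trans
        (+-cong (≋-refl {x a * w b}) (*-cong (≋-sym x·κ≋x′) (≋-refl {w b′})))
        (≋-reflexive (factor (x a) (w b) (+ toℕ (κ (a , a′))) (w b′)))
        where
        factor : ∀ x w κ w′ → x * w + x * κ * w′ ≡ x * (w + κ * w′)
        factor = solve-∀
        x·κ≋x′ : x a * + toℕ (κ (a , a′)) ≋ x a′
        x·κ≋x′ = ≋-trans (*-cong (≋-refl {x a}) (≋-sym (≋-residue (inv (x a) * x a′))))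
          (≋-trans (≋-reflexive (sym (*-assoc (x a) (inv (x a)) (x a′))))
          (≋-trans (*-cong (inv-inverse (x-unit a)) (≋-refl {x a′})) (≋-reflexive (*-identityˡ _))))

      -- By `∑-excess-excess` the norm depends on collisions only. By `s≋twisted` the two maps
      -- differ by the unit `x a`, and multiplication by a unit neither creates nor destroys a
      -- collision.
      ‖excess‖² : ∀ π → ∑ (allFin p) (λ t → excess Ω (s π) t * excess Ω (s π) t) ≡ g (κ π)
      ‖excess‖² π@(a , a′) = trans (∑-excess-excess Ω (s π) Ω (s π))
        (cong (λ c → P * P * c - P * (size Ω * size Ω)) (∑-cong Ω λ ω → ∑-cong Ω λ ω′ → δ-cong
          (λ p∣ → p∣- (*-cancelˡ (x-unit a) (≋-trans (≋-sym (s≋twisted π ω)) (≋-trans (mk p∣) (s≋twisted π ω′)))))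
          (λ p∣ → p∣- (≋-trans (s≋twisted π ω) (≋-trans (*-cong (≋-refl {x a}) (mk p∣)) (≋-sym (s≋twisted π ω′)))))))

      E : ℤ
      E = collisions W w W w

      -- A linear congruence in μ has a single root if its slope is a unit; if p divides the slope,
      -- all residues are roots or none is.
      ∑-linear : ∀ i j → ∑ (allFin p) (λ μ → δ (i + + toℕ μ * j)) ≤ 1ℤ + P * (δ i * δ j)
      ∑-linear i j with P ∣? j
      ... | yes p∣j = begin
        ∑ (allFin p) (λ μ → δ (i + + toℕ μ * j))
          ≡⟨ ∑-cong (allFin p) (λ μ → δ-cong
               (∣-respˡ-≋ (mk (∣-resp (sym (i-[i+j]≡-j i (+ toℕ μ * j))) (∣m⇒∣-m (∣n⇒∣m*n (+ toℕ μ) p∣j)))))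
               (∣-respˡ-≋ (mk (∣-resp (sym (i+j-i≡j i (+ toℕ μ * j))) (∣n⇒∣m*n (+ toℕ μ) p∣j))))) ⟩
        ∑ (allFin p) (λ μ → δ i)
          ≡⟨ ∑-residues-const (δ i) ⟩
        P * δ i
          ≡⟨ cong (_*_ P) (*-identityʳ (δ i)) ⟨
        P * (δ i * 1ℤ)
          ≤⟨ i≤j+i (P * (δ i * 1ℤ)) 1ℤ ⟩
        1ℤ + P * (δ i * 1ℤ) ∎
        where
        open ≤-Reasoning
        i-[i+j]≡-j : ∀ i j → i - (i + j) ≡ - j
        i-[i+j]≡-j = solve-∀
        i+j-i≡j : ∀ i j → i + j - i ≡ j
        i+j-i≡j = solve-∀
      ... | no uj = begin
        ∑ (allFin p) (λ μ → δ (i + + toℕ μ * j))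
          ≡⟨ ∑-cong (allFin p) (λ μ → trans (δ-cong
               (λ p∣ → p∣- (root⇒ (+ toℕ μ) p∣)) (λ p∣ → root⇐ (+ toℕ μ) (mk p∣))) (sym (*-identityʳ _))) ⟩
        ∑ (allFin p) (λ μ → δ (- (i * inv j) - + toℕ μ) * 1ℤ)
          ≡⟨ ∑-residues (- (i * inv j)) (λ _ → 1ℤ) ⟩
        1ℤ
          ≡⟨ trans (cong (_+_ 1ℤ) (trans (cong (_*_ P) (*-zeroʳ (δ i))) (*-zeroʳ P))) refl ⟨
        1ℤ + P * (δ i * 0ℤ) ∎
        where
        open ≤-Reasoning
        solve₁ : ∀ i j j⁻¹ μ → j * - (i * j⁻¹) - j * μ ≡ i * 1ℤ - i * (j * j⁻¹) - (i + μ * j)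
        solve₁ = solve-∀
        solve₂ : ∀ i j j⁻¹ μ → i + μ * j ≡ i * 1ℤ - i * (j * j⁻¹) - j * (- (i * j⁻¹) - μ)
        solve₂ = solve-∀
        i≋ijj⁻¹ : i * 1ℤ ≋ i * (j * inv j)
        i≋ijj⁻¹ = *-cong (≋-refl {i}) (≋-sym (inv-inverse uj))
        root⇒ : ∀ μ → P ∣ i + μ * j → - (i * inv j) ≋ μ
        root⇒ μ p∣ = *-cancelˡ uj (mk (∣-resp (sym (solve₁ i j (inv j) μ)) (∣m∣n⇒∣m-n (p∣- i≋ijj⁻¹) p∣)))
        root⇐ : ∀ μ → - (i * inv j) ≋ μ → P ∣ i + μ * j
        root⇐ μ eq = ∣-resp (sym (solve₂ i j (inv j) μ)) (∣m∣n⇒∣m-n (p∣- i≋ijj⁻¹) (∣n⇒∣m*n j (p∣- eq)))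

      ∑-collisions-twisted : ∑ (allFin p) (λ μ → collisions Ω (twisted μ) Ω (twisted μ)) ≤ size Ω * size Ω + P * (E * E)
      ∑-collisions-twisted = begin
        ∑ (allFin p) (λ μ → collisions Ω (twisted μ) Ω (twisted μ))
          ≡⟨ trans (∑-swap (allFin p) Ω _) (∑-cong Ω λ ω → ∑-swap (allFin p) Ω _) ⟩
        ∑ Ω (λ ω → ∑ Ω (λ ω′ → ∑ (allFin p) (λ μ → δ (twisted μ ω - twisted μ ω′))))
          ≡⟨ (∑-cong Ω λ (b , b′) → ∑-cong Ω λ (c , c′) → ∑-cong (allFin p) λ μ →
               cong δ (difference (w b) (w b′) (w c) (w c′) (+ toℕ μ))) ⟩
        ∑ Ω (λ (b , b′) → ∑ Ω (λ (c , c′) → ∑ (allFin p) (λ μ → δ ((w b - w c) + + toℕ μ * (w b′ - w c′)))))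
          ≤⟨ (∑-mono Ω λ (b , b′) → ∑-mono Ω λ (c , c′) → ∑-linear (w b - w c) (w b′ - w c′)) ⟩
        ∑ Ω (λ (b , b′) → ∑ Ω (λ (c , c′) → 1ℤ + P * (δ (w b - w c) * δ (w b′ - w c′))))
          ≡⟨ trans (∑-cong Ω λ ω → trans (∑-+ Ω _ _) (cong₂ _+_ (∑-1 Ω) (∑-*ˡ Ω P _)))
              (trans (∑-+ Ω _ _) (cong₂ _+_ (∑-const Ω (size Ω)) (trans (∑-*ˡ Ω P _) (cong (_*_ P) factor)))) ⟩
        size Ω * size Ω + P * (E * E) ∎
        where
        open ≤-Reasoning
        difference : ∀ b b′ c c′ μ → b + μ * b′ - (c + μ * c′) ≡ b - c + μ * (b′ - c′)
        difference = solve-∀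
        factor : ∑ Ω (λ (b , b′) → ∑ Ω (λ (c , c′) → δ (w b - w c) * δ (w b′ - w c′))) ≡ E * E
        factor = trans (∑-cong Ω λ ω → trans (∑-cartesianProduct W W _) (∑-*-∑ W W _ _))
          (trans (∑-cartesianProduct W W _) (∑-*-∑ W W _ _))

      -- The summand `1ℤ` of `∑-linear` adds up to what a uniform distribution predicts and cancels
      -- against the mean. What is left counts the pairs ω, ω′ whose `w`-values agree in both
      -- coordinates.
      ∑g : ∑ (allFin p) g ≤ P * P * P * (E * E)
      ∑g = begin
        ∑ (allFin p) g
          ≡⟨ trans (∑-minus (allFin p) _ _) (cong₂ _-_ (∑-*ˡ (allFin p) (P * P) _)
               (∑-residues-const (P * (size Ω * size Ω)))) ⟩
        P * P * ∑ (allFin p) (λ μ → collisions Ω (twisted μ) Ω (twisted μ)) - P * (P * (size Ω * size Ω))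
          ≤⟨ +-monoˡ-≤ _ (*-monoˡ-≤-nonNeg (P * P) {{nonNegative (0≤i*i P)}} ∑-collisions-twisted) ⟩
        P * P * (size Ω * size Ω + P * (E * E)) - P * (P * (size Ω * size Ω))
          ≡⟨ collect P (size Ω * size Ω) (E * E) ⟩
        P * P * P * (E * E) ∎
        where
        open ≤-Reasoning
        collect : ∀ P s e → P * P * (s + P * e) - P * (P * s) ≡ P * P * P * e
        collect = solve-∀

      κ-energy : ∑ Π (λ π → ∑ Π (λ ρ → ⟦ κ π Fin.≟ κ ρ ⟧)) ≤ multiplicativeEnergy X x
      κ-energy = begin
        ∑ Π (λ π → ∑ Π (λ ρ → ⟦ κ π Fin.≟ κ ρ ⟧))
          ≤⟨ (∑-mono Π λ (a , a′) → ∑-mono Π λ (c , c′) →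
               ⟦⟧-mono (κ (a , a′) Fin.≟ κ (c , c′)) (P ∣? (x a * x c′ - x a′ * x c)) (proportional a a′ c c′)) ⟩
        ∑ Π (λ (a , a′) → ∑ Π (λ (c , c′) → δ (x a * x c′ - x a′ * x c)))
          ≡⟨ trans (∑-cartesianProduct X X _) (∑-cong X λ a → ∑-cong X λ a′ → ∑-cartesianProduct X X _) ⟩
        multiplicativeEnergy X x ∎
        where
        open ≤-Reasoning
        cross : ∀ x x′ y y′ u v → x * y′ - x′ * y ≡
          x′ * y * (x * u) - x′ * y * 1ℤ - (x * y′ * (y * v) - x * y′ * 1ℤ) + x * y * (v * y′ - u * x′)
        cross = solve-∀
        proportional : ∀ a a′ c c′ → κ (a , a′) ≡ κ (c , c′) → P ∣ x a * x c′ - x a′ * x c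
        proportional a a′ c c′ eq = ∣-resp (sym (cross (x a) (x a′) (x c) (x c′) (inv (x a)) (inv (x c))))
          (∣m∣n⇒∣m+n (∣m∣n⇒∣m-n
            (p∣- (*-cong (≋-refl {x a′ * x c}) (inv-inverse (x-unit a))))
            (p∣- (*-cong (≋-refl {x a * x c′}) (inv-inverse (x-unit c)))))
            (∣n⇒∣m*n (x a * x c) (p∣- (≋-trans (≋-residue (inv (x c) * x c′)) (≋-trans
              (≋-reflexive (cong (λ k → + toℕ k) (sym eq))) (≋-sym (≋-residue (inv (x a) * x a′))))))))

      S : (A × A) × (B × B) → ℤ
      S (π , ω) = s π ω

      excess-S : ∀ t → excess R S t ≡ ∑ Π (λ π → excess Ω (s π) t)
      excess-S t = sym (trans (∑-minus Π _ _) (cong₂ _-_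
        (trans (∑-*ˡ Π P _) (cong (_*_ P) (sym (∑-cartesianProduct Π Ω _))))
        (trans (∑-const Π (size Ω)) (sym (size-cartesianProduct Π Ω)))))

      ‖excess-S‖² : ∑ (allFin p) (λ t → excess R S t * excess R S t) ≤ multiplicativeEnergy X x * (P * P * P * (E * E))
      ‖excess-S‖² = begin
        ∑ (allFin p) (λ t → excess R S t * excess R S t)
          ≡⟨ ∑-cong (allFin p) (λ t → cong₂ _*_ (excess-S t) (excess-S t)) ⟩
        ∑ (allFin p) (λ t → ∑ Π (λ π → excess Ω (s π) t) * ∑ Π (λ π → excess Ω (s π) t))
          ≤⟨ classwise-cauchy-schwarz Π κ (allFin p) (λ π → excess Ω (s π)) g 0≤g ‖excess‖² ⟩
        ∑ Π (λ π → ∑ Π (λ ρ → ⟦ κ π Fin.≟ κ ρ ⟧)) * ∑ (allFin p) g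
          ≤⟨ *-monoʳ-≤-nonNeg (∑ (allFin p) g) {{nonNegative (∑-nonneg (allFin p) 0≤g)}} κ-energy ⟩
        multiplicativeEnergy X x * ∑ (allFin p) g
          ≤⟨ *-monoˡ-≤-nonNeg (multiplicativeEnergy X x) {{nonNegative (∑-nonneg X λ a → ∑-nonneg X λ a′ →
               ∑-nonneg X λ c → ∑-nonneg X λ c′ → ⟦⟧-nonneg (P ∣? (x a * x c′ - x a′ * x c)))}} ∑g ⟩
        multiplicativeEnergy X x * (P * P * P * (E * E)) ∎
        where open ≤-Reasoning

      reflected : ℤ → (A × A) × (B × B) → ℤ
      reflected λ₀ ρ = λ₀ - S ρ

      ‖reflected‖² : ∀ λ₀ → ∑ (allFin p) (λ t → excess R (reflected λ₀) t * excess R (reflected λ₀) t) ≡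
        ∑ (allFin p) (λ t → excess R S t * excess R S t)
      ‖reflected‖² λ₀ = trans (∑-excess-excess R (reflected λ₀) R (reflected λ₀))
        (trans (cong (λ c → P * P * c - P * (size R * size R)) (∑-cong R λ ρ → ∑-cong R λ ρ′ → δ-cong
          (λ p∣ → ∣-resp (flip₁ λ₀ (S ρ) (S ρ′)) (∣m⇒∣-m p∣))
          (λ p∣ → ∣-resp (flip₂ λ₀ (S ρ) (S ρ′)) (∣m⇒∣-m p∣))))
        (sym (∑-excess-excess R S R S)))
        where
        flip₁ : ∀ l s t → - (l - s - (l - t)) ≡ s - t
        flip₁ = solve-∀
        flip₂ : ∀ l s t → - (s - t) ≡ l - s - (l - t)
        flip₂ = solve-∀

      -- Two values of `S` add up to λ₀ exactly when `S` collides with `reflected λ₀`. Without any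
      -- collision the two excesses would have inner product -P |R|², whereas reflection preserves
      -- the norm and Cauchy-Schwarz bounds the inner product by `‖excess-S‖²`.
      collision-positive : ∀ λ₀ → P * P * (multiplicativeEnergy X x * (E * E)) < size R * size R →
        0ℤ < collisions R S R (reflected λ₀)
      collision-positive λ₀ small with 0ℤ <? collisions R S R (reflected λ₀)
      ... | yes 0<N = 0<N
      ... | no  0≮N = contradiction small (≤⇒≯ (*-cancelˡ-≤-pos (size R * size R) _ P {{P>0}} (begin
        P * (size R * size R)
          ≤⟨ 0≤i-j⇒j≤i (subst (0ℤ ≤_) (rearrange P (size R * size R) N) (*-nonneg (0≤i*i P) (neg-mono-≤ (≮⇒≥ 0≮N)))) ⟩
        - (P * P * N - P * (size R * size R))
          ≡⟨ cong -_ (∑-excess-excess R S R (reflected λ₀)) ⟨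
        - ∑ (allFin p) (λ t → u t * u′ t)
          ≡⟨ trans (sym (∑-neg (allFin p) _)) (∑-cong (allFin p) λ t → neg-distribˡ-* (u t) (u′ t)) ⟩
        ∑ (allFin p) (λ t → - u t * u′ t)
          ≤⟨ *-cancelˡ-≤-pos _ _ (+ 2) (begin
               + 2 * ∑ (allFin p) (λ t → - u t * u′ t)
                 ≤⟨ 2∑fg≤∑f²+∑g² (allFin p) (λ t → - u t) u′ ⟩
               ∑ (allFin p) (λ t → - u t * - u t) + ∑ (allFin p) (λ t → u′ t * u′ t)
                 ≡⟨ cong₂ _+_ (∑-cong (allFin p) λ t → neg² (u t)) (‖reflected‖² λ₀) ⟩
               ∑ (allFin p) (λ t → u t * u t) + ∑ (allFin p) (λ t → u t * u t)
                 ≡⟨ double (∑ (allFin p) (λ t → u t * u t)) ⟩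
               + 2 * ∑ (allFin p) (λ t → u t * u t) ∎) ⟩
        ∑ (allFin p) (λ t → u t * u t)
          ≤⟨ ‖excess-S‖² ⟩
        multiplicativeEnergy X x * (P * P * P * (E * E))
          ≡⟨ collect (multiplicativeEnergy X x) P (E * E) ⟩
        P * (P * P * (multiplicativeEnergy X x * (E * E))) ∎)))
        where
        open ≤-Reasoning
        N = collisions R S R (reflected λ₀)
        u = excess R S
        u′ = excess R (reflected λ₀)
        P>0 : Positive P
        P>0 = positive (+<+ (Data.Nat.>-nonZero⁻¹ p))
        neg² : ∀ i → - i * - i ≡ i * i
        neg² = solve-∀
        double : ∀ i → i + i ≡ + 2 * i
        double = solve-∀
        rearrange : ∀ P r N → P * P * - N ≡ - (P * P * N - P * r) - P * r
        rearrange = solve-∀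
        collect : ∀ m P e → m * (P * P * P * e) ≡ P * (P * P * (m * e))
        collect = solve-∀

      size-R : size R ≡ size X * size X * (size W * size W)
      size-R = trans (size-cartesianProduct Π Ω) (cong₂ _*_ (size-cartesianProduct X X) (size-cartesianProduct W W))

    four-products-cover : let r = size X * size X * (size W * size W) in
      P * P * (multiplicativeEnergy X x * (collisions W w W w * collisions W w W w)) < r * r →
      ∀ λ₀ → FourProducts x w λ₀
    four-products-cover small λ₀
      with ((a₁ , a₂) , (b₁ , b₂)) , pos ← ∑-positive⇒∃ R _ (collision-positive λ₀
             (subst (λ r → P * P * (multiplicativeEnergy X x * (E * E)) < r * r) (sym size-R) small))
      with ((a₃ , a₄) , (b₃ , b₄)) , pos ← ∑-positive⇒∃ R _ pos
      = (a₁ , a₂ , a₃ , a₄) , (b₁ , b₂ , b₃ , b₄) ,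
        mk (∣-resp (rearrange (s (a₁ , a₂) (b₁ , b₂)) λ₀ (s (a₃ , a₄) (b₃ , b₄))) (⟦⟧-positive (P ∣? _) pos))
      where
      rearrange : ∀ i l j → i - (l - j) ≡ i + j - l
      rearrange = solve-∀

-- The divisor bound.

module DivisorBound where
  open import Data.Nat
  open import Data.Nat.Properties
  open import Data.Nat.Divisibility
  open import Data.Nat.DivMod using (_/_; m≡m%n+[m/n]*n; m%n<n; m/n*n≤m)
  open import Data.Nat.Coprimality using (Coprime; coprime-divisor)
  open import Data.Nat.Induction using (<-rec)
  open import Data.Nat.ListAction using (product)
  open import Data.Nat.Primality
  open import Data.Nat.Primality.Factorisation using (factorise)
  open import Data.Nat.Tactic.RingSolver using (solve-∀)
  open import Data.List using (List; []; _∷_; _++_; map; length)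
  open import Data.List.Properties using (length-++; length-map)
  open import Data.List.Membership.Propositional using (_∈_)
  open import Data.List.Membership.Propositional.Properties using (∈-++⁺ˡ; ∈-++⁺ʳ; ∈-map⁺)
  open import Data.List.Relation.Unary.All using (All; []; _∷_)
  open import Data.List.Relation.Unary.Any using (here)
  open import Data.Product using (_×_; _,_; ∃-syntax)
  open import Data.Sum using (inj₁; inj₂)
  open import Relation.Nullary using (¬_; yes; no; contradiction)
  open import Relation.Binary.PropositionalEquality

  ContainsDivisors : ℕ → List ℕ → Set
  ContainsDivisors n ds = ∀ {d} → d ∣ n → d ∈ ds

  ^-distrib-* : ∀ m n k → (m * n) ^ k ≡ m ^ k * n ^ k
  ^-distrib-* m n zero    = refl
  ^-distrib-* m n (suc k) rewrite ^-distrib-* m n k = lemma m n (m ^ k) (n ^ k)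
    where
    lemma : ∀ a b c d → a * b * (c * d) ≡ a * c * (b * d)
    lemma = solve-∀

  prime∤⇒coprime : ∀ {q d} → Prime q → ¬ q ∣ d → Coprime d q
  prime∤⇒coprime q-prime q∤d (c∣d , c∣q) with prime⇒irreducible q-prime c∣q
  ... | inj₁ c≡1  = c≡1
  ... | inj₂ refl = contradiction c∣d q∤d

  powerDivisors : ℕ → ℕ → List ℕ → List ℕ
  powerDivisors q zero    ds = ds
  powerDivisors q (suc a) ds = ds ++ map (q *_) (powerDivisors q a ds)

  length-powerDivisors : ∀ q a ds → length (powerDivisors q a ds) ≡ suc a * length ds
  length-powerDivisors q zero    ds = sym (+-identityʳ _)
  length-powerDivisors q (suc a) ds = trans (length-++ ds)
    (cong (length ds +_) (trans (length-map (q *_) (powerDivisors q a ds)) (length-powerDivisors q a ds)))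

  ∤⇒∣-coprimePart : ∀ {q d m} → Prime q → ¬ q ∣ d → ∀ a → d ∣ q ^ a * m → d ∣ m
  ∤⇒∣-coprimePart {m = m} q-prime q∤d zero    d∣ = subst (_ ∣_) (*-identityˡ m) d∣
  ∤⇒∣-coprimePart {q} {d} {m} q-prime q∤d (suc a) d∣ = ∤⇒∣-coprimePart q-prime q∤d a
    (coprime-divisor (prime∤⇒coprime q-prime q∤d) (subst (d ∣_) (*-assoc q (q ^ a) m) d∣))

  containsDivisors-power : ∀ {q m ds} → Prime q → ContainsDivisors m ds →
    ∀ a → ContainsDivisors (q ^ a * m) (powerDivisors q a ds)
  containsDivisors-power {m = m} q-prime ds-all zero d∣ = ds-all (subst (_ ∣_) (*-identityˡ m) d∣)
  containsDivisors-power {q} {m} {ds} q-prime ds-all (suc a) {d} d∣ with q ∣? d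
  ... | no q∤d = ∈-++⁺ˡ (ds-all (∤⇒∣-coprimePart q-prime q∤d (suc a) d∣))
  ... | yes (divides d′ refl) = ∈-++⁺ʳ ds (subst (_∈ map (q *_) (powerDivisors q a ds)) (*-comm q d′)
          (∈-map⁺ (q *_) (containsDivisors-power q-prime ds-all a
            (*-cancelˡ-∣ q {{prime⇒nonZero q-prime}} (subst₂ _∣_ (*-comm d′ q) (*-assoc q (q ^ a) m) d∣)))))

  -- The bound O(n^(1/k)) in integers. A list that may contain more than the divisors stands for the
  -- divisor function, as only upper bounds for its length matter.
  FewDivisors : ℕ → ℕ → ℕ → Set
  FewDivisors k C n = ∃[ ds ] ContainsDivisors n ds × length ds ^ k ≤ C * n

  -- A prime factor q ≥ 2ᵏ at most doubles the number of divisors, so its k-th power grows by at most 2ᵏ ≤ q.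
  fewDivisors-rough : ∀ k (ps : List ℕ) → All (λ q → Prime q × 2 ^ k ≤ q) ps → FewDivisors k 1 (product ps)
  fewDivisors-rough k [] [] = 1 ∷ [] , (λ d∣1 → here (∣1⇒≡1 d∣1)) , ≤-reflexive (^-zeroˡ k)
  fewDivisors-rough k (q ∷ ps) ((q-prime , 2^k≤q) ∷ qs) with fewDivisors-rough k ps qs
  ... | ds , ds-all , bound = powerDivisors q 1 ds ,
    (λ {d} d∣ → containsDivisors-power q-prime ds-all 1
      (subst (λ r → d ∣ r * product ps) (sym (*-identityʳ q)) d∣)) , (begin
      length (powerDivisors q 1 ds) ^ k ≡⟨ cong (_^ k) (length-powerDivisors q 1 ds) ⟩
      (2 * length ds) ^ k               ≡⟨ ^-distrib-* 2 (length ds) k ⟩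
      2 ^ k * length ds ^ k             ≤⟨ *-mono-≤ 2^k≤q bound ⟩
      q * (1 * product ps)              ≡⟨ lemma q (product ps) ⟩
      1 * (q * product ps)              ∎)
    where
    open ≤-Reasoning
    lemma : ∀ q r → q * (1 * r) ≡ 1 * (q * r)
    lemma = solve-∀

  -- A prime power q^a multiplies the number of divisors by a + 1; this compares the k-th power of
  -- that factor with q^a ≥ 2^a, at the price of a constant. The reason is 1 + a ≤ k (1 + a / k) ≤ k
  -- 2^(a / k) with the integer quotient a / k.
  [1+a]^k≤k^k*2^a : ∀ k .{{_ : NonZero k}} a → suc a ^ k ≤ k ^ k * 2 ^ a
  [1+a]^k≤k^k*2^a k a = begin
    suc a ^ k                   ≤⟨ ^-monoˡ-≤ k 1+a≤k*[1+a/k] ⟩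
    (k * suc (a / k)) ^ k       ≡⟨ ^-distrib-* k (suc (a / k)) k ⟩
    k ^ k * suc (a / k) ^ k     ≤⟨ *-monoʳ-≤ (k ^ k) (^-monoˡ-≤ k (1+n≤2^n (a / k))) ⟩
    k ^ k * (2 ^ (a / k)) ^ k   ≡⟨ cong (k ^ k *_) (^-*-assoc 2 (a / k) k) ⟩
    k ^ k * 2 ^ (a / k * k)     ≤⟨ *-monoʳ-≤ (k ^ k) (^-monoʳ-≤ 2 (m/n*n≤m a k)) ⟩
    k ^ k * 2 ^ a               ∎
    where
    open ≤-Reasoning
    1+n≤2^n : ∀ n → suc n ≤ 2 ^ n
    1+n≤2^n zero    = ≤-refl
    1+n≤2^n (suc n) = begin
      suc (suc n)     ≤⟨ +-mono-≤ (m^n>0 2 n) (1+n≤2^n n) ⟩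
      2 ^ n + 2 ^ n   ≡⟨ cong (2 ^ n +_) (+-identityʳ (2 ^ n)) ⟨
      2 ^ suc n       ∎
    1+a≤k*[1+a/k] : suc a ≤ k * suc (a / k)
    1+a≤k*[1+a/k] = begin
      suc a                     ≡⟨ cong suc (m≡m%n+[m/n]*n a k) ⟩
      suc (a % k) + a / k * k   ≤⟨ +-monoˡ-≤ (a / k * k) (m%n<n a k) ⟩
      k + a / k * k             ≡⟨ *-comm (suc (a / k)) k ⟩
      k * suc (a / k)           ∎

  extractPower : ∀ q → 2 ≤ q → ∀ n → .{{NonZero n}} → ∃[ a ] ∃[ m ] (n ≡ q ^ a * m × ¬ q ∣ m)
  extractPower q 2≤q = <-rec Extracted λ n rec → step n (λ {m} → rec {m})
    where
    Extracted : ℕ → Set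
    Extracted n = .{{NonZero n}} → ∃[ a ] ∃[ m ] (n ≡ q ^ a * m × ¬ q ∣ m)
    step : ∀ n → (∀ {m} → m < n → Extracted m) → Extracted n
    step n rec with q ∣? n
    ... | no q∤n = 0 , n , sym (+-identityʳ n) , q∤n
    ... | yes (divides r refl) with rec {r} (m<m*n r q {{m*n≢0⇒m≢0 r}} 2≤q) {{m*n≢0⇒m≢0 r}}
    ... | a , m , refl , q∤m = suc a , m , lemma (q ^ a) m q , q∤m
      where
      lemma : ∀ x m q → x * m * q ≡ q * x * m
      lemma = solve-∀

  module _ (k : ℕ) .{{_ : NonZero k}} where

    private
      B = k ^ k

      roughFactors : ∀ n (ps : List ℕ) → All Prime ps → product ps ∣ n → (2 ^ k) Rough n → All (λ q → Prime q × 2 ^ k ≤ q) ps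
      roughFactors n []       []             _  _     = []
      roughFactors n (q ∷ ps) (q-prime ∷ qs) ∣n rough =
        (q-prime , rough⇒≤ {{prime⇒nonTrivial q-prime}} (rough∧∣⇒rough rough (∣-trans (m∣m*n (product ps)) ∣n))) ∷
        roughFactors n ps qs (∣-trans (n∣m*n q) ∣n) rough

      -- A sieve by induction on `j`, the number of steps that suffice to bring `q` up to 2^k. Each
      -- step splits off the full power of `q` and costs a factor `B`; the prime factors from 2^k on
      -- cost nothing, by `fewDivisors-rough`.
      fewDivisors : ∀ j q → 2 ^ k ≤ q + j → 2 ≤ q → ∀ n → .{{NonZero n}} → q Rough n → FewDivisors k (B ^ j) n
      fewDivisors zero q 2^k≤q 2≤q n rough with factorise n
      ... | record { factors = ps ; isFactorisation = refl ; factorsPrime = primes } =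
        fewDivisors-rough k ps (roughFactors n ps primes ∣-refl λ (hasNonTrivialDivisor d< d∣n) →
          rough (hasNonTrivialDivisor (<-≤-trans d< (≤-trans 2^k≤q (≤-reflexive (+-identityʳ q)))) d∣n))
      fewDivisors (suc j) q 2^k≤q+1+j 2≤q n rough with extractPower q 2≤q n
      ... | a , m , refl , q∤m
        with fewDivisors j (suc q) (subst (2 ^ k ≤_) (+-suc q j) 2^k≤q+1+j) (m≤n⇒m≤1+n 2≤q) m
               {{m*n≢0⇒n≢0 (q ^ a)}} (∤⇒rough-suc q∤m (rough∧∣⇒rough rough (n∣m*n (q ^ a))))
      ... | ds , ds-all , bound with a
      ...   | zero = ds , (λ {d} d∣ → ds-all (subst (d ∣_) (*-identityˡ m) d∣)) ,
              ≤-trans bound (*-mono-≤ (m≤n*m (B ^ j) B {{m^n≢0 k k}}) (≤-reflexive (sym (*-identityˡ m))))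
      ...   | a@(suc b) = powerDivisors q a ds ,
              containsDivisors-power q-prime ds-all a , (begin
                length (powerDivisors q a ds) ^ k  ≡⟨ cong (_^ k) (length-powerDivisors q a ds) ⟩
                (suc a * length ds) ^ k            ≡⟨ ^-distrib-* (suc a) (length ds) k ⟩
                suc a ^ k * length ds ^ k          ≤⟨ *-mono-≤ ([1+a]^k≤k^k*2^a k a) bound ⟩
                B * 2 ^ a * (B ^ j * m)            ≤⟨ *-monoˡ-≤ (B ^ j * m) (*-monoʳ-≤ B (^-monoˡ-≤ a 2≤q)) ⟩
                B * q ^ a * (B ^ j * m)            ≡⟨ rearrange B (q ^ a) (B ^ j) m ⟩
                B ^ suc j * (q ^ a * m)            ∎)
        where
        open ≤-Reasoning
        -- A divisor q of a q-rough number has no nontrivial divisor below itself.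
        q-prime : Prime q
        q-prime = rough∧∣⇒prime {{n>1⇒nonTrivial 2≤q}} rough (∣-trans (m∣m*n (q ^ b)) (m∣m*n m))
        rearrange : ∀ B x y m → B * x * (y * m) ≡ B * y * (x * m)
        rearrange = solve-∀

    divisorBound : ∃[ C ] (∀ n → .{{NonZero n}} → FewDivisors k C n)
    divisorBound = B ^ (2 ^ k) , λ n → fewDivisors (2 ^ k) 2 (m≤n+m (2 ^ k) 2) ≤-refl n 2-rough

-- Counting solutions by sums of indicators.

module Counting where
  open Sums
  open CauchySchwarz
  open import Data.Integer
  open import Data.Integer.Properties
  open import Data.List using (List; _∷_; length; allFin)
  open import Data.List.Membership.Propositional using (_∈_)
  open import Data.List.Relation.Unary.Any using (here; there)
  open import Data.Fin as Fin using (Fin; toℕ)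
  import Data.Fin.Properties as Fin
  import Data.Nat as ℕ
  import Data.Nat.Properties as ℕ
  open import Data.Product using (_×_; _,_)
  open import Data.Sum using (_⊎_; inj₁; inj₂)
  open import Relation.Nullary using (Dec; yes; no)
  open import Relation.Binary.PropositionalEquality

  ∑-unique≤1 : ∀ {n} {Q : Fin n → Set} (Q? : ∀ i → Dec (Q i)) → (∀ {i j} → Q i → Q j → i ≡ j) →
    ∑ (allFin n) (λ i → ⟦ Q? i ⟧) ≤ 1ℤ
  ∑-unique≤1 {n} Q? unique with Fin.any? Q?
  ... | yes (i , qi) = begin
    ∑ (allFin n) (λ j → ⟦ Q? j ⟧)                ≤⟨ ∑-mono (allFin n) (λ j → ⟦⟧-mono (Q? j) (i Fin.≟ j) (unique qi)) ⟩
    ∑ (allFin n) (λ j → ⟦ i Fin.≟ j ⟧)           ≡⟨ ∑-cong (allFin n) (λ j → sym (*-identityʳ _)) ⟩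
    ∑ (allFin n) (λ j → ⟦ i Fin.≟ j ⟧ * 1ℤ)      ≡⟨ ∑-δ i (λ _ → 1ℤ) ⟩
    1ℤ ∎
    where open ≤-Reasoning
  ... | no ¬∃ = begin
    ∑ (allFin n) (λ j → ⟦ Q? j ⟧) ≡⟨ ∑-cong (allFin n) (λ j → ⟦⟧-no (Q? j) (λ qj → ¬∃ (j , qj))) ⟩
    ∑ (allFin n) (λ j → 0ℤ)       ≡⟨ ∑-zero (allFin n) ⟩
    0ℤ                            ≤⟨ +≤+ ℕ.z≤n ⟩
    1ℤ ∎
    where open ≤-Reasoning

  ∑-injective : ∀ {m n} (φ : Fin m → Fin n) → (∀ {i j} → φ i ≡ φ j → i ≡ j) → (f : Fin n → ℤ) → (∀ j → 0ℤ ≤ f j) →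
    ∑ (allFin m) (λ i → f (φ i)) ≤ ∑ (allFin n) f
  ∑-injective {m} {n} φ φ-injective f 0≤f = begin
    ∑ (allFin m) (λ i → f (φ i))
      ≡⟨ ∑-cong (allFin m) (λ i → ∑-δ (φ i) f) ⟨
    ∑ (allFin m) (λ i → ∑ (allFin n) (λ j → ⟦ φ i Fin.≟ j ⟧ * f j))
      ≡⟨ trans (∑-swap (allFin m) (allFin n) _) (∑-cong (allFin n) λ j → ∑-*ʳ (allFin m) (f j) (λ i → ⟦ φ i Fin.≟ j ⟧)) ⟩
    ∑ (allFin n) (λ j → ∑ (allFin m) (λ i → ⟦ φ i Fin.≟ j ⟧) * f j)
      ≤⟨ ∑-mono (allFin n) (λ j → *-monoʳ-≤-nonNeg (f j) {{nonNegative (0≤f j)}}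
           (∑-unique≤1 (λ i → φ i Fin.≟ j) (λ φi≡j φi′≡j → φ-injective (trans φi≡j (sym φi′≡j))))) ⟩
    ∑ (allFin n) (λ j → 1ℤ * f j)
      ≡⟨ ∑-cong (allFin n) (λ j → *-identityˡ (f j)) ⟩
    ∑ (allFin n) f ∎
    where open ≤-Reasoning

  ∑∑≤length : ∀ {m n} {Q : Fin m → Fin n → Set} (Q? : ∀ i j → Dec (Q i j)) (L : List (ℕ × ℕ)) →
    (∀ i j → Q i j → (toℕ i , toℕ j) ∈ L) →
    ∑ (allFin m) (λ i → ∑ (allFin n) (λ j → ⟦ Q? i j ⟧)) ≤ + length L
  ∑∑≤length {m} {n} Q? L covered = begin
    ∑ (allFin m) (λ i → ∑ (allFin n) (λ j → ⟦ Q? i j ⟧))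
      ≤⟨ ∑-mono (allFin m) (λ i → ∑-mono (allFin n) (λ j → listed i j)) ⟩
    ∑ (allFin m) (λ i → ∑ (allFin n) (λ j → ∑ L (λ (a , b) → ⟦ toℕ i ℕ.≟ a ⟧ * ⟦ toℕ j ℕ.≟ b ⟧)))
      ≡⟨ trans (∑-cong (allFin m) λ i → ∑-swap (allFin n) L _) (∑-swap (allFin m) L _) ⟩
    ∑ L (λ (a , b) → ∑ (allFin m) (λ i → ∑ (allFin n) (λ j → ⟦ toℕ i ℕ.≟ a ⟧ * ⟦ toℕ j ℕ.≟ b ⟧)))
      ≡⟨ ∑-cong L (λ (a , b) → ∑-*-∑ (allFin m) (allFin n) (λ i → ⟦ toℕ i ℕ.≟ a ⟧) (λ j → ⟦ toℕ j ℕ.≟ b ⟧)) ⟩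
    ∑ L (λ (a , b) → ∑ (allFin m) (λ i → ⟦ toℕ i ℕ.≟ a ⟧) * ∑ (allFin n) (λ j → ⟦ toℕ j ℕ.≟ b ⟧))
      ≤⟨ ∑-mono L (λ (a , b) → ≤-trans
           (*-monoʳ-≤-nonNeg (∑ (allFin n) (λ j → ⟦ toℕ j ℕ.≟ b ⟧))
             {{nonNegative (∑-nonneg (allFin n) λ j → ⟦⟧-nonneg (toℕ j ℕ.≟ b))}} (atMostOne {m} a))
           (≤-trans (≤-reflexive (*-identityˡ _)) (atMostOne {n} b))) ⟩
    ∑ L (λ _ → 1ℤ)
      ≡⟨ trans (∑-const L 1ℤ) (*-identityʳ _) ⟩
    + length L ∎
    where
    open ≤-Reasoning
    atMostOne : ∀ {n} a → ∑ (allFin n) (λ i → ⟦ toℕ i ℕ.≟ a ⟧) ≤ 1ℤ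
    atMostOne {n} a = ∑-unique≤1 {n} (λ i → toℕ i ℕ.≟ a) (λ i≡a j≡a → Fin.toℕ-injective (trans i≡a (sym j≡a)))
    hit : ∀ {a b} (L : List (ℕ × ℕ)) → (a , b) ∈ L → 1ℤ ≤ ∑ L (λ (a′ , b′) → ⟦ a ℕ.≟ a′ ⟧ * ⟦ b ℕ.≟ b′ ⟧)
    hit {a} {b} (_ ∷ L) (here refl) = begin
      1ℤ      ≡⟨ cong₂ _*_ (⟦⟧-yes (a ℕ.≟ a) refl) (⟦⟧-yes (b ℕ.≟ b) refl) ⟨
      head    ≡⟨ +-identityʳ head ⟨
      head + 0ℤ ≤⟨ +-monoʳ-≤ head (∑-nonneg L λ (a′ , b′) → *-nonneg (⟦⟧-nonneg (a ℕ.≟ a′)) (⟦⟧-nonneg (b ℕ.≟ b′))) ⟩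
      head + _ ∎
      where head = ⟦ a ℕ.≟ a ⟧ * ⟦ b ℕ.≟ b ⟧
    hit {a} {b} ((a′ , b′) ∷ L) (there ∈L) = ≤-trans (hit L ∈L)
      (≤-trans (≤-reflexive (sym (+-identityˡ _))) (+-monoˡ-≤ _ (*-nonneg (⟦⟧-nonneg (a ℕ.≟ a′)) (⟦⟧-nonneg (b ℕ.≟ b′)))))
    listed : ∀ i j → ⟦ Q? i j ⟧ ≤ ∑ L (λ (a , b) → ⟦ toℕ i ℕ.≟ a ⟧ * ⟦ toℕ j ℕ.≟ b ⟧)
    listed i j with Q? i j
    ... | yes q = hit L (covered i j q)
    ... | no _  = ∑-nonneg L λ (a , b) → *-nonneg (⟦⟧-nonneg (toℕ i ℕ.≟ a)) (⟦⟧-nonneg (toℕ j ℕ.≟ b))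

  ∣i∣≤n⇒0≤i+n : ∀ i {n} → ∣ i ∣ ℕ.≤ n → 0ℤ ≤ i + + n
  ∣i∣≤n⇒0≤i+n (+ m)    _   = +≤+ ℕ.z≤n
  ∣i∣≤n⇒0≤i+n -[1+ m ] m<n = subst (0ℤ ≤_) (sym (⊖-≥ m<n)) (+≤+ ℕ.z≤n)

  m≡n±∣m-n∣ : ∀ m n → (m ≡ n ℕ.+ ∣ + m - + n ∣) ⊎ (m ≡ n ℕ.∸ ∣ + m - + n ∣)
  m≡n±∣m-n∣ m n with ℕ.≤-total n m
  ... | inj₁ n≤m = inj₁ (sym (trans (cong (n ℕ.+_) (trans (cong ∣_∣ (m-n≡m⊖n m n)) (cong ∣_∣ (⊖-≥ n≤m)))) (ℕ.m+[n∸m]≡n n≤m)))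
  ... | inj₂ m≤n = inj₂ (sym (trans (cong (n ℕ.∸_) (trans (cong ∣_∣ (m-n≡m⊖n m n)) (∣⊖∣-≤ m≤n))) (ℕ.m∸[m∸n]≡n m≤n)))

-- Rational approximation modulo p and intervals of units.

module Pigeonhole (p : ℕ) (p-prime : Prime p) where
  open Modular p p-prime
  open import Data.Integer hiding (_/_; _%_)
  open import Data.Integer.Properties
  open import Data.Integer.Divisibility.Signed
  open import Data.Integer.Tactic.RingSolver using (solve-∀)
  open import Data.Fin as Fin using (Fin; toℕ; fromℕ<)
  import Data.Fin.Properties as Fin
  import Data.Nat as ℕ
  import Data.Nat.Properties as ℕ
  open import Data.Nat.DivMod using (_/_; _%_; m<n*o⇒m/o<n; m≡m%n+[m/n]*n; m%n<n)
  open import Data.Product using (_×_; _,_; ∃-syntax)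
  open import Relation.Nullary using (yes; no)
  open import Relation.Binary.PropositionalEquality

  /-equal⇒close : ∀ m n → m / p ≡ n / p → ∣ + m - + n ∣ ℕ.< p
  /-equal⇒close m n eq = subst (ℕ._< p) (cong ∣_∣ (sym difference))
    (ℕ.≤-<-trans (subst (ℕ._≤ (m % p) ℕ.⊔ (n % p)) (cong ∣_∣ (sym (m-n≡m⊖n (m % p) (n % p))))
      (∣m⊝n∣≤m⊔n (m % p) (n % p))) (ℕ.⊔-pres-<m (m%n<n m p) (m%n<n n p)))
    where
    cancel : ∀ r s q → r + q - (s + q) ≡ r - s
    cancel = solve-∀
    difference : + m - + n ≡ + (m % p) - + (n % p)
    difference = trans (cong₂ (λ i j → + i - + j) (m≡m%n+[m/n]*n m p)
        (trans (m≡m%n+[m/n]*n n p) (cong (λ q → n % p ℕ.+ q ℕ.* p) (sym eq))))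
      (cancel (+ (m % p)) (+ (n % p)) (+ (m / p ℕ.* p)))

  module _ (θ : ℤ) (X : ℕ) .{{_ : ℕ.NonZero X}} where

    private
      r : Fin (ℕ.suc X) → ℕ
      r t = toℕ (residue (+ toℕ t * θ))

      box : Fin (ℕ.suc X) → Fin X
      box t = fromℕ< (m<n*o⇒m/o<n {r t ℕ.* X} {X} {p}
        (subst (r t ℕ.* X ℕ.<_) (ℕ.*-comm p X) (ℕ.*-monoˡ-< X (Fin.toℕ<n (residue (+ toℕ t * θ))))))

      distrib : ∀ t s θ → (t - s) * θ ≡ t * θ - s * θ
      distrib = solve-∀

      scale : ∀ t s → + (r t ℕ.* X) - + (r s ℕ.* X) ≡ (+ r t - + r s) * + X
      scale t s = trans (cong₂ _-_ (pos-* (r t) X) (pos-* (r s) X)) (sym (distrib (+ r t) (+ r s) (+ X)))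

    -- Thue's lemma: the residues r of tθ for 0 ≤ t ≤ X fall into X boxes according to the integer
    -- part of r X / p, and two residues in one box differ by some v with |v| X < p.
    thue : ∃[ u ] ∃[ v ] (1 ℕ.≤ u × u ℕ.≤ X × ∣ v ∣ ℕ.* X ℕ.< p × + u * θ ≋ v)
    thue with Fin.pigeonhole (ℕ.n<1+n X) box
    ... | s , t , s<t , eq = toℕ t ℕ.∸ toℕ s , + r t - + r s ,
      ℕ.m<n⇒0<n∸m s<t , ℕ.≤-trans (ℕ.m∸n≤m (toℕ t) (toℕ s)) (Fin.toℕ≤pred[n] t) ,
      subst (ℕ._< p) (trans (cong ∣_∣ (scale t s)) (abs-* (+ r t - + r s) (+ X)))
        (/-equal⇒close (r t ℕ.* X) (r s ℕ.* X) (sym box-equal)) ,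
      ≋-trans (≋-reflexive (trans (cong (_* θ) (trans (sym (⊖-≥ (ℕ.<⇒≤ s<t))) (sym (m-n≡m⊖n (toℕ t) (toℕ s)))))
        (distrib (+ toℕ t) (+ toℕ s) θ))) (minus-cong (≋-residue (+ toℕ t * θ)) (≋-residue (+ toℕ s * θ)))
      where
      box-equal : r s ℕ.* X / p ≡ r t ℕ.* X / p
      box-equal = trans (sym (Fin.toℕ-fromℕ< _)) (trans (cong toℕ eq) (Fin.toℕ-fromℕ< _))

  small⇒unit : ∀ {n} → 1 ℕ.≤ n → n ℕ.< p → Unit (+ n)
  small⇒unit {ℕ.suc n} 1≤n n<p p∣n with ∣∧∣∣<⇒≡0 p∣n n<p
  ... | ()

  -- The sums of two elements of an interval of length n fill an interval of length 2n, and at most one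
  -- of two adjacent such intervals contains a multiple of p.
  unitSubinterval : ∀ b n → 4 ℕ.* n ℕ.≤ p → ∃[ c ] (c ℕ.≤ n × (∀ {i} → i ℕ.< 2 ℕ.* n → Unit (+ 2 * (b + + c) + + i)))
  unitSubinterval b n 4n≤p with Fin.any? {2 ℕ.* n} (λ i → P ∣? (+ 2 * (b + + 0) + + toℕ i))
  ... | no ¬∃ = 0 , ℕ.z≤n , λ i<2n p∣ → ¬∃ (fromℕ< i<2n ,
          subst (λ i → P ∣ + 2 * (b + + 0) + + i) (sym (Fin.toℕ-fromℕ< i<2n)) p∣)
  -- A multiple of p in each of the adjacent intervals would make p divide 2n + i - j, which is
  -- positive and less than 4n ≤ p.
  ... | yes (j , p∣j) = n , ℕ.≤-refl , λ {i} i<2n p∣i → small⇒unit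
    (ℕ.m<n⇒0<n∸m (ℕ.<-≤-trans (Fin.toℕ<n j) (ℕ.m≤m+n (2 ℕ.* n) i)))
    (ℕ.≤-<-trans (ℕ.m∸n≤m (2 ℕ.* n ℕ.+ i) (toℕ j)) (ℕ.<-≤-trans (ℕ.+-monoʳ-< (2 ℕ.* n) i<2n) (ℕ.≤-trans (ℕ.≤-reflexive (four n)) 4n≤p)))
    (∣-resp (trans (difference b (+ n) (+ i) (+ toℕ j)) (trans (cong (λ e → e + + i - + toℕ j) (sym (pos-* 2 n)))
      (trans (m-n≡m⊖n (2 ℕ.* n ℕ.+ i) (toℕ j)) (⊖-≥ (ℕ.≤-trans (ℕ.<⇒≤ (Fin.toℕ<n j)) (ℕ.m≤m+n (2 ℕ.* n) i))))))
      (∣m∣n⇒∣m-n p∣i p∣j))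
    where
    difference : ∀ b n i j → + 2 * (b + n) + i - (+ 2 * (b + + 0) + j) ≡ + 2 * n + i - j
    difference = solve-∀
    open import Data.Nat.Tactic.RingSolver renaming (solve-∀ to solveℕ-∀)
    four : ∀ n → 2 ℕ.* n ℕ.+ 2 ℕ.* n ≡ 4 ℕ.* n
    four = solveℕ-∀

-- Tables of divisors.

module DivisorTables where
  open DivisorBound using (ContainsDivisors)
  open import Data.Nat
  open import Data.List using (List; length)

  -- Completeness is asked only up to `B`, but shortness for every n, so that the lengths of
  -- candidate lists can be bounded without knowing the size of the number being factored.
  record DivisorTable (B τ : ℕ) : Set where
    field
      divisors : ℕ → List ℕ
      complete : ∀ n → .{{NonZero n}} → n ≤ B → ContainsDivisors n (divisors n)
      short    : ∀ n → length (divisors n) ≤ τ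

-- Multiplicative energy of an interval of length at most √p.

module IntervalEnergy (p : ℕ) (p-prime : Prime p) where
  open Sums
  open CauchySchwarz
  open Counting
  open Modular p p-prime
  open BilinearCovering p p-prime using (multiplicativeEnergy)
  open DivisorTables
  open import Data.Integer
  open import Data.Integer.Properties
  open import Data.Integer.Divisibility.Signed
  open import Data.Integer.Tactic.RingSolver using (solve-∀)
  open import Data.List using (List; length; allFin; cartesianProduct; map; _++_; upTo)
  open import Data.List.Properties using (length-++; length-map; length-tabulate; length-upTo)
  open import Data.List.Membership.Propositional using (_∈_)
  open import Data.List.Membership.Propositional.Properties using (∈-++⁺ˡ; ∈-++⁺ʳ; ∈-map⁺; ∈-cartesianProduct⁺; ∈-upTo⁺)
  open import Data.Fin as Fin using (Fin; toℕ; fromℕ<)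
  import Data.Fin.Properties as Fin
  import Data.Nat as ℕ
  import Data.Nat.Properties as ℕ
  import Data.Nat.Divisibility as ℕ
  import Data.Nat.Tactic.RingSolver as ℕ
  open import Data.Product using (_,_)
  open import Data.Sum using (_⊎_; inj₁; inj₂; [_,_]′)
  open import Relation.Binary.PropositionalEquality

  ≋⇒∣∣≡ : ∀ z {r} → ∣ z ∣ ℕ.< p → r ℕ.< p → z ≋ + r → ∣ z ∣ ≡ r ⊎ ∣ z ∣ ≡ p ℕ.∸ r
  ≋⇒∣∣≡ (+ n)      {r} n<p r<p z≋r = inj₁ (≋⇒toℕ≡ n<p r<p z≋r)
  ≋⇒∣∣≡ -[1+ n ]   {r} n<p r<p z≋r = inj₂ (trans (sym (ℕ.m∸[m∸n]≡n (ℕ.<⇒≤ n<p))) (cong (p ℕ.∸_)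
    (≋⇒toℕ≡ (ℕ.∸-monoʳ-< (ℕ.s≤s ℕ.z≤n) (ℕ.<⇒≤ n<p)) r<p (≋-trans (mk (divides 1ℤ shift)) z≋r))))
    where
    cancel : ∀ P m → P - m - - m ≡ 1ℤ * P
    cancel = solve-∀
    shift : + (p ℕ.∸ ℕ.suc n) - -[1+ n ] ≡ 1ℤ * P
    shift = trans (cong (_- -[1+ n ]) (trans (sym (⊖-≥ (ℕ.<⇒≤ n<p))) (sym (m-n≡m⊖n p (ℕ.suc n))))) (cancel P (+ ℕ.suc n))

  module _ {B τ : ℕ} (table : DivisorTable B τ) (p≤B : p ℕ.≤ B)
    (a : ℤ) (M : ℕ) (M²≤p : M ℕ.* M ℕ.≤ p) (4M≤p : 4 ℕ.* M ℕ.≤ p) (M>0 : 0 ℕ.< M)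
    (a+i-unit : ∀ (i : Fin M) → Unit (a + + toℕ i)) where

    open DivisorTable table

    private
      x : Fin M → ℤ
      x i = a + + toℕ i

      -- The variable h = x₄ + x₃ - x₁ - x₂ lies between -2M and 2M and is stored with a shift by
      -- 2M.
      offset : Fin (4 ℕ.* M) → ℤ
      offset h = + toℕ h - + (2 ℕ.* M)

      shifted : Fin M → Fin M → Fin M → Fin (4 ℕ.* M) → ℤ
      shifted i j k h = (+ toℕ i - + toℕ j) * (+ toℕ k - + toℕ j) - x j * offset h

      four : ∀ M → M ℕ.+ (M ℕ.+ 2 ℕ.* M) ≡ 4 ℕ.* M
      four = ℕ.solve-∀

      φ< : ∀ (i j k c : Fin M) → toℕ c ℕ.+ (toℕ j ℕ.+ 2 ℕ.* M ℕ.∸ (toℕ i ℕ.+ toℕ k)) ℕ.< 4 ℕ.* M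
      φ< i j k c = ℕ.<-≤-trans (ℕ.+-mono-<-≤ (Fin.toℕ<n c) (ℕ.≤-trans (ℕ.m∸n≤m _ (toℕ i ℕ.+ toℕ k))
        (ℕ.+-monoˡ-≤ (2 ℕ.* M) (ℕ.<⇒≤ (Fin.toℕ<n j))))) (ℕ.≤-reflexive (four M))

      φ : Fin M → Fin M → Fin M → Fin M → Fin (4 ℕ.* M)
      φ i j k c = fromℕ< (φ< i j k c)

      φ-injective : ∀ i j k {c c′} → φ i j k c ≡ φ i j k c′ → c ≡ c′
      φ-injective i j k {c} {c′} eq = Fin.toℕ-injective (ℕ.+-cancelʳ-≡ _ (toℕ c) (toℕ c′)
        (trans (sym (Fin.toℕ-fromℕ< (φ< i j k c))) (trans (cong toℕ eq) (Fin.toℕ-fromℕ< (φ< i j k c′)))))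

      offset-φ : ∀ i j k c → offset (φ i j k c) ≡ + toℕ c + + toℕ j - (+ toℕ i + + toℕ k)
      offset-φ i j k c = trans (cong (λ n → + n - + (2 ℕ.* M)) (Fin.toℕ-fromℕ< (φ< i j k c)))
        (trans (cong (λ e → + toℕ c + e - + (2 ℕ.* M)) (trans (sym (⊖-≥ i+k≤j+2M)) (sym (m-n≡m⊖n (toℕ j ℕ.+ 2 ℕ.* M) (toℕ i ℕ.+ toℕ k)))))
        (cancel (+ toℕ c) (+ toℕ j) (+ (2 ℕ.* M)) (+ toℕ i + + toℕ k)))
        where
        i+k≤j+2M : toℕ i ℕ.+ toℕ k ℕ.≤ toℕ j ℕ.+ 2 ℕ.* M
        i+k≤j+2M = ℕ.≤-trans (ℕ.+-mono-≤ (ℕ.<⇒≤ (Fin.toℕ<n i)) (ℕ.<⇒≤ (Fin.toℕ<n k)))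
          (ℕ.≤-trans (ℕ.≤-reflexive (cong (M ℕ.+_) (sym (ℕ.+-identityʳ M)))) (ℕ.m≤n+m (2 ℕ.* M) (toℕ j)))
        cancel : ∀ c j m s → c + (j + m - s) - m ≡ c + j - s
        cancel = solve-∀

      shifted-φ : ∀ i j k c → x i * x k - x j * x c ≡ shifted i j k (φ i j k c)
      shifted-φ i j k c = trans (identity a (+ toℕ i) (+ toℕ j) (+ toℕ k) (+ toℕ c))
        (cong (λ o → (+ toℕ i - + toℕ j) * (+ toℕ k - + toℕ j) - x j * o) (sym (offset-φ i j k c)))
        where
        identity : ∀ a i j k c → (a + i) * (a + k) - (a + j) * (a + c) ≡ (i - j) * (k - j) - (a + j) * (c + j - (i + k))
        identity = solve-∀

      ∣i-j∣<M : ∀ (i j : Fin M) → ∣ + toℕ i - + toℕ j ∣ ℕ.< M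
      ∣i-j∣<M i j = subst (ℕ._< M) (cong ∣_∣ (sym (m-n≡m⊖n (toℕ i) (toℕ j))))
        (ℕ.≤-<-trans (∣m⊝n∣≤m⊔n (toℕ i) (toℕ j)) (ℕ.⊔-pres-<m (Fin.toℕ<n i) (Fin.toℕ<n j)))

      ∣df∣<p : ∀ i j k → ∣ (+ toℕ i - + toℕ j) * (+ toℕ k - + toℕ j) ∣ ℕ.< p
      ∣df∣<p i j k = subst (ℕ._< p) (sym (abs-* (+ toℕ i - + toℕ j) (+ toℕ k - + toℕ j)))
        (ℕ.<-≤-trans (ℕ.*-mono-< (∣i-j∣<M i j) (∣i-j∣<M k j)) M²≤p)

      ∣offset∣<p : ∀ h → ∣ offset h ∣ ℕ.< p
      ∣offset∣<p h = subst (ℕ._< p) (cong ∣_∣ (sym (m-n≡m⊖n (toℕ h) (2 ℕ.* M))))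
        (ℕ.≤-<-trans (∣m⊝n∣≤m⊔n (toℕ h) (2 ℕ.* M)) (ℕ.⊔-pres-<m (ℕ.<-≤-trans (Fin.toℕ<n h) 4M≤p)
          (ℕ.<-≤-trans (ℕ.*-monoˡ-< M {{ℕ.>-nonZero M>0}} {2} {4} (ℕ.s≤s (ℕ.s≤s (ℕ.s≤s ℕ.z≤n)))) 4M≤p)))

      -- An integer smaller than p in absolute value and congruent to `r` has absolute value `r` or
      -- `p ∸ r`. If it is (i - j)(k - j), then i - j is, up to sign, a divisor of one of these two
      -- numbers.
      candidates : Fin M → ℕ → List ℕ
      candidates j r = map (toℕ j ℕ.+_) ds ++ map (toℕ j ℕ.∸_) ds
        where ds = divisors r ++ divisors (p ℕ.∸ r)

      length-candidates : ∀ (j : Fin M) r → length (candidates j r) ℕ.≤ 4 ℕ.* τ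
      length-candidates j r = begin
        length (candidates j r)
          ≡⟨ trans (length-++ (map (toℕ j ℕ.+_) ds)) (cong₂ ℕ._+_ (length-map (toℕ j ℕ.+_) ds) (length-map (toℕ j ℕ.∸_) ds)) ⟩
        length ds ℕ.+ length ds
          ≤⟨ ℕ.+-mono-≤ ds-short ds-short ⟩
        τ ℕ.+ τ ℕ.+ (τ ℕ.+ τ)
          ≡⟨ collect τ ⟩
        4 ℕ.* τ ∎
        where
        open ℕ.≤-Reasoning
        ds = divisors r ++ divisors (p ℕ.∸ r)
        ds-short : length ds ℕ.≤ τ ℕ.+ τ
        ds-short = subst (ℕ._≤ τ ℕ.+ τ) (sym (length-++ (divisors r))) (ℕ.+-mono-≤ (short r) (short (p ℕ.∸ r)))
        collect : ∀ τ → τ ℕ.+ τ ℕ.+ (τ ℕ.+ τ) ≡ 4 ℕ.* τ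
        collect = ℕ.solve-∀

      ∈-candidates : ∀ (i j : Fin M) {r n} → 0 ℕ.< r → r ℕ.< p → n ≡ r ⊎ n ≡ p ℕ.∸ r →
        ∣ + toℕ i - + toℕ j ∣ ℕ.∣ n → toℕ i ∈ candidates j r
      ∈-candidates i j {r} 0<r r<p n≡ d∣n = [ left , right ]′ (m≡n±∣m-n∣ (toℕ i) (toℕ j))
        where
        ds = divisors r ++ divisors (p ℕ.∸ r)
        d = ∣ + toℕ i - + toℕ j ∣
        listed : ∀ {n} → n ≡ r ⊎ n ≡ p ℕ.∸ r → d ℕ.∣ n → d ∈ ds
        listed (inj₁ refl) d∣n = ∈-++⁺ˡ (complete r {{ℕ.>-nonZero 0<r}} (ℕ.≤-trans (ℕ.<⇒≤ r<p) p≤B) d∣n)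
        listed (inj₂ refl) d∣n = ∈-++⁺ʳ (divisors r) (complete (p ℕ.∸ r) {{ℕ.>-nonZero (ℕ.m<n⇒0<n∸m r<p)}} (ℕ.≤-trans (ℕ.m∸n≤m p r) p≤B) d∣n)
        d∈ds : d ∈ ds
        d∈ds = listed n≡ d∣n
        left : toℕ i ≡ toℕ j ℕ.+ d → toℕ i ∈ candidates j r
        left eq = subst (_∈ candidates j r) (sym eq) (∈-++⁺ˡ (∈-map⁺ (toℕ j ℕ.+_) d∈ds))
        right : toℕ i ≡ toℕ j ℕ.∸ d → toℕ i ∈ candidates j r
        right eq = subst (_∈ candidates j r) (sym eq) (∈-++⁺ʳ (map (toℕ j ℕ.+_) ds) (∈-map⁺ (toℕ j ℕ.∸_) d∈ds))

      T : ℕ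
      T = 4 ℕ.* τ ℕ.* (4 ℕ.* τ)

      -- If x_j h ≢ 0, then i and k each lie in a list of 4τ candidates, from two divisor lists and
      -- two signs. If x_j h ≡ 0, then h = 0 because x_j is a unit, and (i - j)(k - j) vanishes as
      -- an integer because M² ≤ p; so i = j or k = j, which allows at most 2M pairs.
      ∑∑-shifted : ∀ j h → ∑ (allFin M) (λ i → ∑ (allFin M) (λ k → δ (shifted i j k h))) ≤
        ⟦ toℕ h ℕ.≟ 2 ℕ.* M ⟧ * + (2 ℕ.* M) + + T
      ∑∑-shifted j h with toℕ (residue (x j * offset h)) in r≡ | ≋-residue (x j * offset h) | Fin.toℕ<n (residue (x j * offset h))
      ... | ℕ.suc r | ≋r | r<p = begin
        ∑ (allFin M) (λ i → ∑ (allFin M) (λ k → δ (shifted i j k h)))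
          ≤⟨ ∑∑≤length (λ i k → P ∣? shifted i j k h) (cartesianProduct C C) covered ⟩
        + length (cartesianProduct C C)
          ≤⟨ +≤+ (ℕ.≤-trans (ℕ.≤-reflexive (length-cartesianProduct C C)) (ℕ.*-mono-≤ (length-candidates j (ℕ.suc r)) (length-candidates j (ℕ.suc r)))) ⟩
        + T
          ≤⟨ i≤j+i _ _ {{nonNegative (*-nonneg (⟦⟧-nonneg (toℕ h ℕ.≟ 2 ℕ.* M)) (+≤+ ℕ.z≤n))}} ⟩
        ⟦ toℕ h ℕ.≟ 2 ℕ.* M ⟧ * + (2 ℕ.* M) + + T ∎
        where
        open ≤-Reasoning
        C = candidates j (ℕ.suc r)
        covered : ∀ i k → P ∣ shifted i j k h → (toℕ i , toℕ k) ∈ cartesianProduct C C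
        covered i k p∣ = ∈-cartesianProduct⁺
          (∈-candidates i j (ℕ.s≤s ℕ.z≤n) r<p df≡ (subst (∣ d ∣ ℕ.∣_) (sym (abs-* d f)) (ℕ.m∣m*n ∣ f ∣)))
          (∈-candidates k j (ℕ.s≤s ℕ.z≤n) r<p df≡ (subst (∣ f ∣ ℕ.∣_) (sym (abs-* d f)) (ℕ.n∣m*n ∣ d ∣)))
          where
          d = + toℕ i - + toℕ j
          f = + toℕ k - + toℕ j
          df≡ = ≋⇒∣∣≡ (d * f) (∣df∣<p i j k) r<p (≋-trans (mk p∣) ≋r)
      ... | ℕ.zero | ≋0 | _ = begin
        ∑ (allFin M) (λ i → ∑ (allFin M) (λ k → δ (shifted i j k h)))
          ≤⟨ ∑∑≤length (λ i k → P ∣? shifted i j k h) L covered ⟩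
        + length L
          ≡⟨ cong +_ (trans (length-++ (map (toℕ j ,_) (upTo M))) (cong₂ ℕ._+_
               (trans (length-map (toℕ j ,_) (upTo M)) (length-upTo M))
               (trans (length-map (_, toℕ j) (upTo M)) (trans (length-upTo M) (sym (ℕ.+-identityʳ M)))))) ⟩
        + (2 ℕ.* M)
          ≡⟨ *-identityˡ _ ⟨
        1ℤ * + (2 ℕ.* M)
          ≡⟨ cong (_* + (2 ℕ.* M)) (⟦⟧-yes (toℕ h ℕ.≟ 2 ℕ.* M) h≡2M) ⟨
        ⟦ toℕ h ℕ.≟ 2 ℕ.* M ⟧ * + (2 ℕ.* M)
          ≤⟨ i≤i+j _ _ ⟩
        ⟦ toℕ h ℕ.≟ 2 ℕ.* M ⟧ * + (2 ℕ.* M) + + T ∎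
        where
        open ≤-Reasoning
        L = map (toℕ j ,_) (upTo M) ++ map (_, toℕ j) (upTo M)
        offset≡0 : offset h ≡ 0ℤ
        offset≡0 = ∣∧∣∣<⇒≡0 (unit-cancel (a+i-unit j) (≋0⇒∣ ≋0)) (∣offset∣<p h)
        h≡2M : toℕ h ≡ 2 ℕ.* M
        h≡2M = +-injective (i-j≡0⇒i≡j (+ toℕ h) _ offset≡0)
        cases : ∀ i k → (+ toℕ i - + toℕ j ≡ 0ℤ) ⊎ (+ toℕ k - + toℕ j ≡ 0ℤ) → (toℕ i , toℕ k) ∈ L
        cases i k (inj₁ i-j≡0) = ∈-++⁺ˡ (subst (λ n → (n , toℕ k) ∈ map (toℕ j ,_) (upTo M)) (sym (+-injective (i-j≡0⇒i≡j (+ toℕ i) (+ toℕ j) i-j≡0)))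
              (∈-map⁺ (toℕ j ,_) (∈-upTo⁺ (Fin.toℕ<n k))))
        cases i k (inj₂ k-j≡0) = ∈-++⁺ʳ (map (toℕ j ,_) (upTo M)) (subst (λ n → (toℕ i , n) ∈ map (_, toℕ j) (upTo M)) (sym (+-injective (i-j≡0⇒i≡j (+ toℕ k) (+ toℕ j) k-j≡0)))
              (∈-map⁺ (_, toℕ j) (∈-upTo⁺ (Fin.toℕ<n i))))
        covered : ∀ i k → P ∣ shifted i j k h → (toℕ i , toℕ k) ∈ L
        covered i k p∣ = cases i k (i*j≡0⇒i≡0∨j≡0 (+ toℕ i - + toℕ j) (∣∧∣∣<⇒≡0 (≋0⇒∣ (≋-trans (mk p∣) ≋0)) (∣df∣<p i j k)))

    -- Writing d = x₁ - x₃, f = x₂ - x₃ and h = x₄ + x₃ - x₁ - x₂, the equation x₁x₂ ≡ x₃x₄ becomes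
    -- d f ≡ x₃ h, where d f is determined as an integer up to two choices by x₃ and h.
    multiplicativeEnergy-interval : multiplicativeEnergy (allFin M) (λ i → a + + toℕ i) ≤
      + (M ℕ.* (2 ℕ.* M ℕ.+ 4 ℕ.* M ℕ.* (4 ℕ.* τ ℕ.* (4 ℕ.* τ))))
    multiplicativeEnergy-interval = begin
      ∑ Ms (λ i → ∑ Ms (λ j → ∑ Ms (λ c → ∑ Ms (λ k → δ (x i * x k - x j * x c)))))
        ≡⟨ (∑-cong Ms λ i → ∑-cong Ms λ j → ∑-swap Ms Ms _) ⟩
      ∑ Ms (λ i → ∑ Ms (λ j → ∑ Ms (λ k → ∑ Ms (λ c → δ (x i * x k - x j * x c)))))
        ≡⟨ (∑-cong Ms λ i → ∑-cong Ms λ j → ∑-cong Ms λ k → ∑-cong Ms λ c → cong δ (shifted-φ i j k c)) ⟩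
      ∑ Ms (λ i → ∑ Ms (λ j → ∑ Ms (λ k → ∑ Ms (λ c → δ (shifted i j k (φ i j k c))))))
        -- For fixed i, j, k the map c ↦ h is injective, so letting h range freely only adds
        -- nonnegative terms. Then i and k can be counted for fixed j and h.
        ≤⟨ (∑-mono Ms λ i → ∑-mono Ms λ j → ∑-mono Ms λ k → ∑-injective (φ i j k) (φ-injective i j k)
             (λ h → δ (shifted i j k h)) (λ h → ⟦⟧-nonneg (P ∣? shifted i j k h))) ⟩
      ∑ Ms (λ i → ∑ Ms (λ j → ∑ Ms (λ k → ∑ hs (λ h → δ (shifted i j k h)))))
        ≡⟨ trans (∑-swap Ms Ms _) (∑-cong Ms λ j → trans (∑-cong Ms λ i → ∑-swap Ms hs _) (∑-swap Ms hs _)) ⟩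
      ∑ Ms (λ j → ∑ hs (λ h → ∑ Ms (λ i → ∑ Ms (λ k → δ (shifted i j k h)))))
        ≤⟨ (∑-mono Ms λ j → ∑-mono hs λ h → ∑∑-shifted j h) ⟩
      ∑ Ms (λ j → ∑ hs (λ h → ⟦ toℕ h ℕ.≟ 2 ℕ.* M ⟧ * + (2 ℕ.* M) + + T))
        ≤⟨ (∑-mono Ms λ j → begin
             ∑ hs (λ h → ⟦ toℕ h ℕ.≟ 2 ℕ.* M ⟧ * + (2 ℕ.* M) + + T)
               ≡⟨ ∑-+ hs _ _ ⟩
             ∑ hs (λ h → ⟦ toℕ h ℕ.≟ 2 ℕ.* M ⟧ * + (2 ℕ.* M)) + ∑ hs (λ _ → + T)
               ≡⟨ cong₂ _+_ (∑-*ʳ hs (+ (2 ℕ.* M)) (λ h → ⟦ toℕ h ℕ.≟ 2 ℕ.* M ⟧)) (trans (∑-const hs (+ T)) (cong (λ n → + n * + T) (length-tabulate {n = 4 ℕ.* M} (λ i → i)))) ⟩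
             ∑ hs (λ h → ⟦ toℕ h ℕ.≟ 2 ℕ.* M ⟧) * + (2 ℕ.* M) + + (4 ℕ.* M) * + T
               ≤⟨ +-monoˡ-≤ _ (*-monoʳ-≤-nonNeg (+ (2 ℕ.* M)) (∑-unique≤1 {4 ℕ.* M} (λ h → toℕ h ℕ.≟ 2 ℕ.* M)
                    (λ h≡ h′≡ → Fin.toℕ-injective (trans h≡ (sym h′≡))))) ⟩
             1ℤ * + (2 ℕ.* M) + + (4 ℕ.* M) * + T
               ≡⟨ cong₂ _+_ (*-identityˡ (+ (2 ℕ.* M))) (sym (pos-* (4 ℕ.* M) _)) ⟩
             + (2 ℕ.* M ℕ.+ 4 ℕ.* M ℕ.* T) ∎) ⟩
      ∑ Ms (λ j → + (2 ℕ.* M ℕ.+ 4 ℕ.* M ℕ.* T))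
        ≡⟨ trans (∑-const Ms _) (trans (cong (λ n → + n * + (2 ℕ.* M ℕ.+ 4 ℕ.* M ℕ.* T)) (length-tabulate {n = M} (λ i → i))) (sym (pos-* M _))) ⟩
      + (M ℕ.* (2 ℕ.* M ℕ.+ 4 ℕ.* M ℕ.* T)) ∎
      where
      open ≤-Reasoning
      Ms = allFin M
      hs = allFin (4 ℕ.* M)

-- Additive energy of the sums of two reciprocals.

module ReciprocalEnergy (p : ℕ) (p-prime : Prime p) where
  open Sums
  open Counting
  open Modular p p-prime
  open BilinearCovering p p-prime using (collisions)
  open Pigeonhole p p-prime using (small⇒unit; thue)
  open DivisorTables
  open import Data.Integer hiding (_/_; _%_)
  open import Data.Integer.Properties
  open import Data.Integer.Divisibility.Signed
  open import Data.Integer.Tactic.RingSolver using (solve-∀)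
  open import Data.List using (List; []; _∷_; length; allFin; cartesianProduct; map; _++_; upTo; concatMap)
  open import Data.List.Properties using (length-++; length-map; length-upTo; length-tabulate)
  open import Data.List.Membership.Propositional using (_∈_; lose)
  open import Data.List.Membership.Propositional.Properties using (∈-++⁺ˡ; ∈-++⁺ʳ; ∈-map⁺; ∈-cartesianProduct⁺; ∈-upTo⁺; ∈-concatMap⁺)
  open import Data.Fin as Fin using (Fin; toℕ)
  import Data.Fin.Properties as Fin
  import Data.Nat as ℕ
  import Data.Nat.Properties as ℕ
  import Data.Nat.Divisibility as ℕ
  open import Data.Nat.DivMod using (_/_; m*n/n≡m)
  open import Data.Product using (_×_; _,_; ∃-syntax)
  open import Data.Sum using ([_,_]′)
  open import Relation.Binary.PropositionalEquality

  ∣m-n∣≤m⊔n : ∀ m n → ∣ + m - + n ∣ ℕ.≤ m ℕ.⊔ n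
  ∣m-n∣≤m⊔n m n = subst (ℕ._≤ m ℕ.⊔ n) (cong ∣_∣ (sym (m-n≡m⊖n m n))) (∣m⊝n∣≤m⊔n m n)

  length-concatMap≤ : ∀ {A C : Set} (f : A → List C) {m} → (∀ a → length (f a) ℕ.≤ m) → ∀ as → length (concatMap f as) ℕ.≤ length as ℕ.* m
  length-concatMap≤ f f≤m []       = ℕ.z≤n
  length-concatMap≤ f f≤m (a ∷ as) = subst (ℕ._≤ _) (sym (length-++ (f a))) (ℕ.+-mono-≤ (f≤m a) (length-concatMap≤ f f≤m as))

  -- `X` bounds the denominator of the approximation v/u, and `V` stands for |v|. By `range` at most
  -- 2D + 1 multiples of p come into question, and `factors≤` keeps the products inside the table.
  -- By `sum-unit` the sum of two reciprocals is never 0, a value at which the hyperbola would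
  -- degenerate to a line.
  module _ {B τ : ℕ} (table : DivisorTable B τ) (b : ℤ) (N X D : ℕ) .{{_ : ℕ.NonZero X}} (X<p : X ℕ.< p)
    (range : ∀ V → V ℕ.* X ℕ.< p → X ℕ.* (N ℕ.* N) ℕ.+ V ℕ.* (2 ℕ.* N) ℕ.< ℕ.suc D ℕ.* p)
    (factors≤ : ∀ V → V ℕ.* X ℕ.< p → (X ℕ.* N ℕ.+ V) ℕ.* (X ℕ.* N ℕ.+ V) ℕ.≤ B)
    (sum-unit : ∀ (i j : Fin N) → Unit (b + + toℕ i + (b + + toℕ j))) where

    open DivisorTable table

    y : Fin N → ℤ
    y i = b + + toℕ i

    reciprocalSum : Fin N × Fin N → ℤ
    reciprocalSum (i , j) = inv (y i) + inv (y j)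

    y-unit : ∀ i → Unit (y i)
    y-unit i p∣ = sum-unit i i (∣m∣n⇒∣m+n p∣ p∣)

    private
      clear : ∀ k l → reciprocalSum (k , l) * (y k * y l) ≋ y k + y l
      clear k l = ≋-trans (≋-reflexive (expand (y k) (y l) (inv (y k)) (inv (y l))))
        (≋-trans (+-cong (*-cong (inv-inverse (y-unit k)) (≋-refl {y l})) (*-cong (inv-inverse (y-unit l)) (≋-refl {y k})))
          (≋-reflexive (collect (y k) (y l))))
        where
        expand : ∀ y z y⁻¹ z⁻¹ → (y⁻¹ + z⁻¹) * (y * z) ≡ y * y⁻¹ * z + z * z⁻¹ * y
        expand = solve-∀
        collect : ∀ y z → 1ℤ * z + 1ℤ * y ≡ y + z
        collect = solve-∀

      module _ (i j : Fin N) where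

        s s′ : ℤ
        s = reciprocalSum (i , j)
        s′ = inv s

        s-unit : Unit s
        s-unit p∣s = sum-unit i j (∣-respˡ-≋ (≋-sym (clear i j)) (∣m⇒∣m*n (y i * y j) p∣s))

        s′-unit : Unit s′
        s′-unit p∣s′ = p∤1 (∣-respˡ-≋ (≋-sym (inv-inverse s-unit)) (∣n⇒∣m*n s p∣s′))

        -- Denominators are cleared in 1/y + 1/y′ ≡ 1/s′. Completing the product gives (y - s′)(y′ -
        -- s′) ≡ s′², which `FF≋` states after multiplication by u².
        hyperbola : ∀ k l → reciprocalSum (k , l) ≋ s → y k * y l ≋ s′ * (y k + y l)
        hyperbola k l w≋s = *-cancelˡ s-unit (≋-trans
          (≋-trans (*-cong (≋-sym w≋s) (≋-refl {y k * y l})) (clear k l))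
          (≋-trans (≋-reflexive (sym (*-identityˡ (y k + y l))))
            (≋-trans (*-cong (≋-sym (inv-inverse s-unit)) (≋-refl {y k + y l})) (≋-reflexive (*-assoc s s′ (y k + y l))))))

        module _ (u : ℕ) (v : ℤ) (1≤u : 1 ℕ.≤ u) (u≤X : u ℕ.≤ X) (vX<p : ∣ v ∣ ℕ.* X ℕ.< p) (uθ≋v : + u * (s′ - b) ≋ v) where

          F : Fin N → ℤ
          F k = + u * + toℕ k - v

          u-unit : Unit (+ u)
          u-unit = small⇒unit 1≤u (ℕ.≤-<-trans u≤X X<p)

          F≋ : ∀ k → F k ≋ + u * (y k - s′)
          F≋ k = ≋-trans (minus-cong (≋-refl {+ u * + toℕ k}) (≋-sym uθ≋v)) (≋-reflexive (expand (+ u) (+ toℕ k) s′ b))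
            where
            expand : ∀ u k s b → u * k - u * (s - b) ≡ u * (b + k - s)
            expand = solve-∀

          FF≋ : ∀ k l → reciprocalSum (k , l) ≋ s → F k * F l ≋ + u * s′ * (+ u * s′)
          FF≋ k l w≋s = ≋-trans (*-cong (F≋ k) (F≋ l)) (≋-trans (≋-reflexive (expand (+ u) (y k) (y l) s′))
            (≋-trans (+-cong (*-cong (≋-refl {+ u * + u}) (minus-cong (hyperbola k l w≋s) (≋-refl {s′ * (y k + y l)})))
              (≋-refl {+ u * s′ * (+ u * s′)}))
            (≋-reflexive (collect (+ u) (s′ * (y k + y l)) (+ u * s′ * (+ u * s′))))))
            where
            expand : ∀ u y z s → u * (y - s) * (u * (z - s)) ≡ u * u * (y * z - s * (y + z)) + u * s * (u * s)
            expand = solve-∀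
            collect : ∀ u t r → u * u * (t - t) + r ≡ r
            collect = solve-∀

          FF-unit : ∀ k l → reciprocalSum (k , l) ≋ s → Unit (F k * F l)
          FF-unit k l w≋s p∣ = unit-* us′-unit us′-unit (∣-respˡ-≋ (≋-sym (FF≋ k l w≋s)) p∣)
            where
            us′-unit = unit-* u-unit s′-unit

          product-with : ℤ → ℤ
          product-with q = F i * F j + + u * (q * P)

          -- The difference of two products F k F l divided by u. As u is a unit, p divides `Δ`
          -- already, and bounding `Δ` instead of u Δ saves a factor of size up to X in the number
          -- of possible products.
          Δ : Fin N → Fin N → ℤ
          Δ k l = + u * (+ (toℕ k ℕ.* toℕ l) - + (toℕ i ℕ.* toℕ j)) - v * (+ (toℕ k ℕ.+ toℕ l) - + (toℕ i ℕ.+ toℕ j))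

          FF-FF : ∀ k l → F k * F l - F i * F j ≡ + u * Δ k l
          FF-FF k l = trans (expand (+ u) v (+ toℕ k) (+ toℕ l) (+ toℕ i) (+ toℕ j))
            (cong₂ (λ kl ij → + u * (+ u * (kl - ij) - v * (+ (toℕ k ℕ.+ toℕ l) - + (toℕ i ℕ.+ toℕ j))))
              (sym (pos-* (toℕ k) (toℕ l))) (sym (pos-* (toℕ i) (toℕ j))))
            where
            expand : ∀ u v k l i j → (u * k - v) * (u * l - v) - (u * i - v) * (u * j - v) ≡ u * (u * (k * l - i * j) - v * (k + l - (i + j)))
            expand = solve-∀

          ∣Δ∣< : ∀ k l → ∣ Δ k l ∣ ℕ.< ℕ.suc D ℕ.* p
          ∣Δ∣< k l = ℕ.≤-<-trans (begin
            ∣ Δ k l ∣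
              ≤⟨ ∣i-j∣≤∣i∣+∣j∣ (+ u * kl-ij) (v * k+l-i-j) ⟩
            ∣ + u * kl-ij ∣ ℕ.+ ∣ v * k+l-i-j ∣
              ≡⟨ cong₂ ℕ._+_ (abs-* (+ u) kl-ij) (abs-* v k+l-i-j) ⟩
            u ℕ.* ∣ kl-ij ∣ ℕ.+ ∣ v ∣ ℕ.* ∣ k+l-i-j ∣
              ≤⟨ ℕ.+-mono-≤ (ℕ.*-mono-≤ u≤X (ℕ.≤-trans (∣m-n∣≤m⊔n (toℕ k ℕ.* toℕ l) (toℕ i ℕ.* toℕ j)) (ℕ.⊔-lub (ℕ.*-mono-≤ (k≤ k) (k≤ l)) (ℕ.*-mono-≤ (k≤ i) (k≤ j)))))
                             (ℕ.*-monoʳ-≤ ∣ v ∣ (ℕ.≤-trans (∣m-n∣≤m⊔n (toℕ k ℕ.+ toℕ l) (toℕ i ℕ.+ toℕ j)) (ℕ.⊔-lub (k+l≤ k l) (k+l≤ i j)))) ⟩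
            X ℕ.* (N ℕ.* N) ℕ.+ ∣ v ∣ ℕ.* (2 ℕ.* N) ∎) (range ∣ v ∣ vX<p)
            where
            open ℕ.≤-Reasoning
            kl-ij = + (toℕ k ℕ.* toℕ l) - + (toℕ i ℕ.* toℕ j)
            k+l-i-j = + (toℕ k ℕ.+ toℕ l) - + (toℕ i ℕ.+ toℕ j)
            k≤ : ∀ (k : Fin N) → toℕ k ℕ.≤ N
            k≤ k = ℕ.<⇒≤ (Fin.toℕ<n k)
            k+l≤ : ∀ (k l : Fin N) → toℕ k ℕ.+ toℕ l ℕ.≤ 2 ℕ.* N
            k+l≤ k l = subst (toℕ k ℕ.+ toℕ l ℕ.≤_) (cong (N ℕ.+_) (sym (ℕ.+-identityʳ N))) (ℕ.+-mono-≤ (k≤ k) (k≤ l))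

          ∣F∣≤ : ∀ k → ∣ F k ∣ ℕ.≤ X ℕ.* N ℕ.+ ∣ v ∣
          ∣F∣≤ k = ℕ.≤-trans (∣i-j∣≤∣i∣+∣j∣ (+ u * + toℕ k) v) (ℕ.+-monoˡ-≤ ∣ v ∣
            (subst (ℕ._≤ X ℕ.* N) (sym (abs-* (+ u) (+ toℕ k))) (ℕ.*-mono-≤ u≤X (ℕ.<⇒≤ (Fin.toℕ<n k)))))

          instance
            u≢0 : ℕ.NonZero u
            u≢0 = ℕ.>-nonZero 1≤u

          -- Since F k = u k - v, the divisor d = |F k| leaves for k only the values (v ± d)/u.
          candidates : ℤ → List ℕ
          candidates q = map (λ d → ∣ v + + d ∣ / u) ds ++ map (λ d → ∣ v - + d ∣ / u) ds
            where ds = divisors ∣ product-with q ∣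

          length-candidates : ∀ q → length (candidates q) ℕ.≤ 2 ℕ.* τ
          length-candidates q = subst (ℕ._≤ 2 ℕ.* τ)
            (sym (trans (length-++ (map (λ d → ∣ v + + d ∣ / u) ds)) (cong₂ ℕ._+_ (length-map _ ds) (length-map _ ds))))
            (ℕ.+-mono-≤ ds-short (ℕ.≤-trans ds-short (ℕ.m≤m+n τ 0)))
            where
            ds = divisors ∣ product-with q ∣
            ds-short = short ∣ product-with q ∣

          ∈-candidates : ∀ k q → ∣ F k ∣ ∈ divisors ∣ product-with q ∣ → toℕ k ∈ candidates q
          ∈-candidates k q F∈ = [ nonneg , nonpos ]′ (+∣i∣≡i⊎+∣i∣≡-i (F k))
            where
            ds = divisors ∣ product-with q ∣
            cancel₊ : ∀ v uk → v + (uk - v) ≡ uk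
            cancel₊ = solve-∀
            cancel₋ : ∀ v uk → v - - (uk - v) ≡ uk
            cancel₋ = solve-∀
            quotient≡ : ∀ z → z ≡ + u * + toℕ k → ∣ z ∣ / u ≡ toℕ k
            quotient≡ z z≡ = trans (cong (_/ u) (trans (cong ∣_∣ z≡) (abs-* (+ u) (+ toℕ k))))
              (trans (cong (_/ u) (ℕ.*-comm u (toℕ k))) (m*n/n≡m (toℕ k) u))
            nonneg : + ∣ F k ∣ ≡ F k → toℕ k ∈ candidates q
            nonneg eq = subst (_∈ candidates q) (quotient≡ (v + + ∣ F k ∣) (trans (cong (_+_ v) eq) (cancel₊ v (+ u * + toℕ k))))
              (∈-++⁺ˡ (∈-map⁺ (λ d → ∣ v + + d ∣ / u) F∈))
            nonpos : + ∣ F k ∣ ≡ - F k → toℕ k ∈ candidates q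
            nonpos eq = subst (_∈ candidates q) (quotient≡ (v - + ∣ F k ∣) (trans (cong (_-_ v) eq) (cancel₋ v (+ u * + toℕ k))))
              (∈-++⁺ʳ (map (λ d → ∣ v + + d ∣ / u) ds) (∈-map⁺ (λ d → ∣ v - + d ∣ / u) F∈))

          pairs : ℕ → List (ℕ × ℕ)
          pairs n = cartesianProduct (candidates (+ n - + D)) (candidates (+ n - + D))

          L : List (ℕ × ℕ)
          L = concatMap pairs (upTo (ℕ.suc (2 ℕ.* D)))

          length-L : length L ℕ.≤ ℕ.suc (2 ℕ.* D) ℕ.* (2 ℕ.* τ ℕ.* (2 ℕ.* τ))
          length-L = ℕ.≤-trans (length-concatMap≤ pairs (λ n → subst (ℕ._≤ _) (sym (length-cartesianProduct (candidates (+ n - + D)) (candidates (+ n - + D))))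
              (ℕ.*-mono-≤ (length-candidates (+ n - + D)) (length-candidates (+ n - + D)))) (upTo (ℕ.suc (2 ℕ.* D))))
            (ℕ.≤-reflexive (cong (ℕ._* (2 ℕ.* τ ℕ.* (2 ℕ.* τ))) (length-upTo (ℕ.suc (2 ℕ.* D)))))

          covered′ : ∀ k l → reciprocalSum (k , l) ≋ s → P ∣ Δ k l → (toℕ k , toℕ l) ∈ L
          covered′ k l w≋s (divides q Δ≡qP) = ∈-concatMap⁺ pairs (lose (∈-upTo⁺ n<) (subst (λ r → (toℕ k , toℕ l) ∈ cartesianProduct (candidates r) (candidates r)) q≡
                  (∈-cartesianProduct⁺ (∈-candidates k q (listed k (divides-product (F k) (F l))))
                                       (∈-candidates l q (listed l (subst (∣ F l ∣ ℕ.∣_) (cong ∣_∣ (*-comm (F l) (F k))) (divides-product (F l) (F k))))))))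
            where
            ∣q∣≤D : ∣ q ∣ ℕ.≤ D
            ∣q∣≤D = ℕ.≤-pred (ℕ.*-cancelʳ-< p ∣ q ∣ (ℕ.suc D) (subst (ℕ._< ℕ.suc D ℕ.* p) (trans (cong ∣_∣ Δ≡qP) (abs-* q P)) (∣Δ∣< k l)))
            n : ℕ
            n = ∣ q + + D ∣
            n< : n ℕ.< ℕ.suc (2 ℕ.* D)
            n< = ℕ.s≤s (ℕ.≤-trans (∣i+j∣≤∣i∣+∣j∣ q (+ D)) (subst (∣ q ∣ ℕ.+ D ℕ.≤_) (cong (D ℕ.+_) (sym (ℕ.+-identityʳ D))) (ℕ.+-monoˡ-≤ D ∣q∣≤D)))
            cancel : ∀ q D → q ≡ q + D - D
            cancel = solve-∀
            q≡ : q ≡ + n - + D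
            q≡ = trans (cancel q (+ D)) (cong (_- + D) (sym (0≤i⇒+∣i∣≡i (∣i∣≤n⇒0≤i+n q ∣q∣≤D))))
            recover : ∀ x y → x ≡ y + (x - y)
            recover = solve-∀
            FF≡ : F k * F l ≡ product-with q
            FF≡ = trans (recover (F k * F l) (F i * F j)) (cong (_+_ (F i * F j)) (trans (FF-FF k l) (cong (_*_ (+ u)) Δ≡qP)))
            divides-product : ∀ x y → ∣ x ∣ ℕ.∣ ∣ x * y ∣
            divides-product x y = subst (∣ x ∣ ℕ.∣_) (sym (abs-* x y)) (ℕ.m∣m*n ∣ y ∣)
            -- The table is complete for nonzero numbers only; this product is congruent to the unit
            -- (u s′)².
            ∣FF∣≢0 : ℕ.NonZero ∣ F k * F l ∣
            ∣FF∣≢0 = ℕ.≢-nonZero λ ∣FF∣≡0 → FF-unit k l w≋s (divides 0ℤ (∣i∣≡0⇒i≡0 ∣FF∣≡0))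
            ∣FF∣≤B : ∣ F k * F l ∣ ℕ.≤ B
            ∣FF∣≤B = subst (ℕ._≤ B) (sym (abs-* (F k) (F l))) (ℕ.≤-trans (ℕ.*-mono-≤ (∣F∣≤ k) (∣F∣≤ l)) (factors≤ ∣ v ∣ vX<p))
            listed : ∀ m → ∣ F m ∣ ℕ.∣ ∣ F k * F l ∣ → ∣ F m ∣ ∈ divisors ∣ product-with q ∣
            listed m ∣FF = subst (λ r → ∣ F m ∣ ∈ divisors ∣ r ∣) FF≡ (complete ∣ F k * F l ∣ {{∣FF∣≢0}} ∣FF∣≤B ∣FF)

          covered : ∀ k l → reciprocalSum (k , l) ≋ s → (toℕ k , toℕ l) ∈ L
          covered k l w≋s = covered′ k l w≋s (unit-cancel u-unit
            (∣-resp (FF-FF k l) (p∣- (≋-trans (FF≋ k l w≋s) (≋-sym (FF≋ i j ≋-refl))))))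

        coincidences≤ : ∑ (allFin N) (λ k → ∑ (allFin N) (λ l → δ (s - reciprocalSum (k , l)))) ≤
          + (ℕ.suc (2 ℕ.* D) ℕ.* (2 ℕ.* τ ℕ.* (2 ℕ.* τ)))
        coincidences≤ = from-approximation (thue (s′ - b) X)
          where
          from-approximation : (∃[ u ] ∃[ v ] (1 ℕ.≤ u × u ℕ.≤ X × ∣ v ∣ ℕ.* X ℕ.< p × + u * (s′ - b) ≋ v)) →
            ∑ (allFin N) (λ k → ∑ (allFin N) (λ l → δ (s - reciprocalSum (k , l)))) ≤
            + (ℕ.suc (2 ℕ.* D) ℕ.* (2 ℕ.* τ ℕ.* (2 ℕ.* τ)))
          from-approximation (u , v , 1≤u , u≤X , vX<p , uθ≋v) = ≤-trans
            (∑∑≤length (λ k l → P ∣? (s - reciprocalSum (k , l))) (L u v 1≤u u≤X vX<p uθ≋v)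
              (λ k l p∣ → covered u v 1≤u u≤X vX<p uθ≋v k l (≋-sym (mk p∣))))
            (+≤+ (length-L u v 1≤u u≤X vX<p uθ≋v))

    -- For fixed s ≢ 0 the pairs with 1/y₁ + 1/y₂ ≡ s lie on a hyperbola (j₁ - θ)(j₂ - θ) ≡ s⁻². Approximating θ
    -- by a fraction v/u, they fall on few integral hyperbolas (u j₁ - v)(u j₂ - v) = K, each of which is
    -- controlled by the divisors of K.
    reciprocalEnergy : collisions (cartesianProduct (allFin N) (allFin N)) reciprocalSum (cartesianProduct (allFin N) (allFin N)) reciprocalSum ≤
      + (N ℕ.* N ℕ.* (ℕ.suc (2 ℕ.* D) ℕ.* (2 ℕ.* τ ℕ.* (2 ℕ.* τ))))
    reciprocalEnergy = begin
      ∑ W (λ ω → ∑ W (λ ω′ → δ (reciprocalSum ω - reciprocalSum ω′)))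
        ≤⟨ ∑-mono W (λ (i , j) → ≤-trans (≤-reflexive (∑-cartesianProduct (allFin N) (allFin N) _)) (coincidences≤ i j)) ⟩
      ∑ W (λ _ → + K)
        ≡⟨ trans (∑-const W (+ K)) (trans (sym (pos-* (length W) K)) (cong (λ n → + (n ℕ.* K)) length-W)) ⟩
      + (N ℕ.* N ℕ.* K) ∎
      where
      open ≤-Reasoning
      W = cartesianProduct (allFin N) (allFin N)
      K = ℕ.suc (2 ℕ.* D) ℕ.* (2 ℕ.* τ ℕ.* (2 ℕ.* τ))
      length-W : length W ≡ N ℕ.* N
      length-W = trans (length-cartesianProduct (allFin N) (allFin N)) (cong₂ ℕ._*_ (length-tabulate {n = N} (λ i → i)) (length-tabulate {n = N} (λ i → i)))

-- Integer square roots and thresholds.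

module Thresholds where
  open import Data.Nat
  open import Data.Nat.Properties
  open import Data.Nat.DivMod using (m≡m%n+[m/n]*n; m%n<n)
  open import Data.Nat.Tactic.RingSolver using (solve-∀)
  open import Data.Product using (_×_; _,_; ∃-syntax)
  open import Data.Sum using (inj₁; inj₂)
  open import Relation.Nullary using (yes; no; contradiction)
  open import Relation.Binary.PropositionalEquality

  crossing : ∀ (f : ℕ → ℕ) n k → f 0 ≤ n → n < f k → ∃[ i ] (f i ≤ n × n < f (suc i))
  crossing f n zero    f0≤n n<f0 = contradiction n<f0 (≤⇒≯ f0≤n)
  crossing f n (suc k) f0≤n n<fk+1 with n <? f k
  ... | yes n<fk = crossing f n k f0≤n n<fk
  ... | no  n≮fk = k , ≮⇒≥ n≮fk , n<fk+1

  m<[1+m/n]*n : ∀ m n .{{_ : NonZero n}} → m < suc (m / n) * n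
  m<[1+m/n]*n m n = subst (_< suc (m / n) * n) (sym (m≡m%n+[m/n]*n m n)) (+-monoˡ-< (m / n * n) (m%n<n m n))

  -- `X` is the integer part of √(n/N), described without division.
  scaledSqrt : ∀ n N → 0 < N → N ≤ n → ∃[ X ] (1 ≤ X × X * X * N ≤ n × n < suc X * suc X * N)
  scaledSqrt n N 0<N N≤n with crossing (λ i → suc i * suc i * N) n n (≤-trans (≤-reflexive (+-identityʳ N)) N≤n)
      (<-≤-trans (n<1+n n) (≤-trans (m≤m*n (suc n) (suc n)) (m≤m*n (suc n * suc n) N {{>-nonZero 0<N}})))
  ... | i , ≤n , n< = suc i , s≤s z≤n , ≤n , n<

  [m+n]²≤2m²+2n² : ∀ m n → (m + n) * (m + n) ≤ 2 * (m * m) + 2 * (n * n)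
  [m+n]²≤2m²+2n² m n with ≤-total m n
  ... | inj₁ m≤n = subst (λ n → (m + n) * (m + n) ≤ 2 * (m * m) + 2 * (n * n)) (m+[n∸m]≡n m≤n)
    (≤-trans (m≤m+n _ ((n ∸ m) * (n ∸ m))) (≤-reflexive (expand m (n ∸ m))))
    where
    expand : ∀ m d → (m + (m + d)) * (m + (m + d)) + d * d ≡ 2 * (m * m) + 2 * ((m + d) * (m + d))
    expand = solve-∀
  ... | inj₂ n≤m = subst (λ m → (m + n) * (m + n) ≤ 2 * (m * m) + 2 * (n * n)) (m+[n∸m]≡n n≤m)
    (≤-trans (m≤m+n _ ((m ∸ n) * (m ∸ n))) (≤-reflexive (expand n (m ∸ n))))
    where
    expand : ∀ n d → (n + d + n) * (n + d + n) + d * d ≡ 2 * ((n + d) * (n + d)) + 2 * (n * n)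
    expand = solve-∀

-- Short numerators: the error against the main term.

module ShortNumerators (p : ℕ) (p-prime : Prime p) where
  open Sums
  open CauchySchwarz
  open Modular p p-prime
  open BilinearCovering p p-prime
  open DivisorTables
  open Thresholds
  open IntervalEnergy p p-prime
  open ReciprocalEnergy p p-prime
  open import Data.Nat
  open import Data.Nat.Properties
  open import Data.Nat.DivMod using (m/n*n≤m; /-mono-≤; m*n/n≡m)
  open import Data.Nat.Tactic.RingSolver using (solve-∀)
  open import Data.Integer using (ℤ; +_; +<+)
  import Data.Integer as ℤ
  import Data.Integer.Properties as ℤ
  open import Data.List using (allFin; cartesianProduct)
  open import Data.List.Properties using (length-tabulate)
  open import Data.Fin using (Fin; toℕ)
  open import Data.Product using (_×_; _,_; ∃-syntax)
  open import Relation.Binary.PropositionalEquality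

  module _ {τ : ℕ} (0<τ : 0 < τ) (table : DivisorTable (2 * p * (2 * p)) τ) (a b : ℤ) (M N : ℕ)
    (0<M : 0 < M) (0<N : 0 < N) (M²≤p : M * M ≤ p) (4M≤p : 4 * M ≤ p) (N≤p : N ≤ p)
    (a+i-unit : ∀ (i : Fin M) → Unit (a ℤ.+ + toℕ i))
    (sum-unit : ∀ (i j : Fin N) → Unit (b ℤ.+ + toℕ i ℤ.+ (b ℤ.+ + toℕ j)))
    (large₁ : 574464 * (τ * τ * (τ * τ) * (τ * τ)) * p ≤ M * M * N)
    (large₂ : 574464 * (τ * τ * (τ * τ) * (τ * τ)) * (p * p) < M * N * N * (M * N * N)) where

    private
      τ⁶ = τ * τ * (τ * τ) * (τ * τ)

    -- The choice X ≈ √(p/N) balances the two terms X N² and (p/X) N of `R`. Both are then about √(p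
    -- N³), and `D` is about √(N³/p).
    module _ (X : ℕ) (1≤X : 1 ≤ X) (X²N≤p : X * X * N ≤ p) (p<[1+X]²N : p < suc X * suc X * N) where

      private
        instance
          X≢0 : NonZero X
          X≢0 = >-nonZero 1≤X

        V₀ R D E₁ E₂ : ℕ
        V₀ = p / X
        R = X * (N * N) + V₀ * (2 * N)
        D = R / p
        E₁ = M * (2 * M + 4 * M * (4 * τ * (4 * τ)))
        E₂ = N * N * (suc (2 * D) * (2 * τ * (2 * τ)))

        XN≤p : X * N ≤ p
        XN≤p = ≤-trans (*-monoˡ-≤ N (m≤m*n X X)) X²N≤p

        X<p : X < p
        X<p = X<p′ X 1≤X (≤-trans (m≤m*n (X * X) N {{>-nonZero 0<N}}) X²N≤p)
          where
          open import Data.Nat.Primality using (prime⇒nonTrivial)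
          X<p′ : ∀ X → 1 ≤ X → X * X ≤ p → X < p
          X<p′ 1               _ _    = nonTrivial⇒n>1 p {{prime⇒nonTrivial p-prime}}
          X<p′ X@(suc (suc _)) _ X²≤p = <-≤-trans (m<m*n X X (s≤s (s≤s z≤n))) X²≤p

        V≤V₀ : ∀ V → V * X < p → V ≤ V₀
        V≤V₀ V VX<p = subst (_≤ V₀) (m*n/n≡m V X) (/-mono-≤ (<⇒≤ VX<p) (≤-refl {X}))

        range : ∀ V → V * X < p → X * (N * N) + V * (2 * N) < suc D * p
        range V VX<p = ≤-<-trans (+-monoʳ-≤ (X * (N * N)) (*-monoˡ-≤ (2 * N) (V≤V₀ V VX<p))) (m<[1+m/n]*n R p)

        factors≤ : ∀ V → V * X < p → (X * N + V) * (X * N + V) ≤ 2 * p * (2 * p)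
        factors≤ V VX<p = *-mono-≤ XN+V≤2p XN+V≤2p
          where
          XN+V≤2p : X * N + V ≤ 2 * p
          XN+V≤2p = +-mono-≤ XN≤p (≤-trans (m≤m*n V X) (≤-trans (<⇒≤ VX<p) (≤-reflexive (sym (+-identityʳ p)))))

        V₀²≤4pN : V₀ * V₀ ≤ 4 * (p * N)
        V₀²≤4pN = *-cancelʳ-≤ (V₀ * V₀) (4 * (p * N)) p (begin
          V₀ * V₀ * p                    ≤⟨ *-monoʳ-≤ (V₀ * V₀) (<⇒≤ p<[1+X]²N) ⟩
          V₀ * V₀ * (suc X * suc X * N)  ≤⟨ *-monoʳ-≤ (V₀ * V₀) (*-monoˡ-≤ N (*-mono-≤ 1+X≤2X 1+X≤2X)) ⟩
          V₀ * V₀ * (2 * X * (2 * X) * N) ≡⟨ rearrange V₀ X N ⟩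
          4 * (V₀ * X * (V₀ * X) * N)    ≤⟨ *-monoʳ-≤ 4 (*-monoˡ-≤ N (*-mono-≤ (m/n*n≤m p X) (m/n*n≤m p X))) ⟩
          4 * (p * p * N)                ≡⟨ regroup p N ⟩
          4 * (p * N) * p ∎)
          where
          open ≤-Reasoning
          1+X≤2X : suc X ≤ 2 * X
          1+X≤2X = subst (suc X ≤_) (cong (_+_ X) (sym (+-identityʳ X))) (+-monoˡ-≤ X 1≤X)
          rearrange : ∀ V X N → V * V * (2 * X * (2 * X) * N) ≡ 4 * (V * X * (V * X) * N)
          rearrange = solve-∀
          regroup : ∀ p N → 4 * (p * p * N) ≡ 4 * (p * N) * p
          regroup = solve-∀

        R²≤34pN³ : R * R ≤ 34 * (p * (N * N * N))
        R²≤34pN³ = begin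
          R * R
            ≤⟨ [m+n]²≤2m²+2n² (X * (N * N)) (V₀ * (2 * N)) ⟩
          2 * (X * (N * N) * (X * (N * N))) + 2 * (V₀ * (2 * N) * (V₀ * (2 * N)))
            ≡⟨ rearrange X N V₀ ⟩
          2 * (X * X * N * (N * N * N)) + 8 * (V₀ * V₀ * (N * N))
            ≤⟨ +-mono-≤ (*-monoʳ-≤ 2 (*-monoˡ-≤ (N * N * N) X²N≤p)) (*-monoʳ-≤ 8 (*-monoˡ-≤ (N * N) V₀²≤4pN)) ⟩
          2 * (p * (N * N * N)) + 8 * (4 * (p * N) * (N * N))
            ≡⟨ collect p N ⟩
          34 * (p * (N * N * N)) ∎
          where
          open ≤-Reasoning
          rearrange : ∀ X N V → 2 * (X * (N * N) * (X * (N * N))) + 2 * (V * (2 * N) * (V * (2 * N))) ≡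
            2 * (X * X * N * (N * N * N)) + 8 * (V * V * (N * N))
          rearrange = solve-∀
          collect : ∀ p N → 2 * (p * (N * N * N)) + 8 * (4 * (p * N) * (N * N)) ≡ 34 * (p * (N * N * N))
          collect = solve-∀

        p²[1+2D]²≤ : p * p * (suc (2 * D) * suc (2 * D)) ≤ 272 * (p * (N * N * N)) + 2 * (p * p)
        p²[1+2D]²≤ = begin
          p * p * (suc (2 * D) * suc (2 * D))
            ≤⟨ *-monoʳ-≤ (p * p) ([m+n]²≤2m²+2n² 1 (2 * D)) ⟩
          p * p * (2 * (1 * 1) + 2 * (2 * D * (2 * D)))
            ≡⟨ rearrange p D ⟩
          8 * (D * p * (D * p)) + 2 * (p * p)
            ≤⟨ +-monoˡ-≤ (2 * (p * p)) (*-monoʳ-≤ 8 (≤-trans (*-mono-≤ (m/n*n≤m R p) (m/n*n≤m R p)) R²≤34pN³)) ⟩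
          8 * (34 * (p * (N * N * N))) + 2 * (p * p)
            ≡⟨ cong (λ e → e + 2 * (p * p)) (sym (*-assoc 8 34 (p * (N * N * N)))) ⟩
          272 * (p * (N * N * N)) + 2 * (p * p) ∎
          where
          open ≤-Reasoning
          rearrange : ∀ p D → p * p * (2 * (1 * 1) + 2 * (2 * D * (2 * D))) ≡ 8 * (D * p * (D * p)) + 2 * (p * p)
          rearrange = solve-∀

        E₁≤ : E₁ ≤ 66 * (M * M * (τ * τ))
        E₁≤ = begin
          M * (2 * M + 4 * M * (4 * τ * (4 * τ)))      ≡⟨ expand M τ ⟩
          2 * (M * M * 1) + 64 * (M * M * (τ * τ))       ≤⟨ +-monoˡ-≤ _ (*-monoʳ-≤ 2 (*-monoʳ-≤ (M * M) (*-mono-≤ 0<τ 0<τ))) ⟩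
          2 * (M * M * (τ * τ)) + 64 * (M * M * (τ * τ)) ≡⟨ *-distribʳ-+ (M * M * (τ * τ)) 2 64 ⟨
          66 * (M * M * (τ * τ)) ∎
          where
          open ≤-Reasoning
          expand : ∀ M τ → M * (2 * M + 4 * M * (4 * τ * (4 * τ))) ≡ 2 * (M * M * 1) + 64 * (M * M * (τ * τ))
          expand = solve-∀

        double< : ∀ {A B Z} → 2 * A ≤ Z → 2 * B < Z → A + B < Z
        double< {A} {B} {Z} 2A≤Z 2B<Z = *-cancelˡ-< 2 (A + B) Z (subst₂ _<_ (sym (*-distribˡ-+ 2 A B)) (cong (_+_ Z) (sym (+-identityʳ Z))) (+-mono-≤-< 2A≤Z 2B<Z))

        -- The square of 1 + 2D brings a term with p N³ and a term with p². Each is kept within half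
        -- of the main term, the first by `large₁` and the second by `large₂`.
        error<main : p * p * (E₁ * (E₂ * E₂)) < M * M * (N * N * (N * N)) * (M * M * (N * N * (N * N)))
        error<main = begin-strict
          p * p * (E₁ * (E₂ * E₂))
            ≤⟨ *-monoʳ-≤ (p * p) (*-monoˡ-≤ (E₂ * E₂) E₁≤) ⟩
          p * p * (66 * (M * M * (τ * τ)) * (E₂ * E₂))
            ≡⟨ rearrange p M N τ (suc (2 * D)) ⟩
          -- 1056 = 66 · 4², with 66 from `E₁≤` and a 4 from (2τ)² in each of the two factors `E₂`.
          K * (1056 * τ⁶ * (p * p * (suc (2 * D) * suc (2 * D))))
            ≤⟨ *-monoʳ-≤ K (*-monoʳ-≤ (1056 * τ⁶) p²[1+2D]²≤) ⟩
          K * (1056 * τ⁶ * (272 * (p * (N * N * N)) + 2 * (p * p)))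
            ≡⟨ cong (K *_) (*-distribˡ-+ (1056 * τ⁶) (272 * (p * (N * N * N))) (2 * (p * p))) ⟩
          K * (1056 * τ⁶ * (272 * (p * (N * N * N))) + 1056 * τ⁶ * (2 * (p * p)))
            <⟨ *-monoʳ-< K {{>-nonZero (*-mono-< 0<M² 0<N⁴)}} (double< {1056 * τ⁶ * (272 * (p * (N * N * N)))} {1056 * τ⁶ * (2 * (p * p))} half₁ half₂) ⟩
          K * K ∎
          where
          open ≤-Reasoning
          K = M * M * (N * N * (N * N))
          0<M² : 0 < M * M
          0<M² = *-mono-< 0<M 0<M
          0<N⁴ : 0 < N * N * (N * N)
          0<N⁴ = *-mono-< (*-mono-< 0<N 0<N) (*-mono-< 0<N 0<N)
          rearrange : ∀ p M N τ d → p * p * (66 * (M * M * (τ * τ)) * (N * N * (d * (2 * τ * (2 * τ))) * (N * N * (d * (2 * τ * (2 * τ)))))) ≡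
            M * M * (N * N * (N * N)) * (1056 * (τ * τ * (τ * τ) * (τ * τ)) * (p * p * (d * d)))
          rearrange = solve-∀
          group₁ : ∀ t p N → 2 * (1056 * t * (272 * (p * (N * N * N)))) ≡ 574464 * t * p * (N * N * N)
          group₁ = solve-∀
          group₁′ : ∀ M N → M * M * N * (N * N * N) ≡ M * M * (N * N * (N * N))
          group₁′ = solve-∀
          -- 574464 = 2 · 1056 · 272, where 272 = 8 · 34 comes from the bounds for `D` and `R`.
          half₁ : 2 * (1056 * τ⁶ * (272 * (p * (N * N * N)))) ≤ K
          half₁ = subst₂ _≤_ (sym (group₁ τ⁶ p N)) (group₁′ M N) (*-monoˡ-≤ (N * N * N) large₁)
          group₂ : ∀ t q → 2 * (1056 * t * (2 * q)) ≡ 4224 * (t * q)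
          group₂ = solve-∀
          group₂′ : ∀ M N → M * N * N * (M * N * N) ≡ M * M * (N * N * (N * N))
          group₂′ = solve-∀
          half₂ : 2 * (1056 * τ⁶ * (2 * (p * p))) < K
          half₂ = ≤-<-trans (≤-trans (≤-reflexive (group₂ τ⁶ (p * p)))
            (≤-trans (*-monoˡ-≤ (τ⁶ * (p * p)) (≤ᵇ⇒≤ 4224 574464 _)) (≤-reflexive (sym (*-assoc 574464 τ⁶ (p * p))))))
            (subst (574464 * τ⁶ * (p * p) <_) (group₂′ M N) large₂)

        length-allFin : ∀ n → Data.List.length (allFin n) ≡ n
        length-allFin n = length-tabulate (λ i → i)

        x : Fin M → ℤ
        x i = a ℤ.+ + toℕ i

        w : Fin N × Fin N → ℤ
        w = reciprocalSum table b N X D X<p range factors≤ sum-unit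

        W = cartesianProduct (allFin N) (allFin N)

        size-W : size W ≡ + (N * N)
        size-W = cong +_ (trans (length-cartesianProduct (allFin N) (allFin N)) (cong₂ _*_ (length-allFin N) (length-allFin N)))

        size-r : (size (allFin M) ℤ.* size (allFin M) ℤ.* (size W ℤ.* size W)) ≡ + (M * M * (N * N * (N * N)))
        size-r = trans (cong₂ ℤ._*_ (cong₂ ℤ._*_ (cong +_ (length-allFin M)) (cong +_ (length-allFin M))) (cong₂ ℤ._*_ size-W size-W))
          (sym (trans (ℤ.pos-* (M * M) (N * N * (N * N))) (cong₂ ℤ._*_ (ℤ.pos-* M M) (ℤ.pos-* (N * N) (N * N)))))

        small : let r = size (allFin M) ℤ.* size (allFin M) ℤ.* (size W ℤ.* size W) in
          P ℤ.* P ℤ.* (multiplicativeEnergy (allFin M) x ℤ.* (collisions W w W w ℤ.* collisions W w W w)) ℤ.< r ℤ.* r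
        small = begin-strict
          P ℤ.* P ℤ.* (ME ℤ.* (E ℤ.* E))
            ≤⟨ ℤ.*-monoˡ-≤-nonNeg (P ℤ.* P) {{ℤ.nonNegative (0≤i*i P)}} (ℤ.≤-trans
                 (ℤ.*-monoʳ-≤-nonNeg (E ℤ.* E) {{ℤ.nonNegative (0≤i*i E)}} (multiplicativeEnergy-interval table p≤B a M M²≤p 4M≤p 0<M a+i-unit))
                 (ℤ.*-monoˡ-≤-nonNeg (+ E₁) (ℤ.≤-trans (ℤ.*-monoˡ-≤-nonNeg E {{ℤ.nonNegative 0≤E}} E≤) (ℤ.*-monoʳ-≤-nonNeg (+ E₂) E≤)))) ⟩
          P ℤ.* P ℤ.* (+ E₁ ℤ.* (+ E₂ ℤ.* + E₂))
            ≡⟨ trans (cong₂ ℤ._*_ (sym (ℤ.pos-* p p)) (trans (cong (ℤ._*_ (+ E₁)) (sym (ℤ.pos-* E₂ E₂))) (sym (ℤ.pos-* E₁ (E₂ * E₂))))) (sym (ℤ.pos-* (p * p) (E₁ * (E₂ * E₂)))) ⟩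
          + (p * p * (E₁ * (E₂ * E₂)))
            <⟨ +<+ error<main ⟩
          + (M * M * (N * N * (N * N)) * (M * M * (N * N * (N * N))))
            ≡⟨ trans (ℤ.pos-* (M * M * (N * N * (N * N))) _) (sym (cong₂ ℤ._*_ size-r size-r)) ⟩
          _ ∎
          where
          open ℤ.≤-Reasoning
          ME = multiplicativeEnergy (allFin M) x
          E = collisions W w W w
          E≤ : E ℤ.≤ + E₂
          E≤ = reciprocalEnergy table b N X D X<p range factors≤ sum-unit
          0≤E : + 0 ℤ.≤ E
          0≤E = ∑-nonneg W λ ω → ∑-nonneg W λ ω′ → ⟦⟧-nonneg (P Data.Integer.Divisibility.Signed.∣? (w ω ℤ.- w ω′))
            where import Data.Integer.Divisibility.Signed
          p≤B : p ≤ 2 * p * (2 * p)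
          p≤B = ≤-trans (m≤n*m p 2) (m≤m*n (2 * p) (2 * p) {{m*n≢0 2 p}})

      fourProducts′ : ∀ λ₀ → FourProducts x w λ₀
      fourProducts′ = four-products-cover (allFin M) x a+i-unit W w small

    fourProducts : ∀ λ₀ → FourProducts {Fin M} {Fin N × Fin N} (λ i → a ℤ.+ + toℕ i) (λ (i , j) → inv (b ℤ.+ + toℕ i) ℤ.+ inv (b ℤ.+ + toℕ j)) λ₀
    fourProducts = from-X (scaledSqrt p N 0<N N≤p)
      where
      from-X : ∃[ X ] (1 ≤ X × X * X * N ≤ p × p < suc X * suc X * N) →
        ∀ λ₀ → FourProducts {Fin M} {Fin N × Fin N} (λ i → a ℤ.+ + toℕ i) (λ (i , j) → inv (b ℤ.+ + toℕ i) ℤ.+ inv (b ℤ.+ + toℕ j)) λ₀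
      from-X (X , 1≤X , X²N≤p , p<) = fourProducts′ X 1≤X X²N≤p p<

-- Expansions to a rational base.

module DigitExpansion (p : ℕ) (p-prime : Prime p) where
  open Modular p p-prime
  open Bezout
  open Pigeonhole p p-prime using (small⇒unit)
  open import Data.Integer
  open import Data.Integer.Properties
  open import Data.Integer.DivMod using (n%ℕd<d; a≡a%ℕn+[a/ℕn]*n)
  open import Data.Integer.Tactic.RingSolver using (solve-∀)
  open import Data.Fin using (toℕ)
  import Data.Fin.Properties as Fin
  import Data.Nat as ℕ
  import Data.Nat.Properties as ℕ
  import Data.Nat.Tactic.RingSolver as ℕ
  open import Data.Nat.Coprimality using (Coprime)
  open import Data.Product using (_×_; _,_; ∃-syntax; ∃₂)
  open import Data.Sum using (inj₁; inj₂)
  open import Relation.Binary.PropositionalEquality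

  quartic : ℤ → ℤ → ℤ → ℤ → ℤ → ℤ → ℤ
  quartic c₀ c₁ c₂ c₃ c₄ z = c₀ + c₁ * z + c₂ * (z * z) + c₃ * (z * z * z) + c₄ * (z * z * (z * z))

  QuarticValue : ℕ → ℤ → ℤ → Set
  QuarticValue C z t = ∃[ c₀ ] ∃[ c₁ ] ∃[ c₂ ] ∃[ c₃ ] ∃[ c₄ ]
    (∣ c₀ ∣ ℕ.≤ C × ∣ c₁ ∣ ℕ.≤ C × ∣ c₂ ∣ ℕ.≤ C × ∣ c₃ ∣ ℕ.≤ C × ∣ c₄ ∣ ℕ.≤ C × quartic c₀ c₁ c₂ c₃ c₄ z ≋ t)

  -- Coprimality with its Bézout coefficients: these identities can be multiplied to pass to
  -- products, and the second coefficient is the inverse of w modulo u that `digit` needs.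
  Comaximal : ℤ → ℤ → Set
  Comaximal u w = ∃₂ λ x y → x * u + y * w ≡ 1ℤ

  comaximal-* : ∀ {u w w′} → Comaximal u w → Comaximal u w′ → Comaximal u (w * w′)
  comaximal-* {u} {w} {w′} (x , y , eq) (x′ , y′ , eq′) = x * x′ * u + x * y′ * w′ + y * w * x′ , y * y′ ,
    trans (expand u w w′ x y x′ y′) (cong₂ _*_ eq eq′)
    where
    expand : ∀ u w w′ x y x′ y′ → (x * x′ * u + x * y′ * w′ + y * w * x′) * u + y * y′ * (w * w′) ≡ (x * u + y * w) * (x′ * u + y′ * w′)
    expand = solve-∀

  coprime⇒comaximal : ∀ {u} v → Coprime u ∣ v ∣ → Comaximal (+ u) v
  coprime⇒comaximal {u} v coprime = signed (bézout coprime) (+∣i∣≡i⊎+∣i∣≡-i v)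
    where
    open import Data.Sum using (_⊎_)
    flip : ∀ y v → - y * v ≡ y * - v
    flip = solve-∀
    signed : Comaximal (+ u) (+ ∣ v ∣) → (+ ∣ v ∣ ≡ v) ⊎ (+ ∣ v ∣ ≡ - v) → Comaximal (+ u) v
    signed (x , y , eq) (inj₁ ∣v∣≡v)  = x , y , trans (cong (λ e → x * + u + y * e) (sym ∣v∣≡v)) eq
    signed (x , y , eq) (inj₂ ∣v∣≡-v) = x , - y , trans (cong (_+_ (x * + u)) (trans (flip y v) (cong (_*_ y) (sym ∣v∣≡-v)))) eq

  module _ (u : ℕ) .{{_ : ℕ.NonZero u}} where

    -- From x u + y w = 1 it follows that y inverts w modulo u. With c the remainder of s y modulo
    -- u, the number s - c w is divisible by u.
    digit : ∀ w → Comaximal (+ u) w → ∀ s → ∃₂ λ c s′ → s ≡ c * w + + u * s′ × ∣ c ∣ ℕ.≤ u × ∣ s′ ∣ ℕ.* u ℕ.≤ ∣ s ∣ ℕ.+ u ℕ.* ∣ w ∣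
    digit w (x , y , eq) s = c , s′ , s≡ , ℕ.<⇒≤ (n%ℕd<d (s * y) u) , bound
      where
      c s′ : ℤ
      c = + ((s * y) %ℕ u)
      s′ = (s * y) /ℕ u * w + s * x
      distribute : ∀ s x u y w → s * (x * u + y * w) ≡ s * y * w + s * x * u
      distribute = solve-∀
      regroup : ∀ c q u w t → (c + q * u) * w + t * u ≡ c * w + u * (q * w + t)
      regroup = solve-∀
      s≡ : s ≡ c * w + + u * s′
      s≡ = trans (sym (*-identityʳ s)) (trans (cong (_*_ s) (sym eq)) (trans (distribute s x (+ u) y w)
        (trans (cong (λ e → e * w + s * x * + u) (a≡a%ℕn+[a/ℕn]*n (s * y) u)) (regroup c ((s * y) /ℕ u) (+ u) w (s * x)))))
      isolate : ∀ s′ u cw → s′ * u ≡ cw + u * s′ - cw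
      isolate = solve-∀
      bound : ∣ s′ ∣ ℕ.* u ℕ.≤ ∣ s ∣ ℕ.+ u ℕ.* ∣ w ∣
      bound = begin
        ∣ s′ ∣ ℕ.* u                       ≡⟨ abs-* s′ (+ u) ⟨
        ∣ s′ * + u ∣                        ≡⟨ cong ∣_∣ (trans (isolate s′ (+ u) (c * w)) (cong (_- c * w) (sym s≡))) ⟩
        ∣ s - c * w ∣                       ≤⟨ ∣i-j∣≤∣i∣+∣j∣ s (c * w) ⟩
        ∣ s ∣ ℕ.+ ∣ c * w ∣                 ≡⟨ cong (∣ s ∣ ℕ.+_) (abs-* c w) ⟩
        ∣ s ∣ ℕ.+ ∣ c ∣ ℕ.* ∣ w ∣           ≤⟨ ℕ.+-monoʳ-≤ ∣ s ∣ (ℕ.*-monoˡ-≤ ∣ w ∣ (ℕ.<⇒≤ (n%ℕd<d (s * y) u))) ⟩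
        ∣ s ∣ ℕ.+ u ℕ.* ∣ w ∣ ∎
        where open ℕ.≤-Reasoning

  -- An expansion to the base z = v/u: after multiplication by u⁴ the digits of vⁱu⁴⁻ⁱ are reduced modulo u
  -- one after the other, and the remaining coefficient of u⁴ is of size p/u⁴ + O(u).
  expand-fraction : ∀ (u : ℕ) (v z : ℤ) C → .{{_ : ℕ.NonZero u}} → u ℕ.< p → ∣ v ∣ ℕ.≤ u → Coprime u ∣ v ∣ →
    + u * z ≋ v → p ℕ.≤ C ℕ.* (u ℕ.* u ℕ.* (u ℕ.* u)) → ∀ t → QuarticValue (C ℕ.+ 4 ℕ.* u) z t
  expand-fraction u v z C u<p ∣v∣≤u coprime uz≋v p≤Cu⁴ t =
    s₀ , c₁ , c₂ , c₃ , c₄ , ∣s₀∣≤ , ℕ.≤-trans ∣c₁∣≤u u≤C+4u , ℕ.≤-trans ∣c₂∣≤u u≤C+4u ,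
    ℕ.≤-trans ∣c₃∣≤u u≤C+4u , ℕ.≤-trans ∣c₄∣≤u u≤C+4u , *-cancelˡ u⁴-unit
      (≋-trans (≋-reflexive (homogenise (+ u) z s₀ c₁ c₂ c₃ c₄)) (≋-trans substitute
      (≋-trans (≋-reflexive (sym total)) (≋-sym (≋-residue (+ u * + u * (+ u * + u) * t))))))
    where
    -- The expansion starts from the residue of u⁴ t, so that the first number to be reduced is
    -- below p.
    s₄ : ℤ
    s₄ = + toℕ (residue (+ u * + u * (+ u * + u) * t))
    cm : Comaximal (+ u) v
    cm = coprime⇒comaximal v coprime
    D₄ = digit u (v * v * (v * v)) (comaximal-* {w = v * v} {w′ = v * v} (comaximal-* {w = v} {w′ = v} cm cm) (comaximal-* {w = v} {w′ = v} cm cm)) s₄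
    open import Data.Product using (proj₁; proj₂)
    c₄ s₃ c₃ s₂ c₂ s₁ c₁ s₀ : ℤ
    c₄ = proj₁ D₄
    s₃ = proj₁ (proj₂ D₄)
    D₃ = digit u (v * v * v) (comaximal-* {w = v * v} {w′ = v} (comaximal-* {w = v} {w′ = v} cm cm) cm) s₃
    c₃ = proj₁ D₃
    s₂ = proj₁ (proj₂ D₃)
    D₂ = digit u (v * v) (comaximal-* {w = v} {w′ = v} cm cm) s₂
    c₂ = proj₁ D₂
    s₁ = proj₁ (proj₂ D₂)
    D₁ = digit u v cm s₁
    c₁ = proj₁ D₁
    s₀ = proj₁ (proj₂ D₁)
    ∣c₄∣≤u = proj₁ (proj₂ (proj₂ (proj₂ D₄)))
    ∣c₃∣≤u = proj₁ (proj₂ (proj₂ (proj₂ D₃)))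
    ∣c₂∣≤u = proj₁ (proj₂ (proj₂ (proj₂ D₂)))
    ∣c₁∣≤u = proj₁ (proj₂ (proj₂ (proj₂ D₁)))
    u≤C+4u : u ℕ.≤ C ℕ.+ 4 ℕ.* u
    u≤C+4u = ℕ.≤-trans (ℕ.m≤n*m u 4) (ℕ.m≤n+m (4 ℕ.* u) C)
    u-unit : Unit (+ u)
    u-unit = small⇒unit (ℕ.>-nonZero⁻¹ u) u<p
    u⁴-unit : Unit (+ u * + u * (+ u * + u))
    u⁴-unit = unit-* (unit-* u-unit u-unit) (unit-* u-unit u-unit)
    homogenise : ∀ u z c₀ c₁ c₂ c₃ c₄ → u * u * (u * u) * (c₀ + c₁ * z + c₂ * (z * z) + c₃ * (z * z * z) + c₄ * (z * z * (z * z))) ≡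
      c₄ * (u * z * (u * z) * (u * z * (u * z))) + u * (c₃ * (u * z * (u * z) * (u * z)) + u * (c₂ * (u * z * (u * z)) + u * (c₁ * (u * z) + u * c₀)))
    homogenise = solve-∀
    substitute : c₄ * (+ u * z * (+ u * z) * (+ u * z * (+ u * z))) + + u * (c₃ * (+ u * z * (+ u * z) * (+ u * z)) + + u * (c₂ * (+ u * z * (+ u * z)) + + u * (c₁ * (+ u * z) + + u * s₀))) ≋
      c₄ * (v * v * (v * v)) + + u * (c₃ * (v * v * v) + + u * (c₂ * (v * v) + + u * (c₁ * v + + u * s₀)))
    substitute = +-cong (*-cong (≋-refl {c₄}) (*-cong v²≋ v²≋)) (*-cong (≋-refl {+ u}) (+-cong (*-cong (≋-refl {c₃}) (*-cong v²≋ uz≋v))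
      (*-cong (≋-refl {+ u}) (+-cong (*-cong (≋-refl {c₂}) v²≋) (*-cong (≋-refl {+ u}) (+-cong (*-cong (≋-refl {c₁}) uz≋v) (≋-refl {+ u * s₀})))))))
      where v²≋ = *-cong uz≋v uz≋v
    total : s₄ ≡ c₄ * (v * v * (v * v)) + + u * (c₃ * (v * v * v) + + u * (c₂ * (v * v) + + u * (c₁ * v + + u * s₀)))
    total = trans (proj₁ (proj₂ (proj₂ D₄))) (cong (λ s → c₄ * (v * v * (v * v)) + + u * s)
      (trans (proj₁ (proj₂ (proj₂ D₃))) (cong (λ s → c₃ * (v * v * v) + + u * s)
      (trans (proj₁ (proj₂ (proj₂ D₂))) (cong (λ s → c₂ * (v * v) + + u * s) (proj₁ (proj₂ (proj₂ D₁))))))))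
    u⁴ u⁵ : ℕ
    u⁴ = u ℕ.* u ℕ.* (u ℕ.* u)
    u⁵ = u ℕ.* u⁴
    ∣v²∣≤ : ∣ v * v ∣ ℕ.≤ u ℕ.* u
    ∣v²∣≤ = subst (ℕ._≤ u ℕ.* u) (sym (abs-* v v)) (ℕ.*-mono-≤ ∣v∣≤u ∣v∣≤u)
    ∣v³∣≤ : ∣ v * v * v ∣ ℕ.≤ u ℕ.* u ℕ.* u
    ∣v³∣≤ = subst (ℕ._≤ u ℕ.* u ℕ.* u) (sym (abs-* (v * v) v)) (ℕ.*-mono-≤ ∣v²∣≤ ∣v∣≤u)
    ∣v⁴∣≤ : ∣ v * v * (v * v) ∣ ℕ.≤ u⁴
    ∣v⁴∣≤ = subst (ℕ._≤ u⁴) (sym (abs-* (v * v) (v * v))) (ℕ.*-mono-≤ ∣v²∣≤ ∣v²∣≤)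
    step : ∀ {s s′ w w′} → s ℕ.* u ℕ.≤ s′ ℕ.+ u ℕ.* w → w ℕ.≤ w′ → s ℕ.* u ℕ.≤ s′ ℕ.+ u ℕ.* w′
    step {s′ = s′} s≤ w≤ = ℕ.≤-trans s≤ (ℕ.+-monoʳ-≤ s′ (ℕ.*-monoʳ-≤ u w≤))
    -- Because |v| ≤ u, each of the four reductions contributes at most u⁵ once everything is scaled
    -- by u⁴. This gives |s₀| u⁴ ≤ p + 4u⁵.
    ∣s₀∣≤ : ∣ s₀ ∣ ℕ.≤ C ℕ.+ 4 ℕ.* u
    ∣s₀∣≤ = ℕ.*-cancelʳ-≤ ∣ s₀ ∣ (C ℕ.+ 4 ℕ.* u) u⁴ {{ℕ.m*n≢0 (u ℕ.* u) (u ℕ.* u) {{ℕ.m*n≢0 u u}} {{ℕ.m*n≢0 u u}}}} (begin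
      ∣ s₀ ∣ ℕ.* u⁴
        ≡⟨ r₀ ∣ s₀ ∣ u ⟩
      ∣ s₀ ∣ ℕ.* u ℕ.* (u ℕ.* u ℕ.* u)
        ≤⟨ ℕ.*-monoˡ-≤ (u ℕ.* u ℕ.* u) (step {s = ∣ s₀ ∣} {s′ = ∣ s₁ ∣} (proj₂ (proj₂ (proj₂ (proj₂ D₁)))) ∣v∣≤u) ⟩
      (∣ s₁ ∣ ℕ.+ u ℕ.* u) ℕ.* (u ℕ.* u ℕ.* u)
        ≡⟨ r₁ ∣ s₁ ∣ u ⟩
      ∣ s₁ ∣ ℕ.* u ℕ.* (u ℕ.* u) ℕ.+ u⁵
        ≤⟨ ℕ.+-monoˡ-≤ u⁵ (ℕ.*-monoˡ-≤ (u ℕ.* u) (step {s = ∣ s₁ ∣} {s′ = ∣ s₂ ∣} (proj₂ (proj₂ (proj₂ (proj₂ D₂)))) ∣v²∣≤)) ⟩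
      (∣ s₂ ∣ ℕ.+ u ℕ.* (u ℕ.* u)) ℕ.* (u ℕ.* u) ℕ.+ u⁵
        ≡⟨ r₂ ∣ s₂ ∣ u ⟩
      ∣ s₂ ∣ ℕ.* u ℕ.* u ℕ.+ 2 ℕ.* u⁵
        ≤⟨ ℕ.+-monoˡ-≤ (2 ℕ.* u⁵) (ℕ.*-monoˡ-≤ u (step {s = ∣ s₂ ∣} {s′ = ∣ s₃ ∣} (proj₂ (proj₂ (proj₂ (proj₂ D₃)))) ∣v³∣≤)) ⟩
      (∣ s₃ ∣ ℕ.+ u ℕ.* (u ℕ.* u ℕ.* u)) ℕ.* u ℕ.+ 2 ℕ.* u⁵
        ≡⟨ r₃ ∣ s₃ ∣ u ⟩
      ∣ s₃ ∣ ℕ.* u ℕ.+ 3 ℕ.* u⁵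
        ≤⟨ ℕ.+-monoˡ-≤ (3 ℕ.* u⁵) (step {s = ∣ s₃ ∣} {s′ = ∣ s₄ ∣} (proj₂ (proj₂ (proj₂ (proj₂ D₄)))) ∣v⁴∣≤) ⟩
      toℕ (residue (+ u * + u * (+ u * + u) * t)) ℕ.+ u⁵ ℕ.+ 3 ℕ.* u⁵
        ≤⟨ ℕ.+-monoˡ-≤ (3 ℕ.* u⁵) (ℕ.+-monoˡ-≤ u⁵
             (ℕ.≤-trans (ℕ.<⇒≤ (Fin.toℕ<n (residue (+ u * + u * (+ u * + u) * t)))) p≤Cu⁴)) ⟩
      C ℕ.* u⁴ ℕ.+ u⁵ ℕ.+ 3 ℕ.* u⁵
        ≡⟨ r₄ C u ⟩
      (C ℕ.+ 4 ℕ.* u) ℕ.* u⁴ ∎)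
      where
      open ℕ.≤-Reasoning
      r₀ : ∀ s u → s ℕ.* (u ℕ.* u ℕ.* (u ℕ.* u)) ≡ s ℕ.* u ℕ.* (u ℕ.* u ℕ.* u)
      r₀ = ℕ.solve-∀
      r₁ : ∀ s u → (s ℕ.+ u ℕ.* u) ℕ.* (u ℕ.* u ℕ.* u) ≡ s ℕ.* u ℕ.* (u ℕ.* u) ℕ.+ u ℕ.* (u ℕ.* u ℕ.* (u ℕ.* u))
      r₁ = ℕ.solve-∀
      r₂ : ∀ s u → (s ℕ.+ u ℕ.* (u ℕ.* u)) ℕ.* (u ℕ.* u) ℕ.+ u ℕ.* (u ℕ.* u ℕ.* (u ℕ.* u)) ≡ s ℕ.* u ℕ.* u ℕ.+ 2 ℕ.* (u ℕ.* (u ℕ.* u ℕ.* (u ℕ.* u)))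
      r₂ = ℕ.solve-∀
      r₃ : ∀ s u → (s ℕ.+ u ℕ.* (u ℕ.* u ℕ.* u)) ℕ.* u ℕ.+ 2 ℕ.* (u ℕ.* (u ℕ.* u ℕ.* (u ℕ.* u))) ≡ s ℕ.* u ℕ.+ 3 ℕ.* (u ℕ.* (u ℕ.* u ℕ.* (u ℕ.* u)))
      r₃ = ℕ.solve-∀
      r₄ : ∀ C u → C ℕ.* (u ℕ.* u ℕ.* (u ℕ.* u)) ℕ.+ u ℕ.* (u ℕ.* u ℕ.* (u ℕ.* u)) ℕ.+ 3 ℕ.* (u ℕ.* (u ℕ.* u ℕ.* (u ℕ.* u))) ≡ (C ℕ.+ 4 ℕ.* u) ℕ.* (u ℕ.* u ℕ.* (u ℕ.* u))
      r₄ = ℕ.solve-∀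

-- Fractions in lowest terms and their quartic values.

module LongNumerators (p : ℕ) (p-prime : Prime p) where
  open Modular p p-prime
  open Pigeonhole p p-prime using (small⇒unit; thue)
  open DigitExpansion p p-prime
  open import Data.Integer
  open import Data.Integer.Properties
  open import Data.Integer.Divisibility.Signed
  open import Data.Integer.Tactic.RingSolver using (solve-∀)
  import Data.Nat as ℕ
  import Data.Nat.Properties as ℕ
  import Data.Nat.Divisibility as ℕ
  import Data.Nat.Tactic.RingSolver as ℕ
  open import Data.Nat.Coprimality as Coprimality using (Coprime)
  open import Data.Nat.GCD using (gcd; gcd[m,n]∣m; gcd[m,n]∣n; gcd-greatest; gcd[m,n]≢0)
  open import Data.Product using (_×_; _,_; ∃-syntax)
  open import Data.Sum using (_⊎_; inj₁; inj₂)
  open import Relation.Nullary using (¬_; contradiction)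
  open import Relation.Binary.PropositionalEquality

  record Fraction (y : ℤ) (X : ℕ) : Set where
    field
      u         : ℕ
      v         : ℤ
      0<u       : 0 ℕ.< u
      u≤X       : u ℕ.≤ X
      ∣v∣≤X+2   : ∣ v ∣ ℕ.≤ X ℕ.+ 2
      coprime   : Coprime u ∣ v ∣
      uy≋v      : + u * y ≋ v

    height : ℕ
    height = u ℕ.⊔ ∣ v ∣

  -- The greatest common divisor is at most u < p, hence a unit, and the congruence can be divided
  -- by it. Coprimality is required for the digits.
  lowestTerms : ∀ y X u v → 0 ℕ.< u → u ℕ.≤ X → u ℕ.< p → ∣ v ∣ ℕ.≤ X ℕ.+ 2 → + u * y ≋ v → Fraction y X
  lowestTerms y X u v 0<u u≤X u<p ∣v∣≤ uy≋v = reduce (gcd[m,n]∣m u ∣ v ∣) (∣ᵤ⇒∣ {+ g} {v} (gcd[m,n]∣n u ∣ v ∣))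
    where
    g = gcd u ∣ v ∣
    instance
      g≢0 : ℕ.NonZero g
      g≢0 = ℕ.≢-nonZero (gcd[m,n]≢0 u ∣ v ∣ (inj₁ (λ { refl → contradiction 0<u (λ ()) })))
    reduce : g ℕ.∣ u → + g ∣ v → Fraction y X
    reduce (ℕ.divides u′ u≡) (divides v′ v≡) = record
      { u = u′ ; v = v′
      ; 0<u = 0<u′
      ; u≤X = ℕ.≤-trans u′≤u u≤X
      ; ∣v∣≤X+2 = ℕ.≤-trans (subst (∣ v′ ∣ ℕ.≤_) (sym ∣v∣≡) (ℕ.m≤m*n ∣ v′ ∣ g)) ∣v∣≤
      ; coprime = coprime
      ; uy≋v = *-cancelˡ g-unit (≋-trans (≋-reflexive (trans (regroup (+ g) (+ u′) y) (cong (_* y) (trans (sym (pos-* u′ g)) (cong +_ (sym u≡))))))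
                 (≋-trans uy≋v (≋-reflexive (trans v≡ (*-comm v′ (+ g))))))
      }
      where
      regroup : ∀ g u y → g * (u * y) ≡ u * g * y
      regroup = solve-∀
      0<u′ : 0 ℕ.< u′
      0<u′ = ℕ.n≢0⇒n>0 (λ { refl → contradiction 0<u (subst (λ n → ¬ (0 ℕ.< n)) (sym u≡) λ ()) })
      u′≤u : u′ ℕ.≤ u
      u′≤u = subst (u′ ℕ.≤_) (sym u≡) (ℕ.m≤m*n u′ g)
      ∣v∣≡ : ∣ v ∣ ≡ ∣ v′ ∣ ℕ.* g
      ∣v∣≡ = trans (cong ∣_∣ v≡) (abs-* v′ (+ g))
      g-unit : Unit (+ g)
      g-unit = small⇒unit (ℕ.>-nonZero⁻¹ g) (ℕ.≤-<-trans (subst (g ℕ.≤_) (sym u≡) (ℕ.m≤n*m g u′ {{ℕ.>-nonZero 0<u′}})) u<p)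
      coprime : Coprime u′ ∣ v′ ∣
      coprime {d} (d∣u′ , d∣v′) = ℕ.∣1⇒≡1 (ℕ.*-cancelʳ-∣ g (subst (d ℕ.* g ℕ.∣_) (sym (ℕ.*-identityˡ g))
        (gcd-greatest (subst (d ℕ.* g ℕ.∣_) (sym u≡) (ℕ.*-monoˡ-∣ g d∣u′)) (subst (d ℕ.* g ℕ.∣_) (sym ∣v∣≡) (ℕ.*-monoˡ-∣ g d∣v′)))))

  module _ (X : ℕ) (1≤X : 1 ℕ.≤ X) (X²≤p : X ℕ.* X ℕ.≤ p) (p<[1+X]² : p ℕ.< ℕ.suc X ℕ.* ℕ.suc X) (X+2<p : X ℕ.+ 2 ℕ.< p) where

    fraction : ∀ y → Fraction y X
    fraction y = from (thue y X {{ℕ.>-nonZero 1≤X}})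
      where
      from : ∃[ u ] ∃[ v ] (1 ℕ.≤ u × u ℕ.≤ X × ∣ v ∣ ℕ.* X ℕ.< p × + u * y ≋ v) → Fraction y X
      from (u , v , 1≤u , u≤X , vX<p , uy≋v) = lowestTerms y X u v 1≤u u≤X (ℕ.≤-<-trans u≤X (ℕ.≤-<-trans (ℕ.m≤m+n X 2) X+2<p))
        -- |v| X < p < (X + 1)² = (X + 2) X + 1 gives |v| ≤ X + 2.
        (ℕ.*-cancelʳ-≤ ∣ v ∣ (X ℕ.+ 2) X {{ℕ.>-nonZero 1≤X}} (ℕ.≤-pred (ℕ.<-≤-trans (ℕ.<-trans vX<p p<[1+X]²) (ℕ.≤-reflexive (expand X))))) uy≋v
        where
        expand : ∀ X → ℕ.suc X ℕ.* ℕ.suc X ≡ ℕ.suc ((X ℕ.+ 2) ℕ.* X)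
        expand = ℕ.solve-∀

    open Fraction

    module _ {y : ℤ} (f : Fraction y X) (Q C : ℕ) (y-unit : Unit y) (Q<height : Q ℕ.< height f)
      (p≤CQ⁴ : p ℕ.≤ C ℕ.* (Q ℕ.* Q ℕ.* (Q ℕ.* Q))) (t : ℤ) where

      private
        C′ = C ℕ.+ 4 ℕ.* (X ℕ.+ 2)

        p≤Cn⁴ : ∀ {n} → Q ℕ.< n → p ℕ.≤ C ℕ.* (n ℕ.* n ℕ.* (n ℕ.* n))
        p≤Cn⁴ {n} Q<n = ℕ.≤-trans p≤CQ⁴ (ℕ.*-monoʳ-≤ C (ℕ.*-mono-≤ (ℕ.*-mono-≤ (ℕ.<⇒≤ Q<n) (ℕ.<⇒≤ Q<n)) (ℕ.*-mono-≤ (ℕ.<⇒≤ Q<n) (ℕ.<⇒≤ Q<n))))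

        weaken : ∀ {n z s} → n ℕ.≤ X ℕ.+ 2 → QuarticValue (C ℕ.+ 4 ℕ.* n) z s → QuarticValue C′ z s
        weaken {n} n≤ (c₀ , c₁ , c₂ , c₃ , c₄ , b₀ , b₁ , b₂ , b₃ , b₄ , eq) =
          c₀ , c₁ , c₂ , c₃ , c₄ , ℕ.≤-trans b₀ ≤C′ , ℕ.≤-trans b₁ ≤C′ , ℕ.≤-trans b₂ ≤C′ , ℕ.≤-trans b₃ ≤C′ , ℕ.≤-trans b₄ ≤C′ , eq
          where
          ≤C′ : C ℕ.+ 4 ℕ.* n ℕ.≤ C′
          ≤C′ = ℕ.+-monoʳ-≤ C (ℕ.*-monoʳ-≤ 4 n≤)

        y⁻¹ : ℤ
        y⁻¹ = inv y

        -- For |v| ≥ u the expansion must use the base y⁻¹ = u/v, since digits are reduced modulo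
        -- the larger of the two numbers. Multiplication by y⁴ turns a quartic in y⁻¹ into one in y
        -- with reversed coefficients, whence the target t y⁻⁴.
        reverse : QuarticValue C′ y⁻¹ (t * (y⁻¹ * y⁻¹ * (y⁻¹ * y⁻¹))) → QuarticValue C′ y t
        reverse (c₀ , c₁ , c₂ , c₃ , c₄ , b₀ , b₁ , b₂ , b₃ , b₄ , eq) =
          c₄ , c₃ , c₂ , c₁ , c₀ , b₄ , b₃ , b₂ , b₁ , b₀ ,
          ≋-trans (≋-reflexive (pad y c₀ c₁ c₂ c₃ c₄)) (≋-trans (≋-sym (substitute 1ℤ (yy⁻¹≋1)))
            (≋-trans (≋-reflexive (factor y y⁻¹ c₀ c₁ c₂ c₃ c₄)) (≋-trans (*-cong (≋-refl {y * y * (y * y)}) eq)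
            (≋-trans (≋-reflexive (regroup y y⁻¹ t)) (≋-trans (*-cong (≋-refl {t}) (*-cong (*-cong yy⁻¹≋1 yy⁻¹≋1) (*-cong yy⁻¹≋1 yy⁻¹≋1)))
            (≋-reflexive (*-identityʳ t)))))))
          where
          yy⁻¹≋1 : y * y⁻¹ ≋ 1ℤ
          yy⁻¹≋1 = inv-inverse y-unit
          homogeneous : ℤ → ℤ
          homogeneous e = c₀ * (y * y * (y * y)) + c₁ * (y * y * y) * e + c₂ * (y * y) * (e * e) + c₃ * y * (e * e * e) + c₄ * (e * e * (e * e))
          substitute : ∀ e → y * y⁻¹ ≋ e → homogeneous (y * y⁻¹) ≋ homogeneous e
          substitute e e≋ = +-cong (+-cong (+-cong (+-cong (≋-refl {c₀ * (y * y * (y * y))}) (*-cong (≋-refl {c₁ * (y * y * y)}) e≋))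
            (*-cong (≋-refl {c₂ * (y * y)}) e²≋)) (*-cong (≋-refl {c₃ * y}) (*-cong e²≋ e≋))) (*-cong (≋-refl {c₄}) (*-cong e²≋ e²≋))
            where e²≋ = *-cong e≋ e≋
          pad : ∀ y c₀ c₁ c₂ c₃ c₄ → c₄ + c₃ * y + c₂ * (y * y) + c₁ * (y * y * y) + c₀ * (y * y * (y * y)) ≡
            c₀ * (y * y * (y * y)) + c₁ * (y * y * y) * 1ℤ + c₂ * (y * y) * (1ℤ * 1ℤ) + c₃ * y * (1ℤ * 1ℤ * 1ℤ) + c₄ * (1ℤ * 1ℤ * (1ℤ * 1ℤ))
          pad = solve-∀
          factor : ∀ y z c₀ c₁ c₂ c₃ c₄ → c₀ * (y * y * (y * y)) + c₁ * (y * y * y) * (y * z) + c₂ * (y * y) * (y * z * (y * z)) + c₃ * y * (y * z * (y * z) * (y * z)) + c₄ * (y * z * (y * z) * (y * z * (y * z))) ≡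
            y * y * (y * y) * (c₀ + c₁ * z + c₂ * (z * z) + c₃ * (z * z * z) + c₄ * (z * z * (z * z)))
          factor = solve-∀
          regroup : ∀ y z t → y * y * (y * y) * (t * (z * z * (z * z))) ≡ t * (y * z * (y * z) * (y * z * (y * z)))
          regroup = solve-∀

        reciprocal : (+ ∣ v f ∣ ≡ v f) ⊎ (+ ∣ v f ∣ ≡ - v f) → ∃[ v′ ] (∣ v′ ∣ ≡ u f × + ∣ v f ∣ * y⁻¹ ≋ v′)
        reciprocal (inj₁ ∣v∣≡v) = + u f , refl , ≋-trans (*-cong (≋-trans (≋-reflexive ∣v∣≡v) (≋-sym (uy≋v f))) (≋-refl {y⁻¹}))
          (≋-trans (≋-reflexive (*-assoc (+ u f) y y⁻¹)) (≋-trans (*-cong (≋-refl {+ u f}) (inv-inverse y-unit)) (≋-reflexive (*-identityʳ (+ u f)))))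
        reciprocal (inj₂ ∣v∣≡-v) = - + u f , ∣-i∣≡∣i∣ (+ u f) , ≋-trans (*-cong (≋-trans (≋-reflexive ∣v∣≡-v) (neg-cong (≋-sym (uy≋v f)))) (≋-refl {y⁻¹}))
          (≋-trans (≋-reflexive (regroup (+ u f) y y⁻¹)) (≋-trans (neg-cong (*-cong (≋-refl {+ u f}) (inv-inverse y-unit))) (≋-reflexive (cong -_ (*-identityʳ (+ u f))))))
          where
          regroup : ∀ u y z → - (u * y) * z ≡ - (u * (y * z))
          regroup = solve-∀

        from-reciprocal : u f ℕ.≤ ∣ v f ∣ → ∃[ v′ ] (∣ v′ ∣ ≡ u f × + ∣ v f ∣ * y⁻¹ ≋ v′) → QuarticValue C′ y t
        from-reciprocal u≤∣v∣ (v′ , ∣v′∣≡u , eq) = reverse (weaken (∣v∣≤X+2 f) (expand-fraction ∣ v f ∣ v′ y⁻¹ C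
          {{ℕ.>-nonZero (ℕ.<-≤-trans (0<u f) u≤∣v∣)}} (ℕ.≤-<-trans (∣v∣≤X+2 f) X+2<p) (subst (ℕ._≤ ∣ v f ∣) (sym ∣v′∣≡u) u≤∣v∣)
          (subst (Coprime ∣ v f ∣) (sym ∣v′∣≡u) (Coprimality.sym (coprime f))) eq
          (p≤Cn⁴ (subst (Q ℕ.<_) (ℕ.m≤n⇒m⊔n≡n u≤∣v∣) Q<height)) (t * (y⁻¹ * y⁻¹ * (y⁻¹ * y⁻¹)))))

        by-cases : (∣ v f ∣ ℕ.≤ u f) ⊎ (u f ℕ.≤ ∣ v f ∣) → QuarticValue C′ y t
        by-cases (inj₁ ∣v∣≤u) = weaken (ℕ.≤-trans (u≤X f) (ℕ.m≤m+n X 2)) (expand-fraction (u f) (v f) y C {{ℕ.>-nonZero (0<u f)}}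
          (ℕ.≤-<-trans (u≤X f) (ℕ.≤-<-trans (ℕ.m≤m+n X 2) X+2<p)) ∣v∣≤u (coprime f) (uy≋v f)
          (p≤Cn⁴ (subst (Q ℕ.<_) (ℕ.m≥n⇒m⊔n≡m ∣v∣≤u) Q<height)) t)
        by-cases (inj₂ u≤∣v∣) = from-reciprocal u≤∣v∣ (reciprocal (+∣i∣≡i⊎+∣i∣≡-i (v f)))

      -- The denominator of the base used is the height h: from Q < h follows p ≤ C h⁴, and h ≤ X +
      -- 2 keeps the digits of order √p.
      expand-large-height : QuarticValue C′ y t
      expand-large-height = by-cases (ℕ.≤-total ∣ v f ∣ (u f))

-- The common form of the conclusion.

module Representations (p : ℕ) (p-prime : Prime p) where
  open Sums
  open Modular p p-prime
  open import Data.Integer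
  open import Data.List using (allFin)
  open import Data.Fin using (Fin)
  open import Data.Nat using () renaming (_<_ to _<ℕ_)
  open import Data.Product using (_×_; ∃₂)

  SumOfEightFractions : (a : ℤ) (M : ℕ) (b : ℤ) (N : ℕ) → ℤ → Set
  SumOfEightFractions a M b N λ₀ = ∃₂ λ (i j : Fin 8 → ℕ) →
    (∀ t → i t <ℕ M) × (∀ t → j t <ℕ N) × (∀ t → Unit (b + + j t)) ×
    ∑ (allFin 8) (λ t → (a + + i t) * inv (b + + j t)) ≋ λ₀

-- Long numerators: five neighbouring denominators.

module LongNumeratorRepresentations (p : ℕ) (p-prime : Prime p) where
  open Counting using (∣i∣≤n⇒0≤i+n)
  open Modular p p-prime
  open Pigeonhole p p-prime using (small⇒unit)
  open DigitExpansion p p-prime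
  open LongNumerators p p-prime
  open Representations p p-prime
  open import Data.Integer
  open import Data.Integer.Properties
  open import Algebra.Properties.AbelianGroup +-0-abelianGroup using (∙-cancelʳ)
  open import Data.Integer.Tactic.RingSolver using (solve-∀)
  open import Data.Fin as Fin using (Fin; toℕ; fromℕ<; combine)
  open import Data.Fin.Patterns
  import Data.Fin.Properties as Fin
  import Data.Nat as ℕ
  import Data.Nat.Properties as ℕ
  import Data.Nat.Tactic.RingSolver as ℕ
  open import Data.Product using (Σ; _×_; _,_; ∃-syntax; proj₁; proj₂)
  open import Relation.Nullary using (Dec; yes; no; contradiction)
  open import Relation.Binary.PropositionalEquality

  -- A record, so that the integer can be inferred from the type.
  record Bounded (i : ℤ) (n : ℕ) : Set where
    constructor bounded
    field bound : ∣ i ∣ ℕ.≤ n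

  bounded-+ : ∀ {i j m n} → Bounded i m → Bounded j n → Bounded (i + j) (m ℕ.+ n)
  bounded-+ {i} {j} (bounded i≤) (bounded j≤) = bounded (ℕ.≤-trans (∣i+j∣≤∣i∣+∣j∣ i j) (ℕ.+-mono-≤ i≤ j≤))

  bounded-* : ∀ {i j m n} → Bounded i m → Bounded j n → Bounded (i * j) (m ℕ.* n)
  bounded-* {i} {j} {m} {n} (bounded i≤) (bounded j≤) = bounded (subst (ℕ._≤ m ℕ.* n) (sym (abs-* i j)) (ℕ.*-mono-≤ i≤ j≤))

  ∣quartic∣≤ : ∀ {C} c₀ c₁ c₂ c₃ c₄ z → ∣ c₀ ∣ ℕ.≤ C → ∣ c₁ ∣ ℕ.≤ C → ∣ c₂ ∣ ℕ.≤ C → ∣ c₃ ∣ ℕ.≤ C → ∣ c₄ ∣ ℕ.≤ C →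
    ∣ z ∣ ℕ.≤ 4 → ∣ quartic c₀ c₁ c₂ c₃ c₄ z ∣ ℕ.≤ 341 ℕ.* C
  ∣quartic∣≤ {C} c₀ c₁ c₂ c₃ c₄ z b₀ b₁ b₂ b₃ b₄ z≤4 = ℕ.≤-trans
    (Bounded.bound (bounded-+ (bounded-+ (bounded-+ (bounded-+ (bounded {c₀} b₀) (bounded-* (bounded {c₁} b₁) z≤)) (bounded-* (bounded {c₂} b₂) z²≤))
      (bounded-* (bounded {c₃} b₃) (bounded-* z²≤ z≤))) (bounded-* (bounded {c₄} b₄) (bounded-* z²≤ z²≤))))
    (ℕ.≤-reflexive (collect C))
    where
    z≤ : Bounded z 4
    z≤ = bounded z≤4
    z²≤ : Bounded (z * z) (4 ℕ.* 4)
    z²≤ = bounded-* z≤ z≤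
    collect : ∀ C → C ℕ.+ C ℕ.* 4 ℕ.+ C ℕ.* 16 ℕ.+ C ℕ.* 64 ℕ.+ C ℕ.* 256 ≡ 341 ℕ.* C
    collect = ℕ.solve-∀

  FiveFractions : ℕ → (Fin 5 → ℤ) → ℤ → Set
  FiveFractions K Y t = Σ (Fin 5 → ℤ) λ k → (∀ i → ∣ k i ∣ ℕ.≤ K) ×
    k 0F * inv (Y 0F) + k 1F * inv (Y 1F) + k 2F * inv (Y 2F) + k 3F * inv (Y 3F) + k 4F * inv (Y 4F) ≋ t

  module _ (24<p : 24 ℕ.< p) (y : ℤ) (Y : Fin 5 → ℤ) (Y≡ : ∀ i → Y i ≡ y + + toℕ i) (Y-unit : ∀ i → Unit (Y i)) where

    private
      Π : ℤ
      Π = Y 0F * Y 1F * (Y 2F * Y 3F * Y 4F)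

      Π-unit : Unit Π
      Π-unit = unit-* (unit-* (Y-unit 0F) (Y-unit 1F)) (unit-* (unit-* (Y-unit 2F) (Y-unit 3F)) (Y-unit 4F))

      e : Fin 5 → ℤ
      e i = inv (Y i)

      clear : ∀ k₀ k₁ k₂ k₃ k₄ → Π * (k₀ * e 0F + k₁ * e 1F + k₂ * e 2F + k₃ * e 3F + k₄ * e 4F) ≋
        k₀ * (Y 1F * Y 2F * Y 3F * Y 4F) + k₁ * (Y 0F * Y 2F * Y 3F * Y 4F) + k₂ * (Y 0F * Y 1F * Y 3F * Y 4F) +
        k₃ * (Y 0F * Y 1F * Y 2F * Y 4F) + k₄ * (Y 0F * Y 1F * Y 2F * Y 3F)
      clear k₀ k₁ k₂ k₃ k₄ = ≋-trans
        (≋-reflexive (distribute (Y 0F) (Y 1F) (Y 2F) (Y 3F) (Y 4F) (e 0F) (e 1F) (e 2F) (e 3F) (e 4F) k₀ k₁ k₂ k₃ k₄))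
        (+-cong (+-cong (+-cong (+-cong (drop 0F k₀ _) (drop 1F k₁ _)) (drop 2F k₂ _)) (drop 3F k₃ _)) (drop 4F k₄ _))
        where
        distribute : ∀ y₀ y₁ y₂ y₃ y₄ e₀ e₁ e₂ e₃ e₄ k₀ k₁ k₂ k₃ k₄ →
          y₀ * y₁ * (y₂ * y₃ * y₄) * (k₀ * e₀ + k₁ * e₁ + k₂ * e₂ + k₃ * e₃ + k₄ * e₄) ≡
          (y₀ * e₀) * (k₀ * (y₁ * y₂ * y₃ * y₄)) + (y₁ * e₁) * (k₁ * (y₀ * y₂ * y₃ * y₄)) + (y₂ * e₂) * (k₂ * (y₀ * y₁ * y₃ * y₄)) +
          (y₃ * e₃) * (k₃ * (y₀ * y₁ * y₂ * y₄)) + (y₄ * e₄) * (k₄ * (y₀ * y₁ * y₂ * y₃))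
        distribute = solve-∀
        drop : ∀ i k z → (Y i * e i) * (k * z) ≋ k * z
        drop i k z = ≋-trans (*-cong (inv-inverse (Y-unit i)) (≋-refl {k * z})) (≋-reflexive (*-identityˡ (k * z)))

      -- Lagrange interpolation of c at 0, -1, -2, -3, -4.
      interpolate : ∀ c₀ c₁ c₂ c₃ c₄ →
        quartic c₀ c₁ c₂ c₃ c₄ (- + 0) * (Y 1F * Y 2F * Y 3F * Y 4F) +
        - + 4 * quartic c₀ c₁ c₂ c₃ c₄ (- + 1) * (Y 0F * Y 2F * Y 3F * Y 4F) +
        + 6 * quartic c₀ c₁ c₂ c₃ c₄ (- + 2) * (Y 0F * Y 1F * Y 3F * Y 4F) +
        - + 4 * quartic c₀ c₁ c₂ c₃ c₄ (- + 3) * (Y 0F * Y 1F * Y 2F * Y 4F) +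
        quartic c₀ c₁ c₂ c₃ c₄ (- + 4) * (Y 0F * Y 1F * Y 2F * Y 3F) ≡
        + 24 * quartic c₀ c₁ c₂ c₃ c₄ y
      interpolate c₀ c₁ c₂ c₃ c₄ rewrite Y≡ 0F | Y≡ 1F | Y≡ 2F | Y≡ 3F | Y≡ 4F = identity c₀ c₁ c₂ c₃ c₄ y
        where
        identity : ∀ c₀ c₁ c₂ c₃ c₄ y →
          (c₀ + c₁ * (- + 0) + c₂ * ((- + 0) * (- + 0)) + c₃ * ((- + 0) * (- + 0) * (- + 0)) + c₄ * ((- + 0) * (- + 0) * ((- + 0) * (- + 0)))) *
            ((y + + 1) * (y + + 2) * (y + + 3) * (y + + 4)) +
          - + 4 * (c₀ + c₁ * (- + 1) + c₂ * ((- + 1) * (- + 1)) + c₃ * ((- + 1) * (- + 1) * (- + 1)) + c₄ * ((- + 1) * (- + 1) * ((- + 1) * (- + 1)))) *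
            ((y + + 0) * (y + + 2) * (y + + 3) * (y + + 4)) +
          + 6 * (c₀ + c₁ * (- + 2) + c₂ * ((- + 2) * (- + 2)) + c₃ * ((- + 2) * (- + 2) * (- + 2)) + c₄ * ((- + 2) * (- + 2) * ((- + 2) * (- + 2)))) *
            ((y + + 0) * (y + + 1) * (y + + 3) * (y + + 4)) +
          - + 4 * (c₀ + c₁ * (- + 3) + c₂ * ((- + 3) * (- + 3)) + c₃ * ((- + 3) * (- + 3) * (- + 3)) + c₄ * ((- + 3) * (- + 3) * ((- + 3) * (- + 3)))) *
            ((y + + 0) * (y + + 1) * (y + + 2) * (y + + 4)) +
          (c₀ + c₁ * (- + 4) + c₂ * ((- + 4) * (- + 4)) + c₃ * ((- + 4) * (- + 4) * (- + 4)) + c₄ * ((- + 4) * (- + 4) * ((- + 4) * (- + 4)))) *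
            ((y + + 0) * (y + + 1) * (y + + 2) * (y + + 3)) ≡
          + 24 * (c₀ + c₁ * y + c₂ * (y * y) + c₃ * (y * y * y) + c₄ * (y * y * (y * y)))
        identity = solve-∀

    -- Dividing `interpolate` by Π gives 24 q(y)/Π as a sum of fractions k i / Y i, where k i is
    -- q(-i) times a signed binomial coefficient of 4. Hence the quartic is asked to take the value
    -- Π t / 24. In 2046 = 6 · 341 the 6 is the largest binomial coefficient, and 341 is the sum of
    -- the powers of 4 up to 4⁴.
    partialFractions : ∀ {C} t → QuarticValue C y (inv (+ 24) * (Π * t)) → FiveFractions (2046 ℕ.* C) Y t
    partialFractions {C} t (c₀ , c₁ , c₂ , c₃ , c₄ , b₀ , b₁ , b₂ , b₃ , b₄ , eq) = k , k≤ , *-cancelˡ Π-unit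
      (≋-trans (clear (k 0F) (k 1F) (k 2F) (k 3F) (k 4F)) (≋-trans (≋-reflexive (interpolate c₀ c₁ c₂ c₃ c₄))
      (≋-trans (*-cong (≋-refl {+ 24}) eq) (≋-trans (≋-reflexive (sym (*-assoc (+ 24) (inv (+ 24)) (Π * t))))
      (≋-trans (*-cong (inv-inverse (small⇒unit (ℕ.s≤s ℕ.z≤n) 24<p)) (≋-refl {Π * t})) (≋-reflexive (*-identityˡ (Π * t))))))))
      where
      q : ℤ → ℤ
      q = quartic c₀ c₁ c₂ c₃ c₄
      k : Fin 5 → ℤ
      k 0F = q (- + 0)
      k 1F = - + 4 * q (- + 1)
      k 2F = + 6 * q (- + 2)
      k 3F = - + 4 * q (- + 3)
      k 4F = q (- + 4)
      q≤ : ∀ z → ∣ z ∣ ℕ.≤ 4 → ∣ q z ∣ ℕ.≤ 341 ℕ.* C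
      q≤ z = ∣quartic∣≤ c₀ c₁ c₂ c₃ c₄ z b₀ b₁ b₂ b₃ b₄
      scaled : ∀ m z → ∣ m ∣ ℕ.≤ 6 → ∣ z ∣ ℕ.≤ 4 → ∣ m * q z ∣ ℕ.≤ 2046 ℕ.* C
      scaled m z m≤6 z≤4 = subst₂ ℕ._≤_ (sym (abs-* m (q z))) (sym (ℕ.*-assoc 6 341 C)) (ℕ.*-mono-≤ m≤6 (q≤ z z≤4))
      bare : ∀ z → ∣ z ∣ ℕ.≤ 4 → ∣ q z ∣ ℕ.≤ 2046 ℕ.* C
      bare z z≤4 = ℕ.≤-trans (q≤ z z≤4) (ℕ.*-monoˡ-≤ C (ℕ.≤ᵇ⇒≤ 341 2046 _))
      k≤ : ∀ i → ∣ k i ∣ ℕ.≤ 2046 ℕ.* C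
      k≤ 0F = bare (- + 0) (ℕ.≤ᵇ⇒≤ 0 4 _)
      k≤ 1F = scaled (- + 4) (- + 1) (ℕ.≤ᵇ⇒≤ 4 6 _) (ℕ.≤ᵇ⇒≤ 1 4 _)
      k≤ 2F = scaled (+ 6) (- + 2) (ℕ.≤ᵇ⇒≤ 6 6 _) (ℕ.≤ᵇ⇒≤ 2 4 _)
      k≤ 3F = scaled (- + 4) (- + 3) (ℕ.≤ᵇ⇒≤ 4 6 _) (ℕ.≤ᵇ⇒≤ 3 4 _)
      k≤ 4F = bare (- + 4) (ℕ.≤ᵇ⇒≤ 4 4 _)

  module _ (X : ℕ) (1≤X : 1 ℕ.≤ X) (X²≤p : X ℕ.* X ℕ.≤ p) (p<[1+X]² : p ℕ.< ℕ.suc X ℕ.* ℕ.suc X) (X+2<p : X ℕ.+ 2 ℕ.< p) where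

    -- There are few residues v/u of small height, and the elements of an interval are distinct.
    large-height-exists : ∀ b n Q → n ℕ.≤ p → Q ℕ.* ℕ.suc (2 ℕ.* Q) ℕ.< n →
      ∃[ j ] (j ℕ.< n × ∃[ f ] Q ℕ.< Fraction.height {b + + j} {X} f)
    large-height-exists b n Q n≤p small = search (Fin.any? (λ j → Q ℕ.<? height (f j)))
      where
      open Fraction
      f : ∀ (j : Fin n) → Fraction (b + + toℕ j) X
      f j = fraction X 1≤X X²≤p p<[1+X]² X+2<p (b + + toℕ j)
      module AllSmall (height≤ : ∀ j → height (f j) ℕ.≤ Q) where
        ∣v∣≤Q : ∀ j → ∣ v (f j) ∣ ℕ.≤ Q
        ∣v∣≤Q j = ℕ.≤-trans (ℕ.m≤n⊔m (u (f j)) ∣ v (f j) ∣) (height≤ j)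
        u-1<Q : ∀ j → ℕ.pred (u (f j)) ℕ.< Q
        u-1<Q j = ℕ.<-≤-trans (ℕ.≤-reflexive (ℕ.suc-pred (u (f j)) {{ℕ.>-nonZero (0<u (f j))}})) (ℕ.≤-trans (ℕ.m≤m⊔n (u (f j)) ∣ v (f j) ∣) (height≤ j))
        v+Q< : ∀ j → ∣ v (f j) + + Q ∣ ℕ.< ℕ.suc (2 ℕ.* Q)
        v+Q< j = ℕ.s≤s (ℕ.≤-trans (∣i+j∣≤∣i∣+∣j∣ (v (f j)) (+ Q)) (subst (∣ v (f j) ∣ ℕ.+ Q ℕ.≤_) (cong (Q ℕ.+_) (sym (ℕ.+-identityʳ Q))) (ℕ.+-monoˡ-≤ Q (∣v∣≤Q j))))
        -- Here u runs through 1, ..., Q and v through -Q, ..., Q; both are shifted to start at 0.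
        code : Fin n → Fin (Q ℕ.* ℕ.suc (2 ℕ.* Q))
        code j = combine (fromℕ< (u-1<Q j)) (fromℕ< (v+Q< j))
        distinct : ∀ {i j} → toℕ i ℕ.< toℕ j → code i ≢ code j
        distinct {i} {j} i<j eq = ℕ.<⇒≢ i<j (≋⇒toℕ≡ (ℕ.<-≤-trans (Fin.toℕ<n i) n≤p) (ℕ.<-≤-trans (Fin.toℕ<n j) n≤p)
          (≋-trans (≋-reflexive (cancel b (+ toℕ i))) (≋-trans (minus-cong y≋ (≋-refl {b})) (≋-reflexive (sym (cancel b (+ toℕ j)))))))
          where
          cancel : ∀ b i → i ≡ b + i - b
          cancel = solve-∀
          codes = Fin.combine-injective (fromℕ< (u-1<Q i)) (fromℕ< (v+Q< i)) (fromℕ< (u-1<Q j)) (fromℕ< (v+Q< j)) eq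
          u≡ : u (f i) ≡ u (f j)
          u≡ = trans (sym (ℕ.suc-pred (u (f i)) {{ℕ.>-nonZero (0<u (f i))}})) (trans (cong ℕ.suc
            (trans (sym (Fin.toℕ-fromℕ< (u-1<Q i))) (trans (cong toℕ (proj₁ codes)) (Fin.toℕ-fromℕ< (u-1<Q j)))))
            (ℕ.suc-pred (u (f j)) {{ℕ.>-nonZero (0<u (f j))}}))
          ∣v+Q∣≡ : ∣ v (f i) + + Q ∣ ≡ ∣ v (f j) + + Q ∣
          ∣v+Q∣≡ = trans (sym (Fin.toℕ-fromℕ< (v+Q< i))) (trans (cong toℕ (proj₂ codes)) (Fin.toℕ-fromℕ< (v+Q< j)))
          v≡ : v (f i) ≡ v (f j)
          v≡ = ∙-cancelʳ (+ Q) (v (f i)) (v (f j)) (trans (sym (0≤i⇒+∣i∣≡i (∣i∣≤n⇒0≤i+n (v (f i)) (∣v∣≤Q i))))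
            (trans (cong +_ ∣v+Q∣≡) (0≤i⇒+∣i∣≡i (∣i∣≤n⇒0≤i+n (v (f j)) (∣v∣≤Q j)))))
          u-unit : Unit (+ u (f i))
          u-unit = small⇒unit (0<u (f i)) (ℕ.≤-<-trans (u≤X (f i)) (ℕ.≤-<-trans (ℕ.m≤m+n X 2) X+2<p))
          y≋ : b + + toℕ i ≋ b + + toℕ j
          y≋ = *-cancelˡ u-unit (≋-trans (uy≋v (f i)) (≋-trans (≋-reflexive v≡) (≋-trans (≋-sym (uy≋v (f j)))
            (≋-reflexive (cong (λ n → + n * (b + + toℕ j)) (sym u≡))))))
      search : Dec (∃[ j ] Q ℕ.< height (f j)) → ∃[ j ] (j ℕ.< n × ∃[ g ] Q ℕ.< Fraction.height {b + + j} {X} g)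
      search (yes (j , Q<)) = toℕ j , Fin.toℕ<n j , f j , Q<
      search (no ¬∃) = contradiction collide (λ (i , j , i<j , eq) → AllSmall.distinct height≤ i<j eq)
        where
        height≤ : ∀ j → height (f j) ℕ.≤ Q
        height≤ j = ℕ.≮⇒≥ (λ Q< → ¬∃ (j , Q<))
        collide = Fin.pigeonhole small (AllSmall.code height≤)

    module _ (24<p : 24 ℕ.< p) (a b : ℤ) (M N C Q : ℕ) (N≤p : N ℕ.≤ p)
      (b+j-unit : ∀ {j} → j ℕ.< N → Unit (b + + j))
      (Q-small : Q ℕ.* ℕ.suc (2 ℕ.* Q) ℕ.+ 5 ℕ.≤ N)
      (Q-large : p ℕ.≤ C ℕ.* (Q ℕ.* Q ℕ.* (Q ℕ.* Q)))
      (M-large : 2 ℕ.* (2046 ℕ.* (C ℕ.+ 4 ℕ.* (X ℕ.+ 2))) ℕ.< M) (λ₀ : ℤ) where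

      private
        K : ℕ
        K = 2046 ℕ.* (C ℕ.+ 4 ℕ.* (X ℕ.+ 2))

        -- One more than the number of pairs (u, v) of height at most Q. By `Q-small`, four further
        -- denominators follow each of the first n.
        n : ℕ
        n = ℕ.suc (Q ℕ.* ℕ.suc (2 ℕ.* Q))

        n+4≤N : n ℕ.+ 4 ℕ.≤ N
        n+4≤N = ℕ.≤-trans (ℕ.≤-reflexive (sym (ℕ.+-suc (Q ℕ.* ℕ.suc (2 ℕ.* Q)) 4))) Q-small

        module _ (j₀ : ℕ) (j₀<n : j₀ ℕ.< n) where

          Y : Fin 5 → ℤ
          Y i = b + + (j₀ ℕ.+ toℕ i)

          j+i<N : ∀ (i : Fin 5) → j₀ ℕ.+ toℕ i ℕ.< N
          j+i<N i = ℕ.<-≤-trans (ℕ.+-mono-<-≤ j₀<n (Fin.toℕ≤pred[n] i)) n+4≤N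

          Y-unit : ∀ i → Unit (Y i)
          Y-unit i = b+j-unit (j+i<N i)

          -- The midpoint of the first 2K + 1 numerators: x₀ + k stays in the interval for |k| ≤ K.
          x₀ : ℤ
          x₀ = a + + K

          -- What x₀ contributes to the eight numerators is removed beforehand. The term
          -- `+ 3 * inv (Y 0F)` belongs to the three fractions x₀ / Y 0 that raise five to eight.
          target : ℤ
          target = λ₀ - x₀ * (inv (Y 0F) + inv (Y 1F) + inv (Y 2F) + inv (Y 3F) + inv (Y 4F) + + 3 * inv (Y 0F))

          assemble : FiveFractions K Y target → SumOfEightFractions a M b N λ₀
          assemble (k , k≤ , eq) = i , j , i<M , j<N , (λ t → b+j-unit (j<N t)) ,
            ≋-trans (≋-reflexive (trans (cong₂ (λ f g → f + g) (term 0F)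
              (cong₂ _+_ (term 1F) (cong₂ _+_ (term 2F) (cong₂ _+_ (term 3F) (cong (_+ rest) (term 4F))))))
              (collect x₀ (k 0F) (k 1F) (k 2F) (k 3F) (k 4F) (inv (Y 0F)) (inv (Y 1F)) (inv (Y 2F)) (inv (Y 3F)) (inv (Y 4F)))))
            (≋-trans (+-cong eq (≋-refl {shift})) (≋-reflexive (cancel λ₀ shift)))
            where
            shift rest : ℤ
            shift = x₀ * (inv (Y 0F) + inv (Y 1F) + inv (Y 2F) + inv (Y 3F) + inv (Y 4F) + + 3 * inv (Y 0F))
            rest = x₀ * inv (Y 0F) + (x₀ * inv (Y 0F) + (x₀ * inv (Y 0F) + 0ℤ))
            index : Fin 5 → ℕ
            index l = ∣ k l + + K ∣
            i j : Fin 8 → ℕ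
            i 0F = index 0F
            i 1F = index 1F
            i 2F = index 2F
            i 3F = index 3F
            i 4F = index 4F
            i 5F = K
            i 6F = K
            i 7F = K
            j 0F = j₀ ℕ.+ 0
            j 1F = j₀ ℕ.+ 1
            j 2F = j₀ ℕ.+ 2
            j 3F = j₀ ℕ.+ 3
            j 4F = j₀ ℕ.+ 4
            j 5F = j₀ ℕ.+ 0
            j 6F = j₀ ℕ.+ 0
            j 7F = j₀ ℕ.+ 0
            index<M : ∀ l → index l ℕ.< M
            index<M l = ℕ.≤-<-trans (ℕ.≤-trans (∣i+j∣≤∣i∣+∣j∣ (k l) (+ K)) (ℕ.≤-trans (ℕ.+-monoˡ-≤ K (k≤ l)) (ℕ.+-monoʳ-≤ K (ℕ.m≤m+n K 0)))) M-large
            K<M : K ℕ.< M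
            K<M = ℕ.≤-<-trans (ℕ.m≤m+n K (K ℕ.+ 0)) M-large
            i<M : ∀ t → i t ℕ.< M
            i<M 0F = index<M 0F
            i<M 1F = index<M 1F
            i<M 2F = index<M 2F
            i<M 3F = index<M 3F
            i<M 4F = index<M 4F
            i<M 5F = K<M
            i<M 6F = K<M
            i<M 7F = K<M
            j<N : ∀ t → j t ℕ.< N
            j<N 0F = j+i<N 0F
            j<N 1F = j+i<N 1F
            j<N 2F = j+i<N 2F
            j<N 3F = j+i<N 3F
            j<N 4F = j+i<N 4F
            j<N 5F = j+i<N 0F
            j<N 6F = j+i<N 0F
            j<N 7F = j+i<N 0F
            term : ∀ l → (a + + index l) * inv (Y l) ≡ (x₀ + k l) * inv (Y l)
            term l = cong (_* inv (Y l)) (trans (cong (_+_ a) (0≤i⇒+∣i∣≡i (∣i∣≤n⇒0≤i+n (k l) (k≤ l)))) (regroup a (k l) (+ K)))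
              where
              regroup : ∀ a k K → a + (k + K) ≡ a + K + k
              regroup = solve-∀
            collect : ∀ x k₀ k₁ k₂ k₃ k₄ e₀ e₁ e₂ e₃ e₄ →
              (x + k₀) * e₀ + ((x + k₁) * e₁ + ((x + k₂) * e₂ + ((x + k₃) * e₃ + ((x + k₄) * e₄ + (x * e₀ + (x * e₀ + (x * e₀ + 0ℤ))))))) ≡
              k₀ * e₀ + k₁ * e₁ + k₂ * e₂ + k₃ * e₃ + k₄ * e₄ + x * (e₀ + e₁ + e₂ + e₃ + e₄ + + 3 * e₀)
            collect = solve-∀
            cancel : ∀ l s → l - s + s ≡ l
            cancel = solve-∀

          solveAt : ∃[ f ] Q ℕ.< Fraction.height {b + + j₀} {X} f → SumOfEightFractions a M b N λ₀
          solveAt (f , Q<) = assemble (partialFractions 24<p (b + + j₀) Y (λ i → sym (+-assoc b (+ j₀) (+ toℕ i))) Y-unit target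
            (expand-large-height X 1≤X X²≤p p<[1+X]² X+2<p f Q C (b+j-unit (ℕ.<-≤-trans j₀<n (ℕ.≤-trans (ℕ.m≤m+n n 4) n+4≤N))) Q< Q-large _))

      longNumerators : SumOfEightFractions a M b N λ₀
      longNumerators = from-height (large-height-exists b n Q (ℕ.≤-trans (ℕ.≤-trans (ℕ.m≤m+n n 4) n+4≤N) N≤p) (ℕ.n<1+n _))
        where
        from-height : ∃[ j ] (j ℕ.< n × ∃[ f ] Q ℕ.< Fraction.height {b + + j} {X} f) → SumOfEightFractions a M b N λ₀
        from-height (j , j<n , f) = solveAt j j<n f

-- Passing to subintervals of units.

module Subintervals (p : ℕ) (p-prime : Prime p) where
  open Sums
  open Modular p p-prime
  open Pigeonhole p p-prime using (unitSubinterval)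
  open Representations p p-prime
  open BilinearCovering p p-prime using (FourProducts)
  open import Data.Integer
  open import Data.Integer.Properties
  open import Data.Integer.Divisibility.Signed
  open import Data.Integer.Tactic.RingSolver using (solve-∀)
  open import Data.List using (allFin)
  open import Data.Fin using (Fin; toℕ)
  open import Data.Fin.Patterns
  import Data.Fin.Properties as Fin
  import Data.Nat as ℕ
  import Data.Nat.Properties as ℕ
  open import Data.Product using (_×_; _,_; ∃-syntax)
  open import Relation.Binary.PropositionalEquality

  restrict : ∀ {a M b N c M′ c′ N′ λ₀} → c ℕ.+ M′ ℕ.≤ M → c′ ℕ.+ N′ ℕ.≤ N →
    SumOfEightFractions (a + + c) M′ (b + + c′) N′ λ₀ → SumOfEightFractions a M b N λ₀
  restrict {a} {M} {b} {N} {c} {M′} {c′} {N′} c+M′≤M c′+N′≤N (i , j , i<M′ , j<N′ , units , eq) =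
    (λ t → c ℕ.+ i t) , (λ t → c′ ℕ.+ j t) ,
    (λ t → ℕ.<-≤-trans (ℕ.+-monoʳ-< c (i<M′ t)) c+M′≤M) , (λ t → ℕ.<-≤-trans (ℕ.+-monoʳ-< c′ (j<N′ t)) c′+N′≤N) ,
    (λ t → subst Unit (+-assoc b (+ c′) (+ j t)) (units t)) ,
    ≋-trans (≋-reflexive (∑-cong (allFin 8) λ t →
      cong₂ (λ x y → x * inv y) (sym (+-assoc a (+ c) (+ i t))) (sym (+-assoc b (+ c′) (+ j t))))) eq

  -- Each product x w with w = 1/y + 1/y′ is two fractions with a common numerator.
  fromFourProducts : ∀ {a M b N λ₀} → (∀ (j : Fin N) → Unit (b + + toℕ j)) →
    FourProducts {Fin M} {Fin N × Fin N} (λ i → a + + toℕ i) (λ (i , j) → inv (b + + toℕ i) + inv (b + + toℕ j)) λ₀ →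
    SumOfEightFractions a M b N λ₀
  fromFourProducts {a} {M} {b} {N} units ((a₁ , a₂ , a₃ , a₄) , ((k₁ , l₁) , (k₂ , l₂) , (k₃ , l₃) , (k₄ , l₄)) , eq) =
    (λ t → toℕ (i t)) , (λ t → toℕ (j t)) , (λ t → Fin.toℕ<n (i t)) , (λ t → Fin.toℕ<n (j t)) , (λ t → units (j t)) ,
    ≋-trans (≋-reflexive (collect (x 0F) (x 2F) (x 4F) (x 6F) (e 0F) (e 1F) (e 2F) (e 3F) (e 4F) (e 5F) (e 6F) (e 7F))) eq
    where
    i : Fin 8 → Fin M
    i 0F = a₁
    i 1F = a₁
    i 2F = a₂
    i 3F = a₂
    i 4F = a₃
    i 5F = a₃
    i 6F = a₄
    i 7F = a₄
    j : Fin 8 → Fin N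
    j 0F = k₁
    j 1F = l₁
    j 2F = k₂
    j 3F = l₂
    j 4F = k₃
    j 5F = l₃
    j 6F = k₄
    j 7F = l₄
    x e : Fin 8 → ℤ
    x t = a + + toℕ (i t)
    e t = inv (b + + toℕ (j t))
    collect : ∀ x₁ x₂ x₃ x₄ e₀ e₁ e₂ e₃ e₄ e₅ e₆ e₇ →
      x₁ * e₀ + (x₁ * e₁ + (x₂ * e₂ + (x₂ * e₃ + (x₃ * e₄ + (x₃ * e₅ + (x₄ * e₆ + (x₄ * e₇ + 0ℤ))))))) ≡
      x₁ * (e₀ + e₁) + x₂ * (e₂ + e₃) + (x₃ * (e₄ + e₅) + x₄ * (e₆ + e₇))
    collect = solve-∀

  record UnitSubinterval (b : ℤ) (n : ℕ) : Set where
    field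
      start    : ℕ
      start≤n  : start ℕ.≤ n
      sum-unit : ∀ {i j} → i ℕ.< n → j ℕ.< n → Unit (b + + start + + i + (b + + start + + j))

    unit : ∀ {j} → j ℕ.< n → Unit (b + + start + + j)
    unit j<n p∣ = sum-unit j<n j<n (∣m∣n⇒∣m+n p∣ p∣)

  unit-subinterval : ∀ b n → 4 ℕ.* n ℕ.≤ p → UnitSubinterval b n
  unit-subinterval b n 4n≤p = from (unitSubinterval b n 4n≤p)
    where
    from : ∃[ c ] (c ℕ.≤ n × (∀ {i} → i ℕ.< 2 ℕ.* n → Unit (+ 2 * (b + + c) + + i))) → UnitSubinterval b n
    from (c , c≤n , units) = record { start = c ; start≤n = c≤n ; sum-unit = λ {i} {j} i<n j<n p∣ →
      units (subst (i ℕ.+ j ℕ.<_) (cong (n ℕ.+_) (sym (ℕ.+-identityʳ n))) (ℕ.+-mono-< i<n j<n))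
        (∣-resp (collect (b + + c) (+ i) (+ j)) p∣) }
      where
      collect : ∀ y i j → y + i + (y + j) ≡ + 2 * y + (i + j)
      collect = solve-∀

-- Both regimes with explicit constants.

module Regimes (p : ℕ) (p-prime : Prime p) where
  open Thresholds
  open DivisorTables
  open Representations p p-prime
  open Subintervals p p-prime
  open ShortNumerators p p-prime using (fourProducts)
  open LongNumeratorRepresentations p p-prime using (longNumerators)
  open import Data.Nat
  open import Data.Nat.Properties
  open import Data.Nat.DivMod using (m/n*n≤m)
  open import Data.Nat.Tactic.RingSolver using (solve-∀)
  open import Data.Integer using (ℤ; +_)
  import Data.Integer as ℤ
  import Data.Integer.Properties as ℤ
  import Data.Fin.Properties as Fin
  open import Data.Product using (_×_; _,_; ∃-syntax)
  open import Relation.Binary.PropositionalEquality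

  m≤2n[m/n] : ∀ m n .{{_ : NonZero n}} → n ≤ m → m ≤ 2 * n * (m / n)
  m≤2n[m/n] m n n≤m = <⇒≤ (begin-strict
    m                   <⟨ m<[1+m/n]*n m n ⟩
    suc (m / n) * n     ≤⟨ *-monoˡ-≤ n (+-monoˡ-≤ (m / n) 1≤m/n) ⟩
    (m / n + m / n) * n ≡⟨ collect (m / n) n ⟩
    2 * n * (m / n) ∎)
    where
    open ≤-Reasoning
    collect : ∀ q n → (q + q) * n ≡ 2 * n * q
    collect = solve-∀
    1≤m/n : 1 ≤ m / n
    1≤m/n = ≮⇒≥ λ { (s≤s q≤0) → <⇒≱ (m<[1+m/n]*n m n) (≤-trans (≤-reflexive (trans (cong (λ q → suc q * n) (n≤0⇒n≡0 q≤0)) (+-identityʳ n))) n≤m) }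

  m*m<n*n⇒m<n : ∀ {m n} → m * m < n * n → m < n
  m*m<n*n⇒m<n {m} {n} m²<n² = ≰⇒> λ n≤m → <⇒≱ m²<n² (*-mono-≤ n≤m n≤m)

  2m≤n⇒c+m≤n : ∀ {c m n} → c ≤ m → 2 * m ≤ n → c + m ≤ n
  2m≤n⇒c+m≤n {c} {m} c≤m 2m≤n = ≤-trans (+-mono-≤ c≤m (m≤m+n m 0)) 2m≤n

  quarter : ∀ n → 4 * (n / 4) ≤ n
  quarter n = ≤-trans (≤-reflexive (*-comm 4 (n / 4))) (m/n*n≤m n 4)

  2m≤4m : ∀ m → 2 * m ≤ 4 * m
  2m≤4m m = *-monoˡ-≤ m (≤ᵇ⇒≤ 2 4 _)

  module _ (a b : ℤ) (M N : ℕ) (M≤p : M ≤ p) (N≤p : N ≤ p) (λ₀ : ℤ) where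

    short : ∀ {τ} → 0 < τ → DivisorTable (2 * p * (2 * p)) τ → ∀ L .{{_ : NonZero L}} → 4 * L ≤ M → 4 ≤ N → M * M < L * L * p →
      (574464 * (512 * (L * L))) * (τ * τ * (τ * τ) * (τ * τ)) * p < M * M * N →
      (574464 * (512 * (L * L))) * (τ * τ * (τ * τ) * (τ * τ)) * p < M * N * N →
      SumOfEightFractions a M b N λ₀
    short {τ} 0<τ table L 4L≤M 4≤N M²<L²p large₁ large₂ =
      restrict {a} {M} {b} {N} {c} {M′} {c′} {N′} (2m≤n⇒c+m≤n ℐ.start≤n (≤-trans (2m≤4m M′) 4M′≤M)) (2m≤n⇒c+m≤n 𝒥.start≤n (≤-trans (2m≤4m N′) (quarter N)))
        (fromFourProducts {a ℤ.+ + c} {M′} {b ℤ.+ + c′} {N′} (λ j → 𝒥.unit (Fin.toℕ<n j))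
          (fourProducts 0<τ table (a ℤ.+ + c) (b ℤ.+ + c′) M′ N′ 0<M′ 0<N′ M′²≤p 4M′≤p (≤-trans (m≤n*m N′ 4) (≤-trans (quarter N) N≤p))
            (λ i → ℐ.unit (Fin.toℕ<n i)) (λ i j → 𝒥.sum-unit (Fin.toℕ<n i) (Fin.toℕ<n j)) large₁′ large₂′ λ₀))
      where
      instance
        4L≢0 : NonZero (4 * L)
        4L≢0 = m*n≢0 4 L
      t = τ * τ * (τ * τ) * (τ * τ)
      -- The division by 4 provides the room that `unit-subinterval` needs, and the division by L
      -- brings M′ below √p.
      M′ N′ : ℕ
      M′ = M / (4 * L)
      N′ = N / 4
      4LM′≤M : 4 * L * M′ ≤ M
      4LM′≤M = ≤-trans (≤-reflexive (*-comm (4 * L) M′)) (m/n*n≤m M (4 * L))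
      4M′≤M : 4 * M′ ≤ M
      4M′≤M = ≤-trans (*-monoˡ-≤ M′ (m≤m*n 4 L)) 4LM′≤M
      4M′≤p : 4 * M′ ≤ p
      4M′≤p = ≤-trans 4M′≤M M≤p
      M≤8LM′ : M ≤ 2 * (4 * L) * M′
      M≤8LM′ = m≤2n[m/n] M (4 * L) 4L≤M
      N≤8N′ : N ≤ 8 * N′
      N≤8N′ = m≤2n[m/n] N 4 4≤N
      0<M′ : 0 < M′
      0<M′ = n≢0⇒n>0 λ M′≡0 → <⇒≱ (≤-trans (>-nonZero⁻¹ (4 * L)) 4L≤M) (≤-trans M≤8LM′ (≤-reflexive (trans (cong (2 * (4 * L) *_) M′≡0) (*-zeroʳ (2 * (4 * L))))))
      0<N′ : 0 < N′
      0<N′ = n≢0⇒n>0 λ N′≡0 → <⇒≱ (≤-trans (s≤s z≤n) 4≤N) (≤-trans N≤8N′ (≤-reflexive (cong (8 *_) N′≡0)))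
      M′²≤p : M′ * M′ ≤ p
      M′²≤p = *-cancelˡ-≤ (L * L) {{m*n≢0 L L}} (begin
        L * L * (M′ * M′)      ≡⟨ regroup L M′ ⟩
        L * M′ * (L * M′)      ≤⟨ *-mono-≤ LM′≤M LM′≤M ⟩
        M * M                  ≤⟨ <⇒≤ M²<L²p ⟩
        L * L * p ∎)
        where
        open ≤-Reasoning
        LM′≤M : L * M′ ≤ M
        LM′≤M = ≤-trans (*-monoˡ-≤ M′ (m≤n*m L 4)) 4LM′≤M
        regroup : ∀ L m → L * L * (m * m) ≡ L * m * (L * m)
        regroup = solve-∀
      ℐ = unit-subinterval a M′ 4M′≤p
      𝒥 = unit-subinterval b N′ (≤-trans (quarter N) N≤p)
      module ℐ = UnitSubinterval ℐ
      module 𝒥 = UnitSubinterval 𝒥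
      c = ℐ.start
      c′ = 𝒥.start
      L²≢0 : NonZero (512 * (L * L))
      L²≢0 = m*n≢0 512 (L * L) {{_}} {{m*n≢0 L L}}
      -- 512 L² = (8L)² · 8, because M ≤ 8L M′ and N ≤ 8N′.
      large₁′ : 574464 * t * p ≤ M′ * M′ * N′
      large₁′ = *-cancelˡ-≤ (512 * (L * L)) {{L²≢0}} (begin
        512 * (L * L) * (574464 * t * p)           ≡⟨ regroup (512 * (L * L)) 574464 t p ⟩
        574464 * (512 * (L * L)) * t * p           ≤⟨ <⇒≤ large₁ ⟩
        M * M * N                                  ≤⟨ *-mono-≤ (*-mono-≤ M≤8LM′ M≤8LM′) N≤8N′ ⟩
        2 * (4 * L) * M′ * (2 * (4 * L) * M′) * (8 * N′) ≡⟨ collect L M′ N′ ⟩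
        512 * (L * L) * (M′ * M′ * N′) ∎)
        where
        open ≤-Reasoning
        regroup : ∀ l k t p → l * (k * t * p) ≡ k * l * t * p
        regroup = solve-∀
        collect : ∀ L m n → 2 * (4 * L) * m * (2 * (4 * L) * m) * (8 * n) ≡ 512 * (L * L) * (m * m * n)
        collect = solve-∀
      linear : 574464 * t * p < M′ * N′ * N′
      linear = *-cancelˡ-< (512 * (L * L)) (574464 * t * p) (M′ * N′ * N′) (begin-strict
        512 * (L * L) * (574464 * t * p)           ≡⟨ regroup (512 * (L * L)) 574464 t p ⟩
        574464 * (512 * (L * L)) * t * p           <⟨ large₂ ⟩
        M * N * N                                  ≤⟨ *-mono-≤ (*-mono-≤ M≤8LM′ N≤8N′) N≤8N′ ⟩
        2 * (4 * L) * M′ * (8 * N′) * (8 * N′)     ≡⟨ collect L M′ N′ ⟩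
        512 * L * (M′ * N′ * N′)                   ≤⟨ *-monoˡ-≤ (M′ * N′ * N′) (*-monoʳ-≤ 512 (m≤m*n L L)) ⟩
        512 * (L * L) * (M′ * N′ * N′) ∎)
        where
        open ≤-Reasoning
        regroup : ∀ l k t p → l * (k * t * p) ≡ k * l * t * p
        regroup = solve-∀
        collect : ∀ L m n → 2 * (4 * L) * m * (8 * n) * (8 * n) ≡ 512 * L * (m * n * n)
        collect = solve-∀
      0<t : 0 < t
      0<t = *-mono-< (*-mono-< (*-mono-< 0<τ 0<τ) (*-mono-< 0<τ 0<τ)) (*-mono-< 0<τ 0<τ)
      -- Squaring `linear` produces the constant factor twice; one copy is dropped.
      large₂′ : 574464 * t * (p * p) < M′ * N′ * N′ * (M′ * N′ * N′)
      large₂′ = begin-strict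
        574464 * t * (p * p)              ≡⟨ *-assoc (574464 * t) p p ⟨
        574464 * t * p * p                ≤⟨ *-monoʳ-≤ (574464 * t * p) (m≤n*m p (574464 * t) {{m*n≢0 574464 t {{_}} {{>-nonZero 0<t}}}}) ⟩
        574464 * t * p * (574464 * t * p) <⟨ *-mono-< linear linear ⟩
        M′ * N′ * N′ * (M′ * N′ * N′) ∎
        where open ≤-Reasoning

    -- The lower bound for M² pays for the digits of order √p, and the one for M N² pays for the
    -- remaining coefficient of order p/Q⁴, as Q² is of order N.
    long : 24 < p → 64 ≤ N → 106392 * 106392 * p ≤ M * M → 512 * 512 * 8184 * p < M * N * N → SumOfEightFractions a M b N λ₀
    long 24<p 64≤N M²-large large = restrict {a} {M} {b} {N} {0} {M} {c′} {N′} ≤-refl (2m≤n⇒c+m≤n 𝒥.start≤n (≤-trans (2m≤4m N′) (quarter N)))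
      (subst (λ a′ → SumOfEightFractions a′ M (b ℤ.+ + c′) N′ λ₀) (sym (ℤ.+-identityʳ a)) (from-X (scaledSqrt p 1 (s≤s z≤n) (≤-trans (s≤s z≤n) 24<p))))
      where
      N′ : ℕ
      N′ = N / 4
      𝒥 = unit-subinterval b N′ (≤-trans (quarter N) N≤p)
      module 𝒥 = UnitSubinterval 𝒥
      c′ = 𝒥.start
      N≤8N′ : N ≤ 8 * N′
      N≤8N′ = m≤2n[m/n] N 4 (≤-trans (≤ᵇ⇒≤ 4 64 _) 64≤N)
      16≤N′ : 16 ≤ N′
      16≤N′ = *-cancelˡ-≤ 4 (≮⇒≥ λ 4N′<64 → <⇒≱ (m<[1+m/n]*n N 4) (≤-trans (≤-trans (≤-reflexive (*-comm (suc N′) 4)) (*-monoʳ-≤ 4 (*-cancelˡ-< 4 N′ 16 4N′<64))) 64≤N))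
      from-X : ∃[ X ] (1 ≤ X × X * X * 1 ≤ p × p < suc X * suc X * 1) → SumOfEightFractions a M (b ℤ.+ + c′) N′ λ₀
      -- Q is the integer part of √(N′/16), so Q(2Q + 1) + 5 ≤ 8Q² fits into N′ while Q² is still
      -- comparable to N.
      from-X (X , 1≤X , X²≤p , p<) = from-Q (scaledSqrt N′ 16 (s≤s z≤n) 16≤N′)
        where
        X²≤p′ : X * X ≤ p
        X²≤p′ = subst (_≤ p) (*-identityʳ (X * X)) X²≤p
        X+2<p : X + 2 < p
        X+2<p = ≰⇒> λ p≤X+2 → <⇒≱ (begin-strict
          p           ≤⟨ p≤X+2 ⟩
          X + 2       <⟨ +-monoʳ-< X (≤-trans (≤ᵇ⇒≤ 3 22 _) (*-monoʳ-≤ 22 1≤X)) ⟩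
          X + 22 * X  ≤⟨ *-monoˡ-≤ X (+-cancelʳ-≤ 2 23 X (≤-trans 24<p p≤X+2)) ⟩
          X * X ∎) X²≤p′
          where open ≤-Reasoning
        106392X≤M : 106392 * X ≤ M
        106392X≤M = ≮⇒≥ λ M< → <⇒≱ (begin-strict
          M * M                            <⟨ *-mono-< M< M< ⟩
          106392 * X * (106392 * X)        ≡⟨ regroup 106392 X ⟩
          106392 * 106392 * (X * X)        ≤⟨ *-monoʳ-≤ (106392 * 106392) X²≤p′ ⟩
          106392 * 106392 * p ∎) M²-large
          where
          open ≤-Reasoning
          regroup : ∀ k X → k * X * (k * X) ≡ k * k * (X * X)
          regroup = solve-∀
        from-Q : ∃[ Q ] (1 ≤ Q × Q * Q * 16 ≤ N′ × N′ < suc Q * suc Q * 16) → SumOfEightFractions a M (b ℤ.+ + c′) N′ λ₀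
        from-Q (Q , 1≤Q , 16Q²≤N′ , N′<) = longNumerators X 1≤X X²≤p′ (subst (p <_) (*-identityʳ (suc X * suc X)) p<) X+2<p 24<p
          a (b ℤ.+ + c′) M N′ C Q (≤-trans (m≤n*m N′ 4) (≤-trans (quarter N) N≤p)) 𝒥.unit Q-small (<⇒≤ (m<[1+m/n]*n p Q⁴)) M-large λ₀
          where
          Q⁴ : ℕ
          Q⁴ = Q * Q * (Q * Q)
          instance
            Q≢0 : NonZero Q
            Q≢0 = >-nonZero 1≤Q
            Q⁴≢0 : NonZero Q⁴
            Q⁴≢0 = m*n≢0 (Q * Q) (Q * Q) {{m*n≢0 Q Q}} {{m*n≢0 Q Q}}
          C : ℕ
          C = suc (p / Q⁴)
          1≤Q² : 1 ≤ Q * Q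
          1≤Q² = *-mono-≤ 1≤Q 1≤Q
          Q-small : Q * suc (2 * Q) + 5 ≤ N′
          Q-small = begin
            Q * suc (2 * Q) + 5          ≡⟨ expand Q ⟩
            Q * 1 + 2 * (Q * Q) + 5 * 1   ≤⟨ +-mono-≤ (+-monoˡ-≤ (2 * (Q * Q)) (*-monoʳ-≤ Q 1≤Q)) (*-monoʳ-≤ 5 1≤Q²) ⟩
            Q * Q + 2 * (Q * Q) + 5 * (Q * Q) ≡⟨ collect (Q * Q) ⟩
            Q * Q * 8                    ≤⟨ *-monoʳ-≤ (Q * Q) (≤ᵇ⇒≤ 8 16 _) ⟩
            Q * Q * 16                   ≤⟨ 16Q²≤N′ ⟩
            N′ ∎
            where
            open ≤-Reasoning
            expand : ∀ Q → Q * suc (2 * Q) + 5 ≡ Q * 1 + 2 * (Q * Q) + 5 * 1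
            expand = solve-∀
            collect : ∀ q → q + 2 * q + 5 * q ≡ q * 8
            collect = solve-∀
          N≤512Q² : N ≤ 512 * (Q * Q)
          N≤512Q² = begin
            N                              ≤⟨ N≤8N′ ⟩
            8 * N′                         ≤⟨ *-monoʳ-≤ 8 (<⇒≤ N′<) ⟩
            8 * (suc Q * suc Q * 16)       ≤⟨ *-monoʳ-≤ 8 (*-monoˡ-≤ 16 (*-mono-≤ 1+Q≤2Q 1+Q≤2Q)) ⟩
            8 * ((Q + Q) * (Q + Q) * 16)   ≡⟨ collect Q ⟩
            512 * (Q * Q) ∎
            where
            open ≤-Reasoning
            1+Q≤2Q : suc Q ≤ Q + Q
            1+Q≤2Q = +-monoˡ-≤ Q 1≤Q
            collect : ∀ Q → 8 * ((Q + Q) * (Q + Q) * 16) ≡ 512 * (Q * Q)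
            collect = solve-∀
          8184[p/Q⁴]<M : 8184 * (p / Q⁴) < M
          8184[p/Q⁴]<M = *-cancelˡ-< (512 * 512 * Q⁴) (8184 * (p / Q⁴)) M (begin-strict
            512 * 512 * Q⁴ * (8184 * (p / Q⁴))  ≡⟨ regroup (512 * 512) 8184 Q⁴ (p / Q⁴) ⟩
            512 * 512 * 8184 * (p / Q⁴ * Q⁴)    ≤⟨ *-monoʳ-≤ (512 * 512 * 8184) (m/n*n≤m p Q⁴) ⟩
            512 * 512 * 8184 * p                <⟨ large ⟩
            M * N * N                           ≤⟨ *-mono-≤ (*-monoʳ-≤ M N≤512Q²) N≤512Q² ⟩
            M * (512 * (Q * Q)) * (512 * (Q * Q)) ≡⟨ collect 512 M Q ⟩
            512 * 512 * Q⁴ * M ∎)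
            where
            open ≤-Reasoning
            regroup : ∀ k l q r → k * q * (l * r) ≡ k * l * (r * q)
            regroup = solve-∀
            collect : ∀ k M Q → M * (k * (Q * Q)) * (k * (Q * Q)) ≡ k * k * (Q * Q * (Q * Q)) * M
            collect = solve-∀
          -- The inequality is doubled, so that each of its two parts can be compared with one M.
          -- The coefficient 106392 = 32736 + 73656 arises from absorbing the constant term by 1 ≤
          -- X.
          M-large : 2 * (2046 * (C + 4 * (X + 2))) < M
          M-large = *-cancelˡ-< 2 _ M (begin-strict
            2 * (2 * (2046 * (suc (p / Q⁴) + 4 * (X + 2))))
              ≡⟨ expand (p / Q⁴) X ⟩
            8184 * (p / Q⁴) + (32736 * X + 73656 * 1)
              ≤⟨ +-monoʳ-≤ (8184 * (p / Q⁴)) (+-monoʳ-≤ (32736 * X) (*-monoʳ-≤ 73656 1≤X)) ⟩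
            8184 * (p / Q⁴) + (32736 * X + 73656 * X)
              ≡⟨ cong (_+_ (8184 * (p / Q⁴))) (*-distribʳ-+ X 32736 73656) ⟨
            8184 * (p / Q⁴) + 106392 * X
              <⟨ +-mono-<-≤ 8184[p/Q⁴]<M 106392X≤M ⟩
            M + M
              ≡⟨ cong (_+_ M) (+-identityʳ M) ⟨
            2 * M ∎)
            where
            open ≤-Reasoning
            expand : ∀ r X → 2 * (2 * (2046 * (suc r + 4 * (X + 2)))) ≡ 8184 * r + (32736 * X + 73656 * 1)
            expand = solve-∀

-- Exponents e/d, roots and the loss from divisors.

module Exponents where
  open DivisorBound
  open DivisorTables
  open Thresholds
  open import Data.Nat
  open import Data.Nat.Properties
  open import Data.Nat.Tactic.RingSolver using (solve-∀)
  open import Data.List using (List; []; length)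
  open import Data.Product using (_×_; _,_; ∃-syntax; proj₁; proj₂)
  open import Relation.Nullary using (yes; no; contradiction)
  open import Relation.Binary.PropositionalEquality

  ^-cancelʳ-< : ∀ {m n} d → m ^ d < n ^ d → m < n
  ^-cancelʳ-< d m^d<n^d = ≰⇒> λ n≤m → <⇒≱ m^d<n^d (^-monoˡ-≤ d n≤m)

  ^-cancelʳ-≤ : ∀ {m n} d .{{_ : NonZero d}} → m ^ d ≤ n ^ d → m ≤ n
  ^-cancelʳ-≤ d m^d≤n^d = ≮⇒≥ λ n<m → ≤⇒≯ m^d≤n^d (^-monoˡ-< d n<m)

  -- In terms of real powers: c ≤ p^(e/d) and p^(1 + e/d) < m. Both are compared through their d-th
  -- powers.
  cp<m : ∀ {p c m} d e → c ^ d ≤ p ^ e → p ^ (d + e) < m ^ d → c * p < m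
  cp<m {p} {c} {m} d e c^d≤p^e p^[d+e]<m^d = ^-cancelʳ-< d (begin-strict
    (c * p) ^ d     ≡⟨ ^-distrib-* c p d ⟩
    c ^ d * p ^ d   ≤⟨ *-monoˡ-≤ (p ^ d) c^d≤p^e ⟩
    p ^ e * p ^ d   ≡⟨ *-comm (p ^ e) (p ^ d) ⟩
    p ^ d * p ^ e   ≡⟨ ^-distribˡ-+-* p d e ⟨
    p ^ (d + e)     <⟨ p^[d+e]<m^d ⟩
    m ^ d ∎)
    where open ≤-Reasoning

  divisorTable : ∀ k .{{_ : NonZero k}} C → (∀ n → .{{NonZero n}} → FewDivisors k C n) → ∀ B τ → C * B < suc τ ^ k → DivisorTable B τ
  divisorTable k C few B τ CB< = record { divisors = divisors ; complete = complete ; short = short }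
    where
    divisors : ℕ → List ℕ
    divisors zero      = []
    divisors n@(suc _) with n ≤? B
    ... | yes _ = proj₁ (few n)
    ... | no  _ = []
    complete : ∀ n → .{{NonZero n}} → n ≤ B → ContainsDivisors n (divisors n)
    complete n@(suc _) n≤B d∣n with n ≤? B
    ... | yes _   = proj₁ (proj₂ (few n)) d∣n
    ... | no  n≰B = contradiction n≤B n≰B
    short : ∀ n → length (divisors n) ≤ τ
    short zero      = z≤n
    short n@(suc _) with n ≤? B
    ... | no  _   = z≤n
    ... | yes n≤B = ≤-pred (^-cancelʳ-< k (≤-<-trans (proj₂ (proj₂ (few n))) (≤-<-trans (*-monoʳ-≤ C n≤B) CB<)))

  root : ∀ k .{{_ : NonZero k}} n → 1 ≤ n → ∃[ τ ] (0 < τ × τ ^ k ≤ n × n < suc τ ^ k)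
  root k n 1≤n with crossing (λ i → suc i ^ k) n n (≤-trans (≤-reflexive (^-zeroˡ k)) 1≤n)
                      (<-≤-trans (n<1+n n) (≤-trans (≤-reflexive (sym (*-identityʳ (suc n)))) (^-monoʳ-≤ (suc n) (>-nonZero⁻¹ k))))
  ... | i , ≤n , n< = suc i , s≤s z≤n , ≤n , n<

  -- With k = 18 d the divisor bound τ = O(p^(2/k)) makes the loss τ⁶ less than p^(1/d).
  loss≤p : ∀ {τ p C K} d → τ ^ (6 * (d * 3)) ≤ C * (2 * p * (2 * p)) → 4 * C * K ^ (d * 3) ≤ p →
    (K * (τ * τ * (τ * τ) * (τ * τ))) ^ d ≤ p
  -- Cubing makes room for the constants: τ^(18d) is O(p²), and against p³ one factor p is left to
  -- absorb them.
  loss≤p {τ} {p} {C} {K} d τ^k≤ large = ^-cancelʳ-≤ 3 (begin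
    ((K * τ⁶) ^ d) ^ 3                             ≡⟨ ^-*-assoc (K * τ⁶) d 3 ⟩
    (K * τ⁶) ^ (d * 3)                             ≡⟨ ^-distrib-* K τ⁶ (d * 3) ⟩
    K ^ (d * 3) * τ⁶ ^ (d * 3)                     ≡⟨ cong (λ t → K ^ (d * 3) * t ^ (d * 3)) (sixth τ) ⟩
    K ^ (d * 3) * (τ ^ 6) ^ (d * 3)                ≡⟨ cong (K ^ (d * 3) *_) (^-*-assoc τ 6 (d * 3)) ⟩
    K ^ (d * 3) * τ ^ (6 * (d * 3))                ≤⟨ *-monoʳ-≤ (K ^ (d * 3)) τ^k≤ ⟩
    K ^ (d * 3) * (C * (2 * p * (2 * p)))          ≡⟨ regroup (K ^ (d * 3)) C p ⟩
    4 * C * K ^ (d * 3) * (p * p)                  ≤⟨ *-monoˡ-≤ (p * p) large ⟩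
    p * (p * p)                                    ≡⟨ cong (λ q → p * (p * q)) (*-identityʳ p) ⟨
    p ^ 3 ∎)
    where
    open ≤-Reasoning
    τ⁶ = τ * τ * (τ * τ) * (τ * τ)
    sixth : ∀ τ → τ * τ * (τ * τ) * (τ * τ) ≡ τ * (τ * (τ * (τ * (τ * (τ * 1)))))
    sixth = solve-∀
    regroup : ∀ x C p → x * (C * (2 * p * (2 * p))) ≡ 4 * C * x * (p * p)
    regroup = solve-∀

-- Choosing between the regimes.

module Dichotomy (p : ℕ) (p-prime : Prime p) where
  open Representations p p-prime
  open Regimes p p-prime
  open import Data.Nat
  open import Data.Nat.Properties
  open import Data.Nat.Tactic.RingSolver using (solve-∀)
  open import Data.Integer using (ℤ)
  open import Relation.Nullary using (Dec; yes; no)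
  open import Relation.Binary.PropositionalEquality

  -- `L` and `K` are variables tied down by equations, so the large numerals stay opaque in what
  -- follows.
  module _ (a b : ℤ) (M N : ℕ) (M≤p : M ≤ p) (N≤p : N ≤ p) (λ₀ : ℤ) (L K τ : ℕ) (0<τ : 0 < τ)
    (table : DivisorTables.DivisorTable (2 * p * (2 * p)) τ) (L≡ : L ≡ 106392) (K≡ : K ≡ 574464 * (512 * (L * L)))
    (4L²≤K : 4 * L * (4 * L) ≤ K) (64²≤K : 64 * 64 ≤ K) (c≤K : 512 * 512 * 8184 ≤ K)
    (24<p : 24 < p)
    (large₁ : K * (τ * τ * (τ * τ) * (τ * τ)) * p < M * M * N)
    (large₂ : K * (τ * τ * (τ * τ) * (τ * τ)) * p < M * N * N) where

    private
      τ⁶ = τ * τ * (τ * τ) * (τ * τ)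

      Kp≤ : K * p ≤ K * τ⁶ * p
      Kp≤ = *-monoˡ-≤ p (m≤m*n K τ⁶ {{>-nonZero (*-mono-< (*-mono-< (*-mono-< 0<τ 0<τ) (*-mono-< 0<τ 0<τ)) (*-mono-< 0<τ 0<τ))}})

      -- As N ≤ p, the factor N cancels from K p < M² N. Thus M exceeds an absolute constant, which
      -- makes the division by 4L harmless.
      K<M² : K < M * M
      K<M² = *-cancelʳ-< N K (M * M) (≤-<-trans (*-monoʳ-≤ K N≤p) (≤-<-trans Kp≤ large₁))

      K<N² : K < N * N
      K<N² = *-cancelʳ-< M K (N * N) (≤-<-trans (*-monoʳ-≤ K M≤p) (≤-<-trans Kp≤ (<-≤-trans large₂ (≤-reflexive (rotate M N)))))
        where
        rotate : ∀ M N → M * N * N ≡ N * N * M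
        rotate = solve-∀

      64≤N : 64 ≤ N
      64≤N = <⇒≤ (m*m<n*n⇒m<n (≤-<-trans 64²≤K K<N²))

      decide : Dec (L * L * p ≤ M * M) → SumOfEightFractions a M b N λ₀
      decide (yes L²p≤M²) = long a b M N M≤p N≤p λ₀ 24<p 64≤N (subst (λ L → L * L * p ≤ M * M) L≡ L²p≤M²)
        (≤-<-trans (*-monoˡ-≤ p c≤K) (≤-<-trans Kp≤ large₂))
      decide (no L²p≰M²) = short a b M N M≤p N≤p λ₀ 0<τ table L {{subst NonZero (sym L≡) _}}
        (<⇒≤ (m*m<n*n⇒m<n (≤-<-trans 4L²≤K K<M²))) (≤-trans (≤ᵇ⇒≤ 4 64 _) 64≤N) (≰⇒> L²p≰M²)
        (subst (λ K → K * τ⁶ * p < M * M * N) K≡ large₁) (subst (λ K → K * τ⁶ * p < M * N * N) K≡ large₂)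

    eightFractions : SumOfEightFractions a M b N λ₀
    eightFractions = decide (L * L * p ≤? M * M)

open import Defs

-- Translation to residues of natural numbers.

module Conversion (p : ℕ) (p-prime : Prime p) where
  open Sums
  open Modular p p-prime
  open Representations p p-prime
  open import Data.Integer
  open import Data.Integer.Properties
  open import Data.Integer.Divisibility.Signed
  open import Data.Integer.Tactic.RingSolver using (solve-∀)
  open import Data.List using (List; []; _∷_; allFin)
  open import Data.Fin using (Fin; toℕ)
  import Data.Nat as ℕ
  open import Data.Nat.DivMod using (m≡m%n+[m/n]*n; m%n<n)
  open import Data.Product using (Σ; _×_; _,_)
  open import Relation.Binary.PropositionalEquality

  ≋-% : ∀ m → + m ≋ + (m ℕ.% p)
  ≋-% m = mk (divides (+ (m ℕ./ p)) (trans (cong (λ n → + n - + (m ℕ.% p)) (m≡m%n+[m/n]*n m p))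
    (trans (cancel (+ (m ℕ.% p)) (+ (m ℕ./ p ℕ.* p))) (pos-* (m ℕ./ p) p))))
    where
    cancel : ∀ r q → r + q - r ≡ q
    cancel = solve-∀

  ≋⇒ModEq : ∀ {m n} → + m ≋ + n → ModEq p m n
  ≋⇒ModEq {m} {n} m≋n = ≋⇒toℕ≡ (m%n<n m p) (m%n<n n p) (≋-trans (≋-sym (≋-% m)) (≋-trans m≋n (≋-% n)))

  ModEq⇒≋ : ∀ {m n} → ModEq p m n → + m ≋ + n
  ModEq⇒≋ {m} {n} eq = ≋-trans (≋-% m) (≋-trans (≋-reflexive (cong +_ eq)) (≋-sym (≋-% n)))

  ∑-cong-≋ : ∀ {A : Set} (as : List A) {f g : A → ℤ} → (∀ a → f a ≋ g a) → ∑ as f ≋ ∑ as g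
  ∑-cong-≋ []       f≋g = ≋-refl
  ∑-cong-≋ (a ∷ as) f≋g = +-cong (f≋g a) (∑-cong-≋ as f≋g)

  convert : ∀ {a M b N λ₀} → SumOfEightFractions (+ a) M (+ b) N (+ λ₀) →
    Σ (Fin 8 → ℕ) λ x → Σ (Fin 8 → ℕ) λ y → Σ (Fin 8 → ℕ) λ z →
      ((∀ i → InInterval p a M (x i)) × (∀ i → InInterval p b N (y i)) ×
       (∀ i → IsFraction p (z i) (x i) (y i)) × ModEq p (Σ[ 8 ] z) λ₀)
  convert {a} {M} {b} {N} {λ₀} (i , j , i<M , j<N , units , eq) = x , y , z ,
    (λ t → i t , i<M t , refl) , (λ t → j t , j<N t , refl) ,
    (λ t → (λ y≡0 → units t (≋0⇒∣ (ModEq⇒≋ y≡0))) , ≋⇒ModEq (zy≋x t)) ,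
    ≋⇒ModEq (≋-trans (∑-cong-≋ (allFin 8) z≋) eq)
    where
    x y z : Fin 8 → ℕ
    x t = a ℕ.+ i t
    y t = b ℕ.+ j t
    z t = toℕ (residue (+ x t * inv (+ y t)))
    z≋ : ∀ t → + z t ≋ + x t * inv (+ y t)
    z≋ t = ≋-sym (≋-residue (+ x t * inv (+ y t)))
    zy≋x : ∀ t → + (z t ℕ.* y t) ≋ + x t
    zy≋x t = ≋-trans (≋-reflexive (pos-* (z t) (y t))) (≋-trans (*-cong (z≋ t) (≋-refl {+ y t}))
      (≋-trans (≋-reflexive (regroup (+ x t) (inv (+ y t)) (+ y t))) (≋-trans (*-cong (≋-refl {+ x t}) (inv-inverse (units t))) (≋-reflexive (*-identityʳ (+ x t))))))
      where
      regroup : ∀ x e y → x * e * y ≡ x * (y * e)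
      regroup = solve-∀

open import Data.Nat using (_+_; _*_; _^_; _≤_; _<_; _>_; NonZero)
open import Data.Fin using (Fin)
open import Data.Product using (Σ; _×_; _,_; ∃-syntax)
open import Relation.Nullary using (¬_)

-- Choice of the threshold p₀.

module Threshold (e d : ℕ) (1≤e : 1 ≤ e) (1≤d : 1 ≤ d) where
  open Exponents
  open DivisorBound
  open import Data.Nat using (suc; >-nonZero; s≤s; z≤n)
  open import Data.Nat.Properties
  open import Data.Integer using (+_)
  open import Data.Product using (proj₁; proj₂)
  open import Relation.Binary.PropositionalEquality using (_≡_; refl; sym; cong)

  -- Numerators are long when M ≥ L √p; K collects the constants lost in the energy estimates and in
  -- shrinking the intervals.
  L K k C p₀ : ℕ
  L = 106392
  K = 574464 * (512 * (L * L))
  k = 6 * (d * 3)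

  instance
    k≢0 : NonZero k
    k≢0 = m*n≢0 6 (d * 3) {{_}} {{m*n≢0 d 3 {{>-nonZero 1≤d}}}}

  few : ∀ n → .{{NonZero n}} → FewDivisors k (proj₁ (divisorBound k)) n
  few = proj₂ (divisorBound k)

  -- The successor makes `C` positive, as taking the k-th root of C B requires 1 ≤ C B.
  C = suc (proj₁ (divisorBound k))
  -- The first summand absorbs the constants in `loss≤p`; the second makes 24 invertible for the
  -- interpolation.
  p₀ = 4 * C * K ^ (d * 3) + 24

  few′ : ∀ n → .{{NonZero n}} → FewDivisors k C n
  few′ n with few n
  ... | ds , ds-all , bound = ds , ds-all , ≤-trans bound (m≤n+m (proj₁ (divisorBound k) * n) n)

  module _ (p : ℕ) (p-prime : Prime p) (p>p₀ : p > p₀) (a M b N : ℕ) (M≤p : M ≤ p) (N≤p : N ≤ p)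
    (large₁ : (M * M * N) ^ d > p ^ (d + e)) (large₂ : (M * N * N) ^ d > p ^ (d + e)) (λ₀ : ℕ) where

    open Representations p p-prime

    24<p : 24 < p
    24<p = ≤-<-trans (m≤n+m 24 (4 * C * K ^ (d * 3))) p>p₀

    B : ℕ
    B = 2 * p * (2 * p)

    p≤p^e : p ≤ p ^ e
    p≤p^e = ≤-trans (≤-reflexive (sym (*-identityʳ p))) (^-monoʳ-≤ p {{>-nonZero (≤-trans (s≤s z≤n) 24<p)}} 1≤e)

    from-root : ∃[ τ ] (0 < τ × τ ^ k ≤ C * B × C * B < suc τ ^ k) → SumOfEightFractions (+ a) M (+ b) N (+ λ₀)
    from-root (τ , 0<τ , τ^k≤ , <τ+1^k) = Dichotomy.eightFractions p p-prime (+ a) (+ b) M N M≤p N≤p (+ λ₀) L K τ 0<τ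
      (divisorTable k C few′ B τ <τ+1^k) refl refl (≤ᵇ⇒≤ (4 * L * (4 * L)) K _) (≤ᵇ⇒≤ (64 * 64) K _) (≤ᵇ⇒≤ (512 * 512 * 8184) K _) 24<p
      (cp<m d e small large₁) (cp<m d e small large₂)
      where
      -- The loss is at most p^(1/d), hence at most p^(e/d) because 1 ≤ e.
      small : (K * (τ * τ * (τ * τ) * (τ * τ))) ^ d ≤ p ^ e
      small = ≤-trans (loss≤p {τ} {p} {C} {K} d τ^k≤ (≤-trans (m≤m+n (4 * C * K ^ (d * 3)) 24) (<⇒≤ p>p₀))) p≤p^e

    representation : SumOfEightFractions (+ a) M (+ b) N (+ λ₀)
    representation = from-root (root k (C * B) (*-mono-≤ {1} {C} {1} {B} (s≤s z≤n) (*-mono-≤ 1≤2p 1≤2p)))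
      where
      1≤2p : 1 ≤ 2 * p
      1≤2p = ≤-trans (≤-trans (s≤s z≤n) 24<p) (m≤n*m p 2)

-- The rational e/d plays the part of ε, and d-th powers express the exponent 1 + e/d. Any real ε >
-- 0 has such a rational below it, for which the size conditions are weaker.
theorem1 : (e d : ℕ) → 1 ≤ e → 1 ≤ d →
    ∃[ p₀ ] ((p : ℕ) .{{_ : NonZero p}} → Prime p → p > p₀ →
    (a M b N : ℕ) → 1 ≤ M → M ≤ p → 1 ≤ N → N ≤ p →
    ¬ IsZeroInterval p a M → ¬ IsZeroInterval p b N →
    (M * M * N) ^ d > p ^ (d + e) →
    (M * N * N) ^ d > p ^ (d + e) →
    (λ₀ : ℕ) →
    Σ (Fin 8 → ℕ) λ x → Σ (Fin 8 → ℕ) λ y → Σ (Fin 8 → ℕ) λ z →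
    ((∀ (i : Fin 8) → InInterval p a M (x i)) ×
    (∀ (i : Fin 8) → InInterval p b N (y i)) ×
    (∀ (i : Fin 8) → IsFraction p (z i) (x i) (y i)) ×
    ModEq p (Σ[ 8 ] z) λ₀))
theorem1 e d 1≤e 1≤d = Threshold.p₀ e d 1≤e 1≤d ,
  λ p p-prime p>p₀ a M b N _ M≤p _ N≤p _ _ large₁ large₂ λ₀ →
    Conversion.convert p p-prime (Threshold.representation e d 1≤e 1≤d p p-prime p>p₀ a M b N M≤p N≤p large₁ large₂ λ₀)
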